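{- Let $G=(V,E)$ be a connected, loopless and bridgeless graph with $n$ vertices and $m$ edges, and write $T(G;x,y)=\sum_{i,j}t_{i,j}x^iy^j$. Let $p(G)$ be the number of parallel classes and $p^*(G)$ the number of non-trivial parallel classes of $G$, and let $\Delta(\tilde G)$ be the number of triangles of $\tilde G$, the simple graph obtained from $G$ by replacing each parallel class by a single edge. Then \begin{enumerate} \item $t_{n-1,0}=1$; \item $t_{n-2,0}=p(G)-n+1$; \item $t_{n-3,0}=\binom{n-1}{2}-(n-2)\,p(G)+\binom{p(G)}{2}-\Delta(\tilde G)$; \item $t_{n-2,1}=p^*(G)$; \item $t_{n-3,1}=-p^*(G)(n-2)+\sum_{A}p(G/A)+\Delta(\tilde G)$, where the sum runs over all non-trivial parallel classes $A\subseteq E$ of $G$ and $G/A$ is the graph obtained by contracting all edges of $A$. \end{enumerate}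
   Context: Graphs are finite and may have parallel edges. The Tutte polynomial is $T(G;x,y)=\sum_{A\subseteq E}(x-1)^{\rho(E)-\rho(A)}(y-1)^{\gamma(A)}$, where for $A\subseteq E$, $c(A)$ is the number of connected components of the spanning subgraph $(V,A)$, $\rho(A)=|V|-c(A)$, $\gamma(A)=|A|-|V|+c(A)$. A parallel class of $G$ is a maximal subset of $E$ all of whose edges have the same pair of endvertices; parallel classes partition $E$. A parallel class is trivial if it has exactly one edge, non-trivial otherwise. -}

module Defs where

open import Algebra.Bundles.Raw using (RawRing)
import Algebra.Definitions.RawSemiring as RawSemiringDefinitions
open import Data.Fin.Base using (Fin; _<_)
open import Data.Fin.Properties using (_≟_; _<?_; any?; all?)
open import Data.Fin.Subset
  using (Subset; inside; outside; ⊤; _∈_; _⊆_; Nonempty; ∣_∣; _-_)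
open import Data.Fin.Subset.Properties
  using (_∈?_; _⊆?_; nonempty?; anySubset?)
open import Data.Integer.Base as ℤ using (ℤ; +_; -[1+_])
open import Data.List.Base
  using (List; []; _∷_; _++_; allFin; cartesianProduct; deduplicate; filter; foldr; length; lookup; map)
open import Data.List.Membership.Propositional renaming (_∈_ to _∈ᴸ_) using ()
open import Data.List.Membership.Propositional.Properties
  using (∈-allFin; ∈-lookup; ∈-filter⁻; ∈-map∘filter⁻; ∈-map∘filter⁺)
import Data.List.Membership.Setoid.Properties as SetoidMembership
import Data.List.Relation.Unary.Any as Any
open import Data.Nat.Base as ℕ using (ℕ; zero; suc; _∸_; _≤_)
import Data.Nat.Properties as ℕ
open import Data.Product.Base using (_×_; _,_; ∃-syntax; proj₁; swap)
open import Data.Product.Properties using (≡-dec)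
open import Data.Sum.Base using (_⊎_; inj₁; inj₂)
open import Data.Vec.Base using ([]; _∷_)
open import Level using (0ℓ)
open import Relation.Binary.Construct.Closure.Equivalence as EqClosure using (EqClosure)
open import Relation.Binary.Core using (Rel; _⇒_)
open import Relation.Binary.Definitions using (Decidable)
open import Relation.Binary.PropositionalEquality as ≡ using (_≡_; _≢_; refl; sym)
open import Relation.Binary.Structures using (IsEquivalence)
open import Relation.Nullary.Decidable
  using (Dec; ¬?; map′; _×-dec_; _⊎-dec_; _→-dec_; decidable-stable)
open import Relation.Nullary.Negation using (¬_)
import Relation.Unary as Unary

-- Polynomials over R as lists of coefficients, constant term first; lists
-- differing only in trailing zeros represent the same polynomial.
module Polynomials {c ℓ} (R : RawRing c ℓ) where
  open RawRing R

  Poly : Set c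
  Poly = List Carrier

  coeff : Poly → ℕ → Carrier
  coeff []      _       = 0#
  coeff (a ∷ p) zero    = a
  coeff (a ∷ p) (suc i) = coeff p i

  constant : Carrier → Poly
  constant a = a ∷ []

  X : Poly
  X = 0# ∷ 1# ∷ []

  _⊕_ : Poly → Poly → Poly
  []      ⊕ q       = q
  (a ∷ p) ⊕ []      = a ∷ p
  (a ∷ p) ⊕ (b ∷ q) = (a + b) ∷ (p ⊕ q)

  _⊗_ : Poly → Poly → Poly
  []      ⊗ q = []
  (a ∷ p) ⊗ q = map (a *_) q ⊕ (0# ∷ (p ⊗ q))

  polyRing : RawRing c ℓ
  polyRing = record
    { Carrier = Poly
    ; _≈_     = λ p q → ∀ i → coeff p i ≈ coeff q i
    ; _+_     = _⊕_
    ; _*_     = _⊗_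
    ; -_      = map (-_)
    ; 0#      = []
    ; 1#      = constant 1#
    }

-- ℤ[x,y] is (ℤ[x])[y].
module ℤ[x] = Polynomials ℤ.+-*-rawRing
module ℤ[x,y] = Polynomials ℤ[x].polyRing

private
  variable
    n m : ℕ

subsets : ∀ n → List (Subset n)
subsets zero    = [] ∷ []
subsets (suc n) = map (outside ∷_) (subsets n) ++ map (inside ∷_) (subsets n)

-- A multigraph with vertex set Fin n and edge set Fin m.  The order of the
-- two ends of an edge is irrelevant; loops are allowed.
record Graph (n m : ℕ) : Set where
  constructor graph
  field
    ends : Fin m → Fin n × Fin n

open Graph public

Joins : Graph n m → Fin m → Fin n → Fin n → Set
Joins G e u v = ends G e ≡ (u , v) ⊎ ends G e ≡ (v , u)

Loopless : Graph n m → Set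
Loopless G = ∀ e u → ¬ Joins G e u u

Adjacent : Graph n m → Fin n → Fin n → Set
Adjacent G u v = ∃[ e ] Joins G e u v

joins? : (G : Graph n m) → ∀ e → Decidable (Joins G e)
joins? G e u v =
  ≡-dec _≟_ _≟_ (ends G e) (u , v) ⊎-dec ≡-dec _≟_ _≟_ (ends G e) (v , u)

adjacent? : (G : Graph n m) → Decidable (Adjacent G)
adjacent? G u v = any? λ e → joins? G e u v

-- Linked G A u v: u and v lie in the same component of (V , A).
Linked : Graph n m → Subset m → Rel (Fin n) 0ℓ
Linked G A = EqClosure λ u v → ∃[ e ] e ∈ A × ends G e ≡ (u , v)

private
  ListLinked : List (Fin n × Fin n) → Rel (Fin n) 0ℓ
  ListLinked es = EqClosure λ u v → (u , v) ∈ᴸ es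

  -- u and v are linked using the additional edge ab at most once.
  Via : List (Fin n × Fin n) → (a b : Fin n) → Rel (Fin n) 0ℓ
  Via es a b u v = ListLinked es u v
    ⊎ (ListLinked es u a × ListLinked es b v)
    ⊎ (ListLinked es u b × ListLinked es a v)

  via-equivalence : (es : List (Fin n × Fin n)) → ∀ a b → IsEquivalence (Via es a b)
  via-equivalence es a b = record { refl = inj₁ ε ; sym = symm ; trans = tran }
    where
    open IsEquivalence (EqClosure.isEquivalence (λ u v → (u , v) ∈ᴸ es))
      using () renaming (refl to ε; sym to _⁻¹; trans to _∙_)

    symm : ∀ {u v} → Via es a b u v → Via es a b v u
    symm (inj₁ p)              = inj₁ (p ⁻¹)
    symm (inj₂ (inj₁ (p , q))) = inj₂ (inj₂ ((q ⁻¹) , (p ⁻¹)))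
    symm (inj₂ (inj₂ (p , q))) = inj₂ (inj₁ ((q ⁻¹) , (p ⁻¹)))

    tran : ∀ {u v w} → Via es a b u v → Via es a b v w → Via es a b u w
    tran (inj₁ p)              (inj₁ q)              = inj₁ (p ∙ q)
    tran (inj₁ p)              (inj₂ (inj₁ (q , r))) = inj₂ (inj₁ ((p ∙ q) , r))
    tran (inj₁ p)              (inj₂ (inj₂ (q , r))) = inj₂ (inj₂ ((p ∙ q) , r))
    tran (inj₂ (inj₁ (p , q))) (inj₁ r)              = inj₂ (inj₁ (p , (q ∙ r)))
    tran (inj₂ (inj₂ (p , q))) (inj₁ r)              = inj₂ (inj₂ (p , (q ∙ r)))
    tran (inj₂ (inj₁ (p , q))) (inj₂ (inj₁ (r , s))) = inj₂ (inj₁ (p , s))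
    tran (inj₂ (inj₁ (p , q))) (inj₂ (inj₂ (r , s))) = inj₁ (p ∙ s)
    tran (inj₂ (inj₂ (p , q))) (inj₂ (inj₁ (r , s))) = inj₁ (p ∙ s)
    tran (inj₂ (inj₂ (p , q))) (inj₂ (inj₂ (r , s))) = inj₂ (inj₂ (p , s))

  listLinked⇒via : (es : List (Fin n × Fin n)) → ∀ a b → ListLinked ((a , b) ∷ es) ⇒ Via es a b
  listLinked⇒via es a b = EqClosure.fold (via-equivalence es a b) step
    where
    step : ∀ {u v} → (u , v) ∈ᴸ ((a , b) ∷ es) → Via es a b u v
    step (Any.here refl) = inj₂ (inj₁ (EqClosure.reflexive _ , EqClosure.reflexive _))
    step (Any.there e)   = inj₁ (EqClosure.return e)

  via⇒listLinked : (es : List (Fin n × Fin n)) → ∀ a b → Via es a b ⇒ ListLinked ((a , b) ∷ es)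
  via⇒listLinked es a b = go
    where
    open IsEquivalence (EqClosure.isEquivalence (λ u v → (u , v) ∈ᴸ ((a , b) ∷ es)))
      using () renaming (sym to _⁻¹; trans to _∙_)
    lift : ListLinked es ⇒ ListLinked ((a , b) ∷ es)
    lift = EqClosure.map Any.there
    ab : ListLinked ((a , b) ∷ es) a b
    ab = EqClosure.return (Any.here refl)
    go : Via es a b ⇒ ListLinked ((a , b) ∷ es)
    go (inj₁ p)              = lift p
    go (inj₂ (inj₁ (p , q))) = lift p ∙ (ab ∙ lift q)
    go (inj₂ (inj₂ (p , q))) = lift p ∙ ((ab ⁻¹) ∙ lift q)

  listLinked? : (es : List (Fin n × Fin n)) → Decidable (ListLinked es)
  listLinked? [] u v = map′
    (λ { refl → EqClosure.reflexive _ })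
    (EqClosure.fold ≡.isEquivalence (λ ()))
    (u ≟ v)
  listLinked? ((a , b) ∷ es) u v =
    map′ (via⇒listLinked es a b) (listLinked⇒via es a b)
      (listLinked? es u v
        ⊎-dec (listLinked? es u a ×-dec listLinked? es b v)
        ⊎-dec (listLinked? es u b ×-dec listLinked? es a v))

linked? : (G : Graph n m) (A : Subset m) → Decidable (Linked G A)
linked? {m = m} G A u v = map′
  (EqClosure.map λ p → let e , _ , eq , e∈A = ∈-map∘filter⁻ (ends G) (_∈? A) {xs = allFin m} p in e , e∈A , sym eq)
  (EqClosure.map λ { (e , e∈A , eq) →
    ∈-map∘filter⁺ (ends G) (_∈? A) (e , ∈-allFin e , sym eq , e∈A) })
  (listLinked? (map (ends G) (filter (_∈? A) (allFin m))) u v)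

-- One vertex from each component of (V , A).
representatives : Graph n m → Subset m → List (Fin n)
representatives {n = n} G A = deduplicate (linked? G A) (allFin n)

c : Graph n m → Subset m → ℕ
c G A = length (representatives G A)

component : (G : Graph n m) (A : Subset m) → Fin n → Fin (c G A)
component G A v = Any.index {P = Linked G A v}
  (SetoidMembership.∈-deduplicate⁺ (EqClosure.setoid _) (linked? G A)
    (λ y~x z~x → EqClosure.transitive _ z~x (EqClosure.symmetric _ y~x))
    (Any.map (λ { refl → EqClosure.reflexive _ }) (∈-allFin v)))

Connected : Graph n m → Set
Connected {n = n} G = 1 ≤ n × (∀ u v → Linked G ⊤ u v)

Bridgeless : Graph n m → Set
Bridgeless G = ∀ e → ¬ (c G ⊤ ℕ.< c G (⊤ - e))

-- The subtractions below are never truncated: c(A) ≤ |V|, ρ(A) ≤ ρ(E) and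
-- |V| ≤ |A| + c(A).
ρ : Graph n m → Subset m → ℕ
ρ {n = n} G A = n ∸ c G A

γ : Graph n m → Subset m → ℕ
γ {n = n} G A = (∣ A ∣ ℕ.+ c G A) ∸ n

module _ {a ℓ} (R : RawRing a ℓ) where
  open RawRing R
  open RawSemiringDefinitions rawSemiring using (_^_)

  tutte : Graph n m → Carrier → Carrier → Carrier
  tutte {m = m} G x y = foldr _+_ 0# (map term (subsets m))
    where
    term : Subset m → Carrier
    term A = ((x + (- 1#)) ^ (ρ G ⊤ ∸ ρ G A)) * ((y + (- 1#)) ^ γ G A)

T : Graph n m → ℤ[x,y].Poly
T G = tutte ℤ[x,y].polyRing G (ℤ[x,y].constant ℤ[x].X) ℤ[x,y].X

-- t G i j is the coefficient of x^i y^j in T G, which is 0 when i or j is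
-- negative (n - 2 and n - 3 may be negative for small n).
t : Graph n m → ℤ → ℤ → ℤ
t G (+ i)    (+ j)    = ℤ[x].coeff (ℤ[x,y].coeff (T G) j) i
t G (+ i)    -[1+ j ] = + 0
t G -[1+ i ] j        = + 0

Parallel : Graph n m → Rel (Fin m) 0ℓ
Parallel G e f = ends G e ≡ ends G f ⊎ ends G e ≡ swap (ends G f)

AllParallel : Graph n m → Subset m → Set
AllParallel G A = ∀ e f → e ∈ A → f ∈ A → Parallel G e f

-- Nonemptiness only matters for the edgeless graph, where the empty set of
-- edges is not counted as a class.
ParallelClass : Graph n m → Subset m → Set
ParallelClass G A =
  Nonempty A × AllParallel G A × (∀ B → AllParallel G B → A ⊆ B → B ⊆ A)

Nontrivial : Subset m → Set
Nontrivial A = ∣ A ∣ ≢ 1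

parallel? : (G : Graph n m) → Decidable (Parallel G)
parallel? G e f =
  ≡-dec _≟_ _≟_ (ends G e) (ends G f) ⊎-dec ≡-dec _≟_ _≟_ (ends G e) (swap (ends G f))

allParallel? : (G : Graph n m) → Unary.Decidable (AllParallel G)
allParallel? G A =
  all? λ e → all? λ f → (e ∈? A) →-dec ((f ∈? A) →-dec parallel? G e f)

private
  allSubsets? : {P : Subset n → Set} → Unary.Decidable P → Dec (∀ A → P A)
  allSubsets? P? = map′
    (λ ¬∃¬P A → decidable-stable (P? A) λ ¬PA → ¬∃¬P (A , ¬PA))
    (λ ∀P (A , ¬PA) → ¬PA (∀P A))
    (¬? (anySubset? λ A → ¬? (P? A)))

parallelClass? : (G : Graph n m) → Unary.Decidable (ParallelClass G)
parallelClass? G A = nonempty? A ×-dec allParallel? G A ×-dec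
  allSubsets? λ B → allParallel? G B →-dec ((A ⊆? B) →-dec (B ⊆? A))

nontrivial? : Unary.Decidable (Nontrivial {m})
nontrivial? A = ¬? (∣ A ∣ ℕ.≟ 1)

parallelClasses : Graph n m → List (Subset m)
parallelClasses {m = m} G = filter (parallelClass? G) (subsets m)

nontrivialClasses : Graph n m → List (Subset m)
nontrivialClasses G = filter nontrivial? (parallelClasses G)

p : Graph n m → ℕ
p G = length (parallelClasses G)

p* : Graph n m → ℕ
p* G = length (nontrivialClasses G)

-- Each parallel class is replaced by one of its members.
simplification : (G : Graph n m) → Graph n (p G)
simplification {m = m} G = graph λ i → ends G (member i)
  where
  member : Fin (p G) → Fin m
  member i = let (_ , nonempty , _) = ∈-filter⁻ (parallelClass? G) {xs = subsets m} (∈-lookup i)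
             in proj₁ nonempty

-- In a simple graph, triangles correspond to sets of three pairwise adjacent
-- vertices, listed here in increasing order.
Triangle : Graph n m → Fin n × Fin n × Fin n → Set
Triangle G (u , v , w) =
  (u < v × v < w) × Adjacent G u v × Adjacent G v w × Adjacent G u w

triangle? : (G : Graph n m) → Unary.Decidable (Triangle G)
triangle? G (u , v , w) =
  (u <? v ×-dec v <? w) ×-dec adjacent? G u v ×-dec adjacent? G v w ×-dec adjacent? G u w

triangles : Graph n m → ℕ
triangles {n = n} G = length (filter (triangle? G)
  (cartesianProduct (allFin n) (cartesianProduct (allFin n) (allFin n))))

-- Contracting A identifies the vertices in each component of (V , A) and
-- deletes the edges of A.
remaining : Subset m → List (Fin m)
remaining {m = m} A = filter (λ e → ¬? (e ∈? A)) (allFin m)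

contract : (G : Graph n m) (A : Subset m) → Graph (c G A) (length (remaining A))
contract G A = graph λ i →
  let u , v = ends G (lookup (remaining A) i)
  in component G A u , component G A v

{-# OPTIONS --safe #-}

-- Only edge sets of rank at most k contribute to the coefficients of x^(n-1-k).
-- The sum of (y - 1)^γ(A) over the sets A of rank k obeys deletion-contraction
-- in the first edge e: sets avoiding e give the sum for G - e, the others the
-- sum for rank k - 1 in G / e.  Modulo y², a set of l loops contributes 1 if
-- l = 0, y if l = 1 and 0 otherwise, so that the rank 1 sum counts parallel
-- classes by their last edge and, in degree 1, non-trivial ones by their last
-- edge but one.  For rank 2 one needs the classes of G / e: contraction removes
-- the class of e and identifies the other two sides of every triangle on e.
-- Writing [e] = 1 if e has no parallel edge in G - e, the triangles obey
-- Δ(G) = Δ(G - e) + [e] #{common neighbours of the ends of e}, which makes both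
-- sides of the rank 2 identities satisfy the same recursion.
module Submission where

open import Defs
import Algebra.Bundles.Raw
import Algebra.Properties.Semiring.Sum as SemiringSum
open import Data.Bool.Base using (Bool; true; false; if_then_else_)
open import Data.Fin.Base as Fin using (Fin; zero; suc)
import Data.Fin.Properties as Fin
open import Data.Fin.Subset using (Subset; inside; outside; ∣_∣; ⊤; _⊆_)
import Data.Fin.Subset as Subset
import Data.Fin.Subset.Properties as Subset
open import Data.Integer.Base using (ℤ; +_; -[1+_]; _+_; _-_; _*_; -_)
import Data.Integer.Properties as ℤ
open import Data.Integer.Tactic.RingSolver using (solve-∀)
open import Data.List.Base
  using (List; []; _∷_; _++_; map; filter; length; tabulate; allFin; deduplicate; foldr; cartesianProduct)
import Data.List.Base as List
open import Data.List.Membership.Propositional using (_∈_)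
open import Data.List.Membership.Propositional.Properties
  using (∈-map⁺; ∈-map⁻; ∈-++⁺ˡ; ∈-++⁺ʳ; ∈-filter⁺; ∈-filter⁻; ∈-tabulate⁺; ∈-tabulate⁻; ∈-allFin; ∈-lookup)
open import Data.List.Membership.Propositional.Properties.WithK using (unique∧set⇒bag)
import Data.List.Membership.Setoid.Properties as SetoidMembership
open import Data.List.Properties
  using (map-∘; map-id; map-tabulate; tabulate-lookup; filter-≐; filter-all; filter-++; length-++; length-map; length-tabulate)
open import Data.List.Relation.Binary.BagAndSetEquality using (∼bag⇒↭)
open import Data.List.Relation.Binary.Permutation.Propositional using (_↭_)
open import Data.List.Relation.Binary.Permutation.Propositional.Properties
  using (↭-length) renaming (map⁺ to ↭-map⁺)
open import Data.List.Relation.Unary.All as All using (All; []; _∷_; lookup)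
import Data.List.Relation.Unary.All.Properties as All
open import Data.List.Relation.Unary.AllPairs as AllPairs using (AllPairs; []; _∷_)
import Data.List.Relation.Unary.AllPairs.Properties as AllPairs
open import Data.List.Relation.Unary.Any as Any using (Any; here; there; index)
import Data.List.Relation.Unary.Any.Properties as Any
open import Data.List.Relation.Unary.Unique.Propositional using (Unique)
import Data.List.Relation.Unary.Unique.Propositional.Properties as Unique
open import Data.Nat.Base as ℕ using (ℕ; zero; suc; _∸_)
open import Data.Nat.Combinatorics using (_C_; nCk+nC[k+1]≡[n+1]C[k+1]; nC1≡n)
open import Data.Nat.ListAction using (sum)
open import Data.Nat.ListAction.Properties using (sum-↭)
import Data.Nat.Properties as ℕ
open import Data.Product.Base as Prod using (_×_; _,_; proj₁; proj₂; swap; ∃)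
open import Data.Product.Properties using (≡-dec)
open import Data.Sum.Base using (_⊎_; inj₁; inj₂)
open import Data.Vec.Base as Vec using ()
import Data.Vec.Properties as Vec
open import Function.Base using (_∘_; id)
open import Function.Bundles using (mk⇔)
open import Level using (0ℓ)
open import Relation.Binary.Construct.Closure.Equivalence as EqClosure using (EqClosure)
open import Relation.Binary.Core using (Rel)
open import Relation.Binary.Definitions using (tri<; tri≈; tri>)
import Relation.Binary.Definitions as Binary
open import Relation.Binary.PropositionalEquality
  using (_≡_; _≢_; refl; sym; trans; cong; cong₂; subst; isEquivalence; module ≡-Reasoning)
open import Relation.Binary.Structures using (IsEquivalence)
open import Relation.Nullary.Decidable using (Dec; yes; no; does; dec-true; _⊎-dec_; _×-dec_; ¬?)
open import Relation.Nullary.Negation using (¬_; contradiction)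
import Relation.Unary as Unary

open import Algebra.Definitions.RawSemiring (Algebra.Bundles.Raw.RawRing.rawSemiring ℤ[x,y].polyRing) using (_^_)
open SemiringSum ℤ.+-*-semiring
  using (sum-cong-≗; ∑-distrib-+; ∑-comm; *-distribˡ-sum; sum-replicate-zero)
  renaming (sum to ∑)
open ≡-Reasoning

-- Deletion and contraction are carried out on lists of edges over a fixed vertex set. Contracting
-- `ab` relabels `b` as `a` and removes no vertex, so an iterated contraction is just a map `φ` on
-- `Fin n`. Rank is read off by contracting edge after edge, and is compared with the number of
-- components separately. All counts are 0-1 expressions in `is0` and `is1` of multiplicities, so
-- that each induction step becomes a polynomial identity in which only `z * z ≡ z` and
-- `z * o ≡ + 0` are special. The obstacle is the sum of p(G/A): a new edge alters every summand. It
-- is traded for `commons`, the numbers of common neighbours summed over the non-trivial classes.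
-- The growth of `commons` involves `mixed`, the common neighbours weighted by how many of their two
-- sides are multiple. The same `mixed` appears in the number of non-trivial classes of G / e, and
-- the two occurrences match.

private
  variable
    n m : ℕ
    A B : Set

-- Multiplicities and common neighbours in lists of edges

bit : Bool → ℤ
bit b = if b then + 1 else + 0

𝟙 : Dec A → ℤ
𝟙 d = bit (does d)

𝟙-cong : (a? : Dec A) (b? : Dec B) → (A → B) → (B → A) → 𝟙 a? ≡ 𝟙 b?
𝟙-cong (yes a) (yes b) f g = refl
𝟙-cong (yes a) (no ¬b) f g = contradiction (f a) ¬b
𝟙-cong (no ¬a) (yes b) f g = contradiction (g b) ¬a
𝟙-cong (no ¬a) (no ¬b) f g = refl

𝟙-true : (a? : Dec A) → A → 𝟙 a? ≡ + 1
𝟙-true (yes _) _ = refl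
𝟙-true (no ¬a) a = contradiction a ¬a

𝟙-false : (a? : Dec A) → ¬ A → 𝟙 a? ≡ + 0
𝟙-false (yes a) ¬a = contradiction a ¬a
𝟙-false (no _)  _  = refl

𝟙-× : (a? : Dec A) (b? : Dec B) → 𝟙 (a? ×-dec b?) ≡ 𝟙 a? * 𝟙 b?
𝟙-× (yes _) (yes _) = refl
𝟙-× (yes _) (no _)  = refl
𝟙-× (no _)  (yes _) = refl
𝟙-× (no _)  (no _)  = refl

𝟙-disjoint : (a? : Dec A) (b? : Dec B) → ¬ (A × B) → 𝟙 a? * 𝟙 b? ≡ + 0
𝟙-disjoint (yes a) (yes b) ¬ab = contradiction (a , b) ¬ab
𝟙-disjoint (yes _) (no _)  _   = refl
𝟙-disjoint (no _)  (yes _) _   = refl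
𝟙-disjoint (no _)  (no _)  _   = refl

-- The coefficients of y⁰ and y¹ in y^k, which is the sum of (y - 1)^|A| over all sets A of k loops.
-- Thus `is0-+` and `is1-+` are the product rule for y^j y^k modulo y². Applied to multiplicities
-- they indicate no parallel edge, respectively exactly one.
is0 is1 : ℕ → ℤ
is0 zero    = + 1
is0 (suc _) = + 0
is1 zero    = + 0
is1 (suc k) = is0 k

is0-idem : ∀ k → is0 k * is0 k ≡ is0 k
is0-idem zero    = refl
is0-idem (suc k) = refl

is0*is1 : ∀ k → is0 k * is1 k ≡ + 0
is0*is1 zero    = refl
is0*is1 (suc k) = refl

is0-+ : ∀ j k → is0 (j ℕ.+ k) ≡ is0 j * is0 k
is0-+ zero    k = sym (ℤ.*-identityˡ (is0 k))
is0-+ (suc j) k = refl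

is1-+ : ∀ j k → is1 (j ℕ.+ k) ≡ is1 j * is0 k + is0 j * is1 k
is1-+ zero    k = sym (trans (ℤ.+-identityˡ _) (ℤ.*-identityˡ (is1 k)))
is1-+ (suc j) k = trans (is0-+ j k) (sym (ℤ.+-identityʳ _))

length-filter-cong : {P Q : A → Set} (P? : Unary.Decidable P) (Q? : Unary.Decidable Q) →
  (∀ x → P x → Q x) → (∀ x → Q x → P x) →
  ∀ xs → length (filter P? xs) ≡ length (filter Q? xs)
length-filter-cong P? Q? f g xs = cong length (filter-≐ P? Q? ((λ {x} → f x) , (λ {x} → g x)) xs)

length-filter-⊎ : {P Q R : A → Set}
  (P? : Unary.Decidable P) (Q? : Unary.Decidable Q) (R? : Unary.Decidable R) →
  (∀ x → P x → Q x ⊎ R x) → (∀ x → Q x → P x) → (∀ x → R x → P x) → (∀ x → Q x → ¬ R x) →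
  ∀ xs → length (filter P? xs) ≡ length (filter Q? xs) ℕ.+ length (filter R? xs)
length-filter-⊎ P? Q? R? f g h d [] = refl
length-filter-⊎ P? Q? R? f g h d (x ∷ xs) with ih ← length-filter-⊎ P? Q? R? f g h d xs | P? x | Q? x | R? x
... | yes p | yes q | yes r = contradiction r (d x q)
... | yes p | yes q | no ¬r = cong suc ih
... | yes p | no ¬q | yes r = trans (cong suc ih) (sym (ℕ.+-suc _ _))
... | yes p | no ¬q | no ¬r with f x p
...   | inj₁ q = contradiction q ¬q
...   | inj₂ r = contradiction r ¬r
length-filter-⊎ P? Q? R? f g h d (x ∷ xs)
    | no ¬p | yes q | _     = contradiction (g x q) ¬p
length-filter-⊎ P? Q? R? f g h d (x ∷ xs)
    | no ¬p | no ¬q | yes r = contradiction (h x r) ¬p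
length-filter-⊎ P? Q? R? f g h d (x ∷ xs)
    | no ¬p | no ¬q | no ¬r = ih

filter-map : {P : B → Set} (P? : Unary.Decidable P) (f : A → B) → ∀ xs →
  filter P? (map f xs) ≡ map f (filter (λ x → P? (f x)) xs)
filter-map P? f []       = refl
filter-map P? f (x ∷ xs) with does (P? (f x))
... | true  = cong (f x ∷_) (filter-map P? f xs)
... | false = filter-map P? f xs

length-filter-map : {P : B → Set} (P? : Unary.Decidable P) (f : A → B) →
  ∀ xs → length (filter P? (map f xs)) ≡ length (filter (λ x → P? (f x)) xs)
length-filter-map P? f xs = trans (cong length (filter-map P? f xs)) (length-map f (filter (λ x → P? (f x)) xs))

δ : Fin n → Fin n → ℤ
δ u v = 𝟙 (u Fin.≟ v)

δ-refl : (u : Fin n) → δ u u ≡ + 1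
δ-refl u = 𝟙-true (u Fin.≟ u) refl

δ-≢ : {u v : Fin n} → u ≢ v → δ u v ≡ + 0
δ-≢ {u = u} {v} = 𝟙-false (u Fin.≟ v)

δ-sym : (u v : Fin n) → δ u v ≡ δ v u
δ-sym u v = 𝟙-cong (u Fin.≟ v) (v Fin.≟ u) sym sym

δ-suc : (u v : Fin n) → δ (suc u) (suc v) ≡ δ u v
δ-suc u v = 𝟙-cong (suc u Fin.≟ suc v) (u Fin.≟ v) Fin.suc-injective (cong suc)

∑-zero : {g : Fin n → ℤ} → (∀ w → g w ≡ + 0) → ∑ g ≡ + 0
∑-zero {n} eq = trans (sum-cong-≗ eq) (sum-replicate-zero n)

∑-δ : (u : Fin n) (g : Fin n → ℤ) → ∑ (λ w → δ w u * g w) ≡ g u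
∑-δ zero g = begin
  + 1 * g zero + ∑ (λ w → δ (suc w) zero * g (suc w))
    ≡⟨ cong₂ _+_ (ℤ.*-identityˡ (g zero)) (∑-zero λ w → ℤ.*-zeroˡ (g (suc w))) ⟩
  g zero + + 0 ≡⟨ ℤ.+-identityʳ _ ⟩
  g zero ∎
∑-δ (suc u) g = begin
  + 0 * g zero + ∑ (λ w → δ (suc w) (suc u) * g (suc w))
    ≡⟨ cong₂ _+_ (ℤ.*-zeroˡ (g zero)) (sum-cong-≗ λ w → cong (_* g (suc w)) (δ-suc w u)) ⟩
  + 0 + ∑ (λ w → δ w u * g (suc w)) ≡⟨ ℤ.+-identityˡ _ ⟩
  ∑ (λ w → δ w u * g (suc w)) ≡⟨ ∑-δ u (g ∘ suc) ⟩
  g (suc u) ∎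

Edge : ℕ → Set
Edge n = Fin n × Fin n

infix 4 _∥_ _∥?_

_∥_ : Edge n → Edge n → Set
e ∥ f = e ≡ f ⊎ e ≡ swap f

-- Abstract, so that decisions stay folded and with-abstraction finds them in goals.
abstract
  _∥?_ : (e f : Edge n) → Dec (e ∥ f)
  e ∥? f = ≡-dec Fin._≟_ Fin._≟_ e f ⊎-dec ≡-dec Fin._≟_ Fin._≟_ e (swap f)

∥-refl : {e : Edge n} → e ∥ e
∥-refl = inj₁ refl

∥-sym : {e f : Edge n} → e ∥ f → f ∥ e
∥-sym (inj₁ refl) = inj₁ refl
∥-sym (inj₂ refl) = inj₂ refl

∥-trans : {e f g : Edge n} → e ∥ f → f ∥ g → e ∥ g
∥-trans (inj₁ refl) q           = q
∥-trans (inj₂ refl) (inj₁ refl) = inj₂ refl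
∥-trans (inj₂ refl) (inj₂ refl) = inj₁ refl

NonLoop : Edge n → Set
NonLoop (u , v) = u ≢ v

abstract
  nonLoop? : Unary.Decidable (NonLoop {n})
  nonLoop? (u , v) = ¬? (u Fin.≟ v)

NonLoop-resp : {e f : Edge n} → e ∥ f → NonLoop e → NonLoop f
NonLoop-resp (inj₁ refl) u≢v = u≢v
NonLoop-resp (inj₂ refl) u≢v = u≢v ∘ sym

mult : Edge n → List (Edge n) → ℕ
mult e es = length (filter (e ∥?_) es)

mult-cong : {e f : Edge n} → e ∥ f → ∀ es → mult e es ≡ mult f es
mult-cong {e = e} {f} e∥f =
  length-filter-cong (e ∥?_) (f ∥?_) (λ _ → ∥-trans (∥-sym e∥f)) (λ _ → ∥-trans e∥f)

mult-∥ : {e f : Edge n} → e ∥ f → ∀ es → mult e (f ∷ es) ≡ suc (mult e es)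
mult-∥ {e = e} {f} e∥f es with e ∥? f
... | yes _ = refl
... | no ¬p = contradiction e∥f ¬p

mult-∦ : {e f : Edge n} → ¬ e ∥ f → ∀ es → mult e (f ∷ es) ≡ mult e es
mult-∦ {e = e} {f} e∦f es with e ∥? f
... | yes p = contradiction p e∦f
... | no _  = refl

mult-∈ : {e : Edge n} {es : List (Edge n)} → e ∈ es → is0 (mult e es) ≡ + 0
mult-∈ {e = e} {f ∷ es} e∈ with e ∥? f
... | yes _ = refl
mult-∈ (here refl) | no e∦f = contradiction ∥-refl e∦f
mult-∈ (there e∈)  | no _   = mult-∈ e∈

mult-loop : (u : Fin n) {es : List (Edge n)} → All NonLoop es → mult (u , u) es ≡ 0
mult-loop u []          = refl
mult-loop u (nl ∷ nls) = trans (mult-∦ (λ p → NonLoop-resp (∥-sym p) nl refl) _) (mult-loop u nls)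

nonloops : List (Edge n) → List (Edge n)
nonloops = filter nonLoop?

mult-nonloops : (e : Edge n) → NonLoop e → ∀ es → mult e (nonloops es) ≡ mult e es
mult-nonloops e nl [] = refl
mult-nonloops e nl (f ∷ es) with nonLoop? f
... | yes _ with does (e ∥? f)
...   | true  = cong suc (mult-nonloops e nl es)
...   | false = mult-nonloops e nl es
mult-nonloops e nl (f ∷ es) | no l =
  trans (mult-nonloops e nl es) (sym (mult-∦ (λ p → l (NonLoop-resp p nl)) es))

-- The parallel classes, respectively the non-trivial ones, counted at their
-- last edge, respectively their last edge but one.
classes classes* : List (Edge n) → ℤ
classes []        = + 0
classes (e ∷ es)  = is0 (mult e es) + classes es
classes* []       = + 0
classes* (e ∷ es) = is1 (mult e es) + classes* es

-- Both take only the values 0 and 1: `adj` indicates at least one edge between u and v, `dbl` at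
-- least two.
adj dbl : List (Edge n) → Fin n → Fin n → ℤ
adj es u v = + 1 - is0 (mult (u , v) es)
dbl es u v = adj es u v - is1 (mult (u , v) es)

adj-sym : (es : List (Edge n)) → ∀ u v → adj es u v ≡ adj es v u
adj-sym es u v = cong (λ k → + 1 - is0 k) (mult-cong (inj₂ refl) es)

adj-loop : {es : List (Edge n)} → All NonLoop es → ∀ u → adj es u u ≡ + 0
adj-loop nls u = cong (λ k → + 1 - is0 k) (mult-loop u nls)

ε : Edge n → Fin n → Fin n → ℤ
ε f u v = 𝟙 ((u , v) ∥? f)

ε-δ : (f : Edge n) → NonLoop f → ∀ u v →
  ε f u v ≡ δ v (proj₂ f) * δ u (proj₁ f) + δ v (proj₁ f) * δ u (proj₂ f)
ε-δ (a , b) a≢b u v = begin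
  𝟙 ((u , v) ∥? (a , b))
    ≡⟨ 𝟙-cong ((u , v) ∥? (a , b)) ((u Fin.≟ a ×-dec v Fin.≟ b) ⊎-dec (u Fin.≟ b ×-dec v Fin.≟ a))
         (λ { (inj₁ refl) → inj₁ (refl , refl) ; (inj₂ refl) → inj₂ (refl , refl) })
         (λ { (inj₁ (refl , refl)) → inj₁ refl ; (inj₂ (refl , refl)) → inj₂ refl }) ⟩
  𝟙 ((u Fin.≟ a ×-dec v Fin.≟ b) ⊎-dec (u Fin.≟ b ×-dec v Fin.≟ a))
    ≡⟨ cases ⟩
  δ v b * δ u a + δ v a * δ u b ∎
  where
  cases : 𝟙 ((u Fin.≟ a ×-dec v Fin.≟ b) ⊎-dec (u Fin.≟ b ×-dec v Fin.≟ a))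
    ≡ δ v b * δ u a + δ v a * δ u b
  cases with u Fin.≟ a | u Fin.≟ b | v Fin.≟ a | v Fin.≟ b
  ... | yes refl | yes refl | _        | _        = contradiction refl a≢b
  ... | _        | _        | yes refl | yes refl = contradiction refl a≢b
  ... | yes _    | no _     | yes _    | no _     = refl
  ... | yes _    | no _     | no _     | yes _    = refl
  ... | yes _    | no _     | no _     | no _     = refl
  ... | no _     | yes _    | yes _    | no _     = refl
  ... | no _     | yes _    | no _     | yes _    = refl
  ... | no _     | yes _    | no _     | no _     = refl
  ... | no _     | no _     | yes _    | no _     = refl
  ... | no _     | no _     | no _     | yes _    = refl
  ... | no _     | no _     | no _     | no _     = refl

-- Multiplicities matter only up to 2: a new edge changes `adj` just when it is the first of its
-- class, and `dbl` (in `dbl-∷`) just when it is the second. The weights are therefore the ones by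
-- which `classes` and `classes*` grow.
adj-∷ : (f : Edge n) (es : List (Edge n)) → ∀ u v →
  adj (f ∷ es) u v ≡ adj es u v + is0 (mult f es) * ε f u v
adj-∷ f es u v with (u , v) ∥? f
... | yes p rewrite mult-cong p es = lemma (is0 (mult f es))
  where
  lemma : ∀ z → + 1 ≡ + 1 - z + z * + 1
  lemma = solve-∀
... | no _ = lemma (adj es u v) (is0 (mult f es))
  where
  lemma : ∀ s z → s ≡ s + z * + 0
  lemma = solve-∀

dbl-∷ : (f : Edge n) (es : List (Edge n)) → ∀ u v →
  dbl (f ∷ es) u v ≡ dbl es u v + is1 (mult f es) * ε f u v
dbl-∷ f es u v with (u , v) ∥? f
... | yes p rewrite mult-cong p es = lemma (is0 (mult f es)) (is1 (mult f es))
  where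
  lemma : ∀ z o → + 1 - + 0 - z ≡ + 1 - z - o + o * + 1
  lemma = solve-∀
... | no _ = lemma (dbl es u v) (is1 (mult f es))
  where
  lemma : ∀ s z → s ≡ s + z * + 0
  lemma = solve-∀

-- The joint weight of the neighbours common to u and v.
link : (g h : Fin n → Fin n → ℤ) → Fin n → Fin n → ℤ
link g h u v = ∑ λ w → g u w * h v w

-- For a non-loop edge with ends u and w this is `h v w`, and it is 0 if u is not an end: the part
-- of `link` in which the given edge is the side at u.
corner : (h : Fin n → Fin n → ℤ) → Fin n → Fin n → Edge n → ℤ
corner h u v (a , b) = δ u a * h v b + δ u b * h v a

corner-cong : (h : Fin n → Fin n → ℤ) → ∀ u v {e f : Edge n} → e ∥ f → corner h u v e ≡ corner h u v f
corner-cong h u v (inj₁ refl) = refl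
corner-cong h u v {f = a , b} (inj₂ refl) = ℤ.+-comm (δ u b * h v a) (δ u a * h v b)

link-ε : (f : Edge n) → NonLoop f → (h : Fin n → Fin n → ℤ) → ∀ u v → link (ε f) h u v ≡ corner h u v f
link-ε f@(a , b) nl h u v = begin
  ∑ (λ w → ε f u w * h v w)
    ≡⟨ sum-cong-≗ (λ w → trans (cong (_* h v w) (ε-δ f nl u w)) (lemma (δ w b) (δ u a) (δ w a) (δ u b) (h v w))) ⟩
  ∑ (λ w → δ w b * (δ u a * h v w) + δ w a * (δ u b * h v w))
    ≡⟨ ∑-distrib-+ (λ w → δ w b * (δ u a * h v w)) (λ w → δ w a * (δ u b * h v w)) ⟩
  ∑ (λ w → δ w b * (δ u a * h v w)) + ∑ (λ w → δ w a * (δ u b * h v w))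
    ≡⟨ cong₂ _+_ (∑-δ b (λ w → δ u a * h v w)) (∑-δ a (λ w → δ u b * h v w)) ⟩
  δ u a * h v b + δ u b * h v a ∎
  where
  lemma : ∀ p q r s t → (p * q + r * s) * t ≡ p * (q * t) + r * (s * t)
  lemma = solve-∀

link-cong : {g g′ h h′ : Fin n → Fin n → ℤ} → (∀ u w → g u w ≡ g′ u w) → (∀ u w → h u w ≡ h′ u w) →
  ∀ u v → link g h u v ≡ link g′ h′ u v
link-cong p q u v = sum-cong-≗ λ w → cong₂ _*_ (p u w) (q v w)

-- `link` is bilinear, and the product of the two increments drops out: as u and v differ, one edge
-- cannot join both of them to the same w.
link-step : (f : Edge n) → NonLoop f → (g h : Fin n → Fin n → ℤ) (p q : ℤ) → ∀ {u v} → u ≢ v →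
  link (λ x w → g x w + p * ε f x w) (λ x w → h x w + q * ε f x w) u v
    ≡ link g h u v + p * corner h u v f + q * corner g v u f
link-step f nl g h p q {u} {v} u≢v = begin
  ∑ (λ w → (g u w + p * ε f u w) * (h v w + q * ε f v w))
    ≡⟨ sum-cong-≗ (λ w → lemma (g u w) (h v w) p q (ε f u w) (ε f v w) (𝟙-disjoint ((u , w) ∥? f) ((v , w) ∥? f) (disj w))) ⟩
  ∑ (λ w → g u w * h v w + p * (ε f u w * h v w) + q * (ε f v w * g u w))
    ≡⟨ ∑-distrib-+ _ (λ w → q * (ε f v w * g u w)) ⟩
  ∑ (λ w → g u w * h v w + p * (ε f u w * h v w)) + ∑ (λ w → q * (ε f v w * g u w))
    ≡⟨ cong₂ _+_
         (trans (∑-distrib-+ _ (λ w → p * (ε f u w * h v w)))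
                (cong (λ t → link g h u v + t) (trans (sym (*-distribˡ-sum p λ w → ε f u w * h v w)) (cong (p *_) (link-ε f nl h u v)))))
         (trans (sym (*-distribˡ-sum q λ w → ε f v w * g u w)) (cong (q *_) (link-ε f nl g v u))) ⟩
  link g h u v + p * corner h u v f + q * corner g v u f ∎
  where
  disj : ∀ w → ¬ ((u , w) ∥ f × (v , w) ∥ f)
  disj w (p , q) with ∥-trans p (∥-sym q)
  ... | inj₁ refl = u≢v refl
  ... | inj₂ refl = u≢v refl
  lemma : ∀ g h p q x y → x * y ≡ + 0 → (g + p * x) * (h + q * y) ≡ g * h + p * (x * h) + q * (y * g)
  lemma g h p q x y eq = begin
    (g + p * x) * (h + q * y) ≡⟨ expand g h p q x y ⟩
    g * h + p * (x * h) + q * (y * g) + p * q * (x * y) ≡⟨ cong (λ t → g * h + p * (x * h) + q * (y * g) + p * q * t) eq ⟩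
    g * h + p * (x * h) + q * (y * g) + p * q * + 0 ≡⟨ tidy (g * h + p * (x * h) + q * (y * g)) (p * q) ⟩
    g * h + p * (x * h) + q * (y * g) ∎
    where
    expand : ∀ g h p q x y → (g + p * x) * (h + q * y) ≡ g * h + p * (x * h) + q * (y * g) + p * q * (x * y)
    expand = solve-∀
    tidy : ∀ s t → s + t * + 0 ≡ s
    tidy = solve-∀

-- Since `dbl` implies `adj`, `mixed` counts each common neighbour w once for each of the sides uw
-- and vw that is a multiple edge.
common mixed : List (Edge n) → Edge n → ℤ
common es (u , v) = link (adj es) (adj es) u v
mixed es (u , v)  = link (dbl es) (adj es) u v + link (adj es) (dbl es) u v

corners : (h : Fin n → Fin n → ℤ) → Edge n → Edge n → ℤ
corners h (u , v) f = corner h u v f + corner h v u f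

common-∷ : (f : Edge n) → NonLoop f → ∀ es (e : Edge n) → NonLoop e →
  common (f ∷ es) e ≡ common es e + is0 (mult f es) * corners (adj es) e f
common-∷ f nl es (u , v) u≢v = begin
  link (adj (f ∷ es)) (adj (f ∷ es)) u v
    ≡⟨ link-cong (adj-∷ f es) (adj-∷ f es) u v ⟩
  _ ≡⟨ link-step f nl (adj es) (adj es) z z u≢v ⟩
  link (adj es) (adj es) u v + z * corner (adj es) u v f + z * corner (adj es) v u f
    ≡⟨ lemma (common es (u , v)) z (corner (adj es) u v f) (corner (adj es) v u f) ⟩
  _ ∎
  where
  z = is0 (mult f es)
  lemma : ∀ c z x y → c + z * x + z * y ≡ c + z * (x + y)
  lemma = solve-∀

mixed-∷ : (f : Edge n) → NonLoop f → ∀ es (e : Edge n) → NonLoop e →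
  mixed (f ∷ es) e ≡ mixed es e + is1 (mult f es) * corners (adj es) e f + is0 (mult f es) * corners (dbl es) e f
mixed-∷ f nl es (u , v) u≢v = begin
  link (dbl (f ∷ es)) (adj (f ∷ es)) u v + link (adj (f ∷ es)) (dbl (f ∷ es)) u v
    ≡⟨ cong₂ _+_ (link-cong (dbl-∷ f es) (adj-∷ f es) u v) (link-cong (adj-∷ f es) (dbl-∷ f es) u v) ⟩
  _ ≡⟨ cong₂ _+_ (link-step f nl (dbl es) (adj es) o z u≢v) (link-step f nl (adj es) (dbl es) z o u≢v) ⟩
  _ ≡⟨ lemma (link (dbl es) (adj es) u v) (link (adj es) (dbl es) u v) o z
         (corner (adj es) u v f) (corner (dbl es) v u f) (corner (dbl es) u v f) (corner (adj es) v u f) ⟩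
  _ ∎
  where
  z = is0 (mult f es)
  o = is1 (mult f es)
  lemma : ∀ x y o z a b c d →
    x + o * a + z * b + (y + z * c + o * d) ≡ x + y + o * (a + d) + z * (c + b)
  lemma = solve-∀

-- Contraction

-- Contraction without a change of vertex set: b is sent to a and, when the two differ, stays behind
-- as an isolated vertex.
merge : (a b : Fin n) → Fin n → Fin n
merge a b v = if does (v Fin.≟ b) then a else v

mergeᴱ : (a b : Fin n) → Edge n → Edge n
mergeᴱ a b = Prod.map (merge a b) (merge a b)

merge-hit : (a b : Fin n) → merge a b b ≡ a
merge-hit a b with b Fin.≟ b
... | yes _  = refl
... | no b≢b = contradiction refl b≢b

merge-miss : (a : Fin n) {b v : Fin n} → v ≢ b → merge a b v ≡ v
merge-miss a {b} {v} v≢b with v Fin.≟ b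
... | yes v≡b = contradiction v≡b v≢b
... | no _    = refl

merge-fix : (a b : Fin n) → merge a b a ≡ a
merge-fix a b with a Fin.≟ b
... | yes _ = refl
... | no _  = refl

merge-ends : (a b : Fin n) → merge a b a ≡ merge a b b
merge-ends a b = trans (merge-fix a b) (sym (merge-hit a b))

merge-≡ : (a b : Fin n) → ∀ {u v} → merge a b u ≡ merge a b v → u ≢ v → (u , v) ∥ (a , b)
merge-≡ a b {u} {v} eq u≢v with u Fin.≟ b | v Fin.≟ b
... | yes refl | yes refl = contradiction refl u≢v
... | yes refl | no _     = inj₂ (cong (b ,_) (sym eq))
... | no _     | yes refl = inj₁ (cong (_, b) eq)
... | no _     | no _     = contradiction eq u≢v

merge-apart : {a b u v : Fin n} → u ≢ a → u ≢ b → merge a b u ≡ merge a b v → u ≡ v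
merge-apart {a = a} {b} {u} {v} u≢a u≢b eq with u Fin.≟ v
... | yes u≡v = u≡v
... | no u≢v with merge-≡ a b eq u≢v
...   | inj₁ refl = contradiction refl u≢a
...   | inj₂ refl = contradiction refl u≢b

merge-fibre : (a b : Fin n) → ∀ {u v} → u ≡ a ⊎ u ≡ b → merge a b u ≡ merge a b v → v ≡ a ⊎ v ≡ b
merge-fibre a b {u} {v} u∈ eq with u Fin.≟ v
... | yes refl = u∈
... | no u≢v with merge-≡ a b eq u≢v
...   | inj₁ refl = inj₂ refl
...   | inj₂ refl = inj₁ refl

mergeᴱ-cong : (a b : Fin n) → ∀ {e f} → e ∥ f → mergeᴱ a b e ∥ mergeᴱ a b f
mergeᴱ-cong a b (inj₁ refl) = inj₁ refl
mergeᴱ-cong a b (inj₂ refl) = inj₂ refl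

mergeᴱ-loop : (a b : Fin n) → ∀ {f} → f ∥ (a , b) → ¬ NonLoop (mergeᴱ a b f)
mergeᴱ-loop a b (inj₁ refl) nl = nl (merge-ends a b)
mergeᴱ-loop a b (inj₂ refl) nl = nl (sym (merge-ends a b))

mergeᴱ-nonLoop : (a b : Fin n) → ∀ {f} → NonLoop f → ¬ f ∥ (a , b) → NonLoop (mergeᴱ a b f)
mergeᴱ-nonLoop a b nl f∦ eq = f∦ (merge-≡ a b eq nl)

data Position (a b : Fin n) (f : Edge n) : Set where
  both  : f ∥ (a , b) → Position a b f
  atˡ   : ∀ w → w ≢ a → w ≢ b → f ∥ (a , w) → Position a b f
  atʳ   : ∀ w → w ≢ a → w ≢ b → f ∥ (b , w) → Position a b f
  apart : proj₁ f ≢ a → proj₁ f ≢ b → proj₂ f ≢ a → proj₂ f ≢ b → Position a b f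

position : (a b : Fin n) (f : Edge n) → NonLoop f → Position a b f
position a b (u , v) u≢v with u Fin.≟ a | u Fin.≟ b | v Fin.≟ a | v Fin.≟ b
... | yes refl | _        | yes refl | _        = contradiction refl u≢v
... | _        | yes refl | _        | yes refl = contradiction refl u≢v
... | yes refl | _        | _        | yes refl = both (inj₁ refl)
... | _        | yes refl | yes refl | _        = both (inj₂ refl)
... | yes refl | _        | no v≢a   | no v≢b   = atˡ v v≢a v≢b (inj₁ refl)
... | no _     | yes refl | no v≢a   | no v≢b   = atʳ v v≢a v≢b (inj₁ refl)
... | no u≢a   | no u≢b   | yes refl | _        = atˡ u u≢a u≢b (inj₂ refl)
... | no u≢a   | no u≢b   | no _     | yes refl = atʳ u u≢a u≢b (inj₂ refl)
... | no u≢a   | no u≢b   | no v≢a   | no v≢b   = apart u≢a u≢b v≢a v≢b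

module _ (a b : Fin n) (a≢b : a ≢ b) where

  private
    μ : Edge n → Edge n
    μ = mergeᴱ a b

  mult-merge-apart : (f : Edge n) → proj₁ f ≢ a → proj₁ f ≢ b → proj₂ f ≢ a → proj₂ f ≢ b →
    ∀ es → mult (μ f) (map μ es) ≡ mult f es
  mult-merge-apart f p q r s es = trans (length-filter-map (μ f ∥?_) μ es)
    (length-filter-cong (λ h → μ f ∥? μ h) (f ∥?_) (λ _ → to) (λ _ → mergeᴱ-cong a b) es)
    where
    to : ∀ {h} → μ f ∥ μ h → f ∥ h
    to (inj₁ eq) = inj₁ (cong₂ _,_ (merge-apart p q (cong proj₁ eq)) (merge-apart r s (cong proj₂ eq)))
    to (inj₂ eq) = inj₂ (cong₂ _,_ (merge-apart p q (cong proj₁ eq)) (merge-apart r s (cong proj₂ eq)))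

  -- An edge becomes parallel to the image of cw exactly if it joins w to a or to b. These two
  -- classes are disjoint because a and b differ, so their sizes add.
  mult-merge-at : ∀ {c w} → c ≡ a ⊎ c ≡ b → w ≢ a → w ≢ b → ∀ {f} → f ∥ (c , w) →
    ∀ es → mult (μ f) (map μ es) ≡ mult (a , w) es ℕ.+ mult (b , w) es
  mult-merge-at {c} {w} c∈ w≢a w≢b {f} f∥ es =
    trans (mult-cong (mergeᴱ-cong a b f∥) (map μ es))
    (trans (length-filter-map (μ (c , w) ∥?_) μ es)
    (length-filter-⊎ (λ h → μ (c , w) ∥? μ h) ((a , w) ∥?_) ((b , w) ∥?_)
      to (λ _ q → ∥-trans (inj₁ (cong (_, _) eqa)) (mergeᴱ-cong a b q)) (λ _ q → ∥-trans (inj₁ (cong (_, _) eqb)) (mergeᴱ-cong a b q))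
      disj es))
    where
    to-a : ∀ {c} → c ≡ a ⊎ c ≡ b → merge a b c ≡ merge a b a
    to-a (inj₁ refl) = refl
    to-a (inj₂ refl) = sym (merge-ends a b)
    eqa : merge a b c ≡ merge a b a
    eqa = to-a c∈
    eqb : merge a b c ≡ merge a b b
    eqb = trans eqa (merge-ends a b)
    to : ∀ h → μ (c , w) ∥ μ h → (a , w) ∥ h ⊎ (b , w) ∥ h
    to (x , y) (inj₁ eq) with refl ← merge-apart {v = y} w≢a w≢b (cong proj₂ eq) | merge-fibre a b {v = x} c∈ (cong proj₁ eq)
    ... | inj₁ refl = inj₁ (inj₁ refl)
    ... | inj₂ refl = inj₂ (inj₁ refl)
    to (x , y) (inj₂ eq) with refl ← merge-apart {v = x} w≢a w≢b (cong proj₂ eq) | merge-fibre a b {v = y} c∈ (cong proj₁ eq)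
    ... | inj₁ refl = inj₁ (inj₂ refl)
    ... | inj₂ refl = inj₂ (inj₂ refl)
    disj : ∀ h → (a , w) ∥ h → ¬ (b , w) ∥ h
    disj h p q with ∥-trans p (∥-sym q)
    ... | inj₁ refl = a≢b refl
    ... | inj₂ refl = w≢b refl

  nonloops-merge-∷ : ∀ {f} → NonLoop f → ¬ f ∥ (a , b) → ∀ es →
    nonloops (map μ (f ∷ es)) ≡ μ f ∷ nonloops (map μ es)
  nonloops-merge-∷ {f} nl f∦ es with nonLoop? (μ f)
  ... | yes _ = refl
  ... | no l  = contradiction (mergeᴱ-nonLoop a b nl f∦) l

  nonloops-merge-∥ : ∀ {f} → f ∥ (a , b) → ∀ es → nonloops (map μ (f ∷ es)) ≡ nonloops (map μ es)
  nonloops-merge-∥ {f} f∥ es with nonLoop? (μ f)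
  ... | yes nl = contradiction nl (mergeᴱ-loop a b f∥)
  ... | no _   = refl

  mult-nonloops-merge : ∀ {f} → NonLoop f → ¬ f ∥ (a , b) → ∀ es →
    mult (μ f) (nonloops (map μ es)) ≡ mult (μ f) (map μ es)
  mult-nonloops-merge nl f∦ es = mult-nonloops _ (mergeᴱ-nonLoop a b nl f∦) (map μ es)

  corners-both : ∀ (h : Fin n → Fin n → ℤ) → (∀ u → h u u ≡ + 0) → ∀ {f} → f ∥ (a , b) → corners h (a , b) f ≡ + 0
  corners-both h h0 f∥ = trans (cong₂ _+_ (corner-cong h a b f∥) (corner-cong h b a f∥)) (begin
    δ a a * h b b + δ a b * h b a + (δ b a * h a b + δ b b * h a a)
      ≡⟨ cong₂ (λ p q → δ a a * p + δ a b * h b a + (δ b a * h a b + δ b b * q)) (h0 b) (h0 a) ⟩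
    δ a a * + 0 + δ a b * h b a + (δ b a * h a b + δ b b * + 0)
      ≡⟨ cong₂ (λ p q → δ a a * + 0 + p * h b a + (q * h a b + δ b b * + 0)) (δ-≢ a≢b) (δ-≢ (a≢b ∘ sym)) ⟩
    δ a a * + 0 + + 0 * h b a + (+ 0 * h a b + δ b b * + 0)
      ≡⟨ lemma (δ a a) (h b a) (h a b) (δ b b) ⟩
    + 0 ∎)
    where
    lemma : ∀ p q r s → p * + 0 + + 0 * q + (+ 0 * r + s * + 0) ≡ + 0
    lemma = solve-∀

  corners-atˡ : ∀ (h : Fin n → Fin n → ℤ) {w} → w ≢ a → w ≢ b → ∀ {f} → f ∥ (a , w) → corners h (a , b) f ≡ h b w
  corners-atˡ h {w} w≢a w≢b f∥ = trans (cong₂ _+_ (corner-cong h a b f∥) (corner-cong h b a f∥)) (begin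
    δ a a * h b w + δ a w * h b a + (δ b a * h a w + δ b w * h a a)
      ≡⟨ cong₂ (λ p q → p * h b w + q * h b a + (δ b a * h a w + δ b w * h a a)) (δ-refl a) (δ-≢ (w≢a ∘ sym)) ⟩
    + 1 * h b w + + 0 * h b a + (δ b a * h a w + δ b w * h a a)
      ≡⟨ cong₂ (λ p q → + 1 * h b w + + 0 * h b a + (p * h a w + q * h a a)) (δ-≢ (a≢b ∘ sym)) (δ-≢ (w≢b ∘ sym)) ⟩
    + 1 * h b w + + 0 * h b a + (+ 0 * h a w + + 0 * h a a)
      ≡⟨ lemma (h b w) (h b a) (h a w) (h a a) ⟩
    h b w ∎)
    where
    lemma : ∀ p q r s → + 1 * p + + 0 * q + (+ 0 * r + + 0 * s) ≡ p
    lemma = solve-∀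

  corners-atʳ : ∀ (h : Fin n → Fin n → ℤ) {w} → w ≢ a → w ≢ b → ∀ {f} → f ∥ (b , w) → corners h (a , b) f ≡ h a w
  corners-atʳ h {w} w≢a w≢b f∥ = trans (cong₂ _+_ (corner-cong h a b f∥) (corner-cong h b a f∥)) (begin
    δ a b * h b w + δ a w * h b b + (δ b b * h a w + δ b w * h a b)
      ≡⟨ cong₂ (λ p q → p * h b w + q * h b b + (δ b b * h a w + δ b w * h a b)) (δ-≢ a≢b) (δ-≢ (w≢a ∘ sym)) ⟩
    + 0 * h b w + + 0 * h b b + (δ b b * h a w + δ b w * h a b)
      ≡⟨ cong₂ (λ p q → + 0 * h b w + + 0 * h b b + (p * h a w + q * h a b)) (δ-refl b) (δ-≢ (w≢b ∘ sym)) ⟩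
    + 0 * h b w + + 0 * h b b + (+ 1 * h a w + + 0 * h a b)
      ≡⟨ lemma (h b w) (h b b) (h a w) (h a b) ⟩
    h a w ∎)
    where
    lemma : ∀ p q r s → + 0 * p + + 0 * q + (+ 1 * r + + 0 * s) ≡ r
    lemma = solve-∀

  corners-apart : ∀ (h : Fin n → Fin n → ℤ) {f} → proj₁ f ≢ a → proj₁ f ≢ b → proj₂ f ≢ a → proj₂ f ≢ b →
    corners h (a , b) f ≡ + 0
  corners-apart h {u , v} p q r s = begin
    δ a u * h b v + δ a v * h b u + (δ b u * h a v + δ b v * h a u)
      ≡⟨ cong₂ (λ x y → x * h b v + y * h b u + (δ b u * h a v + δ b v * h a u)) (δ-≢ (p ∘ sym)) (δ-≢ (r ∘ sym)) ⟩
    + 0 * h b v + + 0 * h b u + (δ b u * h a v + δ b v * h a u)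
      ≡⟨ cong₂ (λ x y → + 0 * h b v + + 0 * h b u + (x * h a v + y * h a u)) (δ-≢ (q ∘ sym)) (δ-≢ (s ∘ sym)) ⟩
    + 0 * h b v + + 0 * h b u + (+ 0 * h a v + + 0 * h a u)
      ≡⟨ lemma (h b v) (h b u) (h a v) (h a u) ⟩
    + 0 ∎
    where
    lemma : ∀ p q r s → + 0 * p + + 0 * q + (+ 0 * r + + 0 * s) ≡ + 0
    lemma = solve-∀

  private
    e : Edge n
    e = a , b

  at-∦ : ∀ {c w f} → w ≢ a → w ≢ b → f ∥ (c , w) → ¬ f ∥ (a , b)
  at-∦ w≢a w≢b p q with ∥-trans (∥-sym p) q
  ... | inj₁ refl = w≢b refl
  ... | inj₂ refl = w≢a refl

  apart-∦ : ∀ {f} → proj₁ f ≢ a → proj₁ f ≢ b → ¬ f ∥ (a , b)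
  apart-∦ p q (inj₁ refl) = p refl
  apart-∦ p q (inj₂ refl) = q refl

  classes-merge-∷ : ∀ {f} → NonLoop f → ¬ f ∥ e → ∀ es →
    classes (nonloops (map μ (f ∷ es))) ≡ is0 (mult (μ f) (map μ es)) + classes (nonloops (map μ es))
  classes-merge-∷ nl f∦ es = trans (cong classes (nonloops-merge-∷ nl f∦ es))
    (cong (λ k → is0 k + classes (nonloops (map μ es))) (mult-nonloops-merge nl f∦ es))

  classes*-merge-∷ : ∀ {f} → NonLoop f → ¬ f ∥ e → ∀ es →
    classes* (nonloops (map μ (f ∷ es))) ≡ is1 (mult (μ f) (map μ es)) + classes* (nonloops (map μ es))
  classes*-merge-∷ nl f∦ es = trans (cong classes* (nonloops-merge-∷ nl f∦ es))
    (cong (λ k → is1 k + classes* (nonloops (map μ es))) (mult-nonloops-merge nl f∦ es))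

  common-[] : common [] e ≡ + 0
  common-[] = ∑-zero {g = λ w → adj [] a w * adj [] b w} λ _ → refl

  mixed-[] : mixed [] e ≡ + 0
  mixed-[] = cong₂ _+_ (∑-zero {g = λ w → dbl [] a w * adj [] b w} λ _ → refl) (∑-zero {g = λ w → adj [] a w * dbl [] b w} λ _ → refl)

  -- Contracting e removes its class and identifies the other two sides of
  -- every triangle on e.
  classes-merge : ∀ {es} → All NonLoop es →
    classes (nonloops (map μ es)) + common es e + (+ 1 - is0 (mult e es)) ≡ classes es
  classes-merge [] = cong (λ c → + 0 + c + (+ 1 - + 1)) common-[]
  classes-merge {f ∷ es} (nl ∷ nls) = trans
      (cong (λ c → classes (nonloops (map μ (f ∷ es))) + c + (+ 1 - is0 (mult e (f ∷ es)))) (common-∷ f nl es e a≢b))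
      (by (position a b f nl))
    where
    K = common es e
    Q = classes (nonloops (map μ es))
    ih : Q + K + (+ 1 - is0 (mult e es)) ≡ classes es
    ih = classes-merge nls
    z₀ = is0 (mult e es)
    arith-both : ∀ {k z} → k ≡ + 0 → z ≡ + 0 → Q + (K + z₀ * k) + (+ 1 - z) ≡ z₀ + classes es
    arith-both refl refl = trans (lemma Q K z₀) (cong (λ t → z₀ + t) ih)
      where
      lemma : ∀ q c z → q + (c + z * + 0) + (+ 1 - + 0) ≡ z + (q + c + (+ 1 - z))
      lemma = solve-∀
    -- Here `x` says that f is the first edge on its side, `y` that the other side of the triangle
    -- over w is missing. A first edge gives a new merged class if the other side is missing and a
    -- new common neighbour if it is present: `x * y + x * (+ 1 - y)` is `x`.
    arith-at : ∀ x y {k l} → l ≡ x * y + Q → k ≡ + 1 - y → l + (K + x * k) + (+ 1 - z₀) ≡ x + classes es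
    arith-at x y refl refl = trans (lemma Q K z₀ x y) (cong (λ t → x + t) ih)
      where
      lemma : ∀ q c z x y → x * y + q + (c + x * (+ 1 - y)) + (+ 1 - z) ≡ x + (q + c + (+ 1 - z))
      lemma = solve-∀
    by : Position a b f →
      classes (nonloops (map μ (f ∷ es))) + (K + is0 (mult f es) * corners (adj es) e f) + (+ 1 - is0 (mult e (f ∷ es)))
        ≡ is0 (mult f es) + classes es
    by (both f∥) = begin
      classes (nonloops (map μ (f ∷ es))) + (K + is0 (mult f es) * corners (adj es) e f) + (+ 1 - is0 (mult e (f ∷ es)))
        ≡⟨ cong₂ (λ l z → l + (K + z * corners (adj es) e f) + (+ 1 - is0 (mult e (f ∷ es))))
             (cong classes (nonloops-merge-∥ f∥ es)) (cong is0 (mult-cong f∥ es)) ⟩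
      Q + (K + is0 (mult e es) * corners (adj es) e f) + (+ 1 - is0 (mult e (f ∷ es)))
        ≡⟨ arith-both (corners-both (adj es) (adj-loop nls) f∥) (cong is0 (mult-∥ (∥-sym f∥) es)) ⟩
      is0 (mult e es) + classes es
        ≡⟨ cong (λ k → is0 k + classes es) (mult-cong f∥ es) ⟨
      is0 (mult f es) + classes es ∎
    by (atˡ w w≢a w≢b f∥) = begin
      _ ≡⟨ cong₂ (λ j k → classes (nonloops (map μ (f ∷ es))) + (K + is0 j * corners (adj es) e f) + (+ 1 - is0 k))
             (mult-cong f∥ es) (mult-∦ (at-∦ w≢a w≢b f∥ ∘ ∥-sym) es) ⟩
      classes (nonloops (map μ (f ∷ es))) + (K + is0 (mult (a , w) es) * corners (adj es) e f) + (+ 1 - is0 (mult e es))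
        ≡⟨ arith-at (is0 (mult (a , w) es)) (is0 (mult (b , w) es))
             (trans (classes-merge-∷ nl (at-∦ w≢a w≢b f∥) es) (cong (_+ Q) at)) (corners-atˡ (adj es) w≢a w≢b f∥) ⟩
      is0 (mult (a , w) es) + classes es
        ≡⟨ cong (λ k → is0 k + classes es) (mult-cong f∥ es) ⟨
      is0 (mult f es) + classes es ∎
      where
      at : is0 (mult (μ f) (map μ es)) ≡ is0 (mult (a , w) es) * is0 (mult (b , w) es)
      at = trans (cong is0 (mult-merge-at (inj₁ refl) w≢a w≢b f∥ es)) (is0-+ (mult (a , w) es) (mult (b , w) es))
    by (atʳ w w≢a w≢b f∥) = begin
      _ ≡⟨ cong₂ (λ j k → classes (nonloops (map μ (f ∷ es))) + (K + is0 j * corners (adj es) e f) + (+ 1 - is0 k))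
             (mult-cong f∥ es) (mult-∦ (at-∦ w≢a w≢b f∥ ∘ ∥-sym) es) ⟩
      classes (nonloops (map μ (f ∷ es))) + (K + is0 (mult (b , w) es) * corners (adj es) e f) + (+ 1 - is0 (mult e es))
        ≡⟨ arith-at (is0 (mult (b , w) es)) (is0 (mult (a , w) es))
             (trans (classes-merge-∷ nl (at-∦ w≢a w≢b f∥) es) (cong (_+ Q) at)) (corners-atʳ (adj es) w≢a w≢b f∥) ⟩
      is0 (mult (b , w) es) + classes es
        ≡⟨ cong (λ k → is0 k + classes es) (mult-cong f∥ es) ⟨
      is0 (mult f es) + classes es ∎
      where
      at : is0 (mult (μ f) (map μ es)) ≡ is0 (mult (b , w) es) * is0 (mult (a , w) es)
      at = trans (cong is0 (mult-merge-at (inj₂ refl) w≢a w≢b f∥ es))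
             (trans (is0-+ (mult (a , w) es) (mult (b , w) es)) (ℤ.*-comm (is0 (mult (a , w) es)) (is0 (mult (b , w) es))))
    by (apart p q r s) = arith-apart (is0 (mult f es))
        (trans (classes-merge-∷ nl (apart-∦ p q) es) (cong (λ k → is0 k + Q) (mult-merge-apart f p q r s es)))
        (corners-apart (adj es) p q r s) (cong is0 (mult-∦ (apart-∦ p q ∘ ∥-sym) es))
      where
      arith-apart : ∀ x {z k l} → l ≡ x + Q → k ≡ + 0 → z ≡ z₀ → l + (K + x * k) + (+ 1 - z) ≡ x + classes es
      arith-apart x refl refl refl = trans (lemma Q K z₀ x) (cong (λ t → x + t) ih)
        where
        lemma : ∀ q c z x → x + q + (c + x * + 0) + (+ 1 - z) ≡ x + (q + c + (+ 1 - z))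
        lemma = solve-∀

  -- At a common neighbour with sides of sizes j and k, the merged class has size at least 2 and
  -- counts 1, whereas the two sides counted [j ≥ 2] + [k ≥ 2] before. The first amount is collected
  -- by `common`, the second by `mixed`. As e has no parallel edge in `es`, no non-trivial class is
  -- lost to loops.
  classes*-merge : ∀ {es} → All NonLoop es → mult e es ≡ 0 →
    classes* (nonloops (map μ es)) + mixed es e ≡ classes* es + common es e
  classes*-merge [] _ = trans (cong (λ t → + 0 + t) mixed-[]) (sym (cong (λ t → + 0 + t) common-[]))
  classes*-merge {f ∷ es} (nl ∷ nls) mult≡0 with e ∥? f
  ... | no e∦f = trans
      (cong (λ c → classes* (nonloops (map μ (f ∷ es))) + c) (mixed-∷ f nl es e a≢b))
      (trans (by (position a b f nl))
      (sym (cong (λ c → is1 (mult f es) + classes* es + c) (common-∷ f nl es e a≢b))))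
    where
    K = common es e
    X = mixed es e
    Q = classes* (nonloops (map μ es))
    ih : Q + X ≡ classes* es + K
    ih = classes*-merge nls mult≡0
    arith-at : ∀ i j {l k k′ z o} → z ≡ is0 i → o ≡ is1 i →
      l ≡ is1 i * is0 j + is1 j * is0 i + Q → k ≡ + 1 - is0 j → k′ ≡ + 1 - is0 j - is1 j →
      l + (X + o * k + z * k′) ≡ o + classes* es + (K + z * k)
    arith-at i j refl refl refl refl refl =
      trans (lhs Q X (is0 i) (is0 j) (is1 i) (is1 j))
        (trans (cong (λ t → t + is1 i + is0 i * (+ 1 - is0 j)) ih) (rhs (classes* es) K (is0 i) (is0 j) (is1 i)))
      where
      lhs : ∀ q x z z′ o o′ → o * z′ + o′ * z + q + (x + o * (+ 1 - z′) + z * (+ 1 - z′ - o′)) ≡ q + x + o + z * (+ 1 - z′)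
      lhs = solve-∀
      rhs : ∀ p c z z′ o → p + c + o + z * (+ 1 - z′) ≡ o + p + (c + z * (+ 1 - z′))
      rhs = solve-∀
    by : Position a b f →
      classes* (nonloops (map μ (f ∷ es)))
          + (X + is1 (mult f es) * corners (adj es) e f + is0 (mult f es) * corners (dbl es) e f)
        ≡ is1 (mult f es) + classes* es + (K + is0 (mult f es) * corners (adj es) e f)
    by (both f∥) = contradiction (∥-sym f∥) e∦f
    by (atˡ w w≢a w≢b f∥) = arith-at (mult (a , w) es) (mult (b , w) es) (cong is0 (mult-cong f∥ es)) (cong is1 (mult-cong f∥ es))
        (trans (classes*-merge-∷ nl (at-∦ w≢a w≢b f∥) es) (cong (_+ Q) at))
        (corners-atˡ (adj es) w≢a w≢b f∥) (corners-atˡ (dbl es) w≢a w≢b f∥)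
      where
      j = mult (a , w) es
      k = mult (b , w) es
      at : is1 (mult (μ f) (map μ es)) ≡ is1 j * is0 k + is1 k * is0 j
      at = trans (cong is1 (mult-merge-at (inj₁ refl) w≢a w≢b f∥ es))
             (trans (is1-+ j k) (cong (λ t → is1 j * is0 k + t) (ℤ.*-comm (is0 j) (is1 k))))
    by (atʳ w w≢a w≢b f∥) = arith-at (mult (b , w) es) (mult (a , w) es) (cong is0 (mult-cong f∥ es)) (cong is1 (mult-cong f∥ es))
        (trans (classes*-merge-∷ nl (at-∦ w≢a w≢b f∥) es) (cong (_+ Q) at))
        (corners-atʳ (adj es) w≢a w≢b f∥) (corners-atʳ (dbl es) w≢a w≢b f∥)
      where
      j = mult (a , w) es
      k = mult (b , w) es
      at : is1 (mult (μ f) (map μ es)) ≡ is1 k * is0 j + is1 j * is0 k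
      at = trans (cong is1 (mult-merge-at (inj₂ refl) w≢a w≢b f∥ es))
             (trans (is1-+ j k) (trans (ℤ.+-comm (is1 j * is0 k) (is0 j * is1 k)) (cong (_+ is1 j * is0 k) (ℤ.*-comm (is0 j) (is1 k)))))
    by (apart p q r s) = arith-apart (is0 (mult f es)) (is1 (mult f es))
        (trans (classes*-merge-∷ nl (apart-∦ p q) es) (cong (λ k → is1 k + Q) (mult-merge-apart f p q r s es)))
        (corners-apart (adj es) p q r s) (corners-apart (dbl es) p q r s)
      where
      arith-apart : ∀ z o {l k k′} → l ≡ o + Q → k ≡ + 0 → k′ ≡ + 0 →
        l + (X + o * k + z * k′) ≡ o + classes* es + (K + z * k)
      arith-apart z o refl refl refl =
        trans (lhs Q X z o) (trans (cong (λ t → o + t) ih) (rhs (classes* es) K z o))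
        where
        lhs : ∀ q x z o → o + q + (x + o * + 0 + z * + 0) ≡ o + (q + x)
        lhs = solve-∀
        rhs : ∀ p c z o → o + (p + c) ≡ o + p + (c + z * + 0)
        rhs = solve-∀

-- Sums over non-trivial classes and triangles

-- Sum of g over the non-trivial parallel classes, each represented by its
-- last edge but one.
∑classes* : (Edge n → ℤ) → List (Edge n) → ℤ
∑classes* g []       = + 0
∑classes* g (f ∷ es) = is1 (mult f es) * g f + ∑classes* g es

∑classes*-cong : {g h : Edge n → ℤ} → ∀ {es} → (∀ {f} → f ∈ es → g f ≡ h f) → ∑classes* g es ≡ ∑classes* h es
∑classes*-cong {es = []}     eq = refl
∑classes*-cong {es = f ∷ es} eq =
  cong₂ (λ x y → is1 (mult f es) * x + y) (eq (here refl)) (∑classes*-cong (eq ∘ there))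

∑classes*-linear : (g h : Edge n → ℤ) (c : ℤ) → ∀ es →
  ∑classes* (λ f → g f + c * h f) es ≡ ∑classes* g es + c * ∑classes* h es
∑classes*-linear g h c []       = sym (trans (ℤ.+-identityˡ _) (ℤ.*-zeroʳ c))
∑classes*-linear g h c (f ∷ es) =
  trans (cong (λ t → is1 (mult f es) * (g f + c * h f) + t) (∑classes*-linear g h c es))
    (lemma (is1 (mult f es)) (g f) (h f) c (∑classes* g es) (∑classes* h es))
  where
  lemma : ∀ o g h c x y → o * (g + c * h) + (x + c * y) ≡ o * g + x + c * (o * h + y)
  lemma = solve-∀

∑classes*-constant : (c : ℤ) → (es : List (Edge n)) → ∑classes* (λ _ → c) es ≡ classes* es * c
∑classes*-constant c []       = refl
∑classes*-constant c (f ∷ es) =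
  trans (cong (λ t → is1 (mult f es) * c + t) (∑classes*-constant c es)) (sym (ℤ.*-distribʳ-+ c (is1 (mult f es)) (classes* es)))

-- Double counting: for symmetric t, `corners` is symmetric in its two edges, so what ab contributes
-- to the classes f can be read as what these f contribute to ab. For t = `adj es` the right-hand
-- side is `mixed es (a , b)`.
∑classes*-corners : (t : Fin n → Fin n → ℤ) → (∀ u v → t u v ≡ t v u) → ∀ a b → a ≢ b → ∀ {es} → All NonLoop es →
  ∑classes* (λ f → corners t f (a , b)) es ≡ link (dbl es) t a b + link t (dbl es) a b
∑classes*-corners t t-sym a b a≢b [] =
  sym (cong₂ _+_ (∑-zero {g = λ w → dbl [] a w * t b w} λ _ → refl) (∑-zero {g = λ w → t a w * dbl [] b w} λ w → ℤ.*-zeroʳ (t a w)))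
∑classes*-corners t t-sym a b a≢b {f@(u , v) ∷ es} (nl ∷ nls) = begin
  o * corners t f (a , b) + ∑classes* (λ f → corners t f (a , b)) es
    ≡⟨ cong₂ (λ x y → o * x + y) swapped (∑classes*-corners t t-sym a b a≢b nls) ⟩
  o * corners t (a , b) f + (link (dbl es) t a b + link t (dbl es) a b)
    ≡⟨ lemma o (corner t a b f) (corner t b a f) (link (dbl es) t a b) (link t (dbl es) a b) (corner (dbl es) b a f) (corner (dbl es) a b f) ⟩
  link (dbl es) t a b + o * corner t a b f + + 0 * corner (dbl es) b a f
    + (link t (dbl es) a b + + 0 * corner (dbl es) a b f + o * corner t b a f)
    ≡⟨ cong₂ _+_ (link-step f nl (dbl es) t o (+ 0) a≢b) (link-step f nl t (dbl es) (+ 0) o a≢b) ⟨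
  _ ≡⟨ cong₂ _+_ (link-cong (λ x y → sym (dbl-∷ f es x y)) zero-step a b) (link-cong zero-step (λ x y → sym (dbl-∷ f es x y)) a b) ⟩
  link (dbl (f ∷ es)) t a b + link t (dbl (f ∷ es)) a b ∎
  where
  o = is1 (mult f es)
  -- `link-step` increments both arguments; the one that stays fixed gets the increment with
  -- coefficient 0.
  zero-step : ∀ x w → t x w + + 0 * ε f x w ≡ t x w
  zero-step x w = trans (cong (λ s → t x w + s) (ℤ.*-zeroˡ (ε f x w))) (ℤ.+-identityʳ _)
  lemma : ∀ o x y l l′ k k′ → o * (x + y) + (l + l′) ≡ l + o * x + + 0 * k + (l′ + + 0 * k′ + o * y)
  lemma = solve-∀
  swapped : corners t f (a , b) ≡ corners t (a , b) f
  swapped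
    rewrite δ-sym u a | δ-sym u b | δ-sym v a | δ-sym v b | t-sym v b | t-sym v a | t-sym u b | t-sym u a
    = shuffle (δ a u) (δ b u) (δ a v) (δ b v) (t b v) (t a v) (t b u) (t a u)
    where
    shuffle : ∀ au bu av bv tbv tav tbu tau →
      au * tbv + bu * tav + (av * tbu + bv * tau) ≡ au * tbv + av * tbu + (bu * tav + bv * tau)
    shuffle = solve-∀

commons : List (Edge n) → ℤ
commons es = ∑classes* (common es) es

-- The new edge acts in two exclusive ways. As the second of its class it makes this class
-- non-trivial and adds its common neighbours. As the first of its class it closes triangles over
-- other non-trivial classes, and these are counted by `mixed`.
commons-∷ : (e : Edge n) → NonLoop e → ∀ {es} → All NonLoop es →
  commons (e ∷ es) ≡ commons es + is1 (mult e es) * common es e + is0 (mult e es) * mixed es e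
commons-∷ e@(a , b) a≢b {es} nls = begin
  o * common (e ∷ es) e + ∑classes* (common (e ∷ es)) es
    ≡⟨ cong₂ (λ x y → o * x + y) own (∑classes*-cong λ {f} f∈ → common-∷ e a≢b es f (lookup nls f∈)) ⟩
  o * common es e + ∑classes* (λ f → common es f + z * corners (adj es) f e) es
    ≡⟨ cong (λ t → o * common es e + t) (∑classes*-linear (common es) (λ f → corners (adj es) f e) z es) ⟩
  o * common es e + (commons es + z * ∑classes* (λ f → corners (adj es) f e) es)
    ≡⟨ cong (λ t → o * common es e + (commons es + z * t)) (∑classes*-corners (adj es) (adj-sym es) a b a≢b nls) ⟩
  o * common es e + (commons es + z * mixed es e)
    ≡⟨ lemma (o * common es e) (commons es) (z * mixed es e) ⟩
  commons es + o * common es e + z * mixed es e ∎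
  where
  o = is1 (mult e es)
  z = is0 (mult e es)
  own : common (e ∷ es) e ≡ common es e
  own = trans (common-∷ e a≢b es e a≢b)
    (trans (cong (λ t → common es e + z * t) (corners-both a b a≢b (adj es) (adj-loop nls) ∥-refl))
      (trans (cong (λ t → common es e + t) (ℤ.*-zeroʳ z)) (ℤ.+-identityʳ _)))
  lemma : ∀ x y z → x + (y + z) ≡ y + x + z
  lemma = solve-∀

∑contractions : List (Edge n) → ℤ
∑contractions es = ∑classes* (λ f → classes (nonloops (map (mergeᴱ (proj₁ f) (proj₂ f)) es))) es

-- Each contracted edge f lies in `es`, so its class is present and `classes-merge` gives
-- `classes es - 1 - common es f`. This trades the sum over contractions for `commons`, which obeys
-- a recursion in the first edge.
∑contractions-commons : {es : List (Edge n)} → All NonLoop es →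
  ∑contractions es ≡ classes* es * (classes es - + 1) - commons es
∑contractions-commons {es = es} nls = begin
  ∑contractions es
    ≡⟨ ∑classes*-cong (λ {f} f∈ → contraction f f∈) ⟩
  ∑classes* (λ f → classes es - + 1 + - (+ 1) * common es f) es
    ≡⟨ ∑classes*-linear (λ _ → classes es - + 1) (common es) (- (+ 1)) es ⟩
  ∑classes* (λ _ → classes es - + 1) es + - (+ 1) * commons es
    ≡⟨ cong₂ _+_ (∑classes*-constant (classes es - + 1) es) (ℤ.-1*i≡-i (commons es)) ⟩
  classes* es * (classes es - + 1) - commons es ∎
  where
  contraction : ∀ f → f ∈ es →
    classes (nonloops (map (mergeᴱ (proj₁ f) (proj₂ f)) es)) ≡ classes es - + 1 + - (+ 1) * common es f
  contraction f f∈ = lemma _ (common es f) (mult-∈ f∈) (classes-merge (proj₁ f) (proj₂ f) (lookup nls f∈) nls)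
    where
    lemma : ∀ q c {z p} → z ≡ + 0 → q + c + (+ 1 - z) ≡ p → q ≡ p - + 1 + - (+ 1) * c
    lemma q c refl refl = ring q c
      where
      ring : ∀ q c → q ≡ q + c + (+ 1 - + 0) - + 1 + - (+ 1) * c
      ring = solve-∀

pairs : List (Edge n) → ℤ
pairs []       = + 0
pairs (e ∷ es) = is0 (mult e es) * classes es + pairs es

-- `classes` is an integer and the binomial coefficient needs a natural number, hence the witness k.
-- A new class pairs with each of the k old ones, which is Pascal's rule.
pairs-C : (es : List (Edge n)) → ∃ λ k → classes es ≡ + k × pairs es ≡ + (k C 2)
pairs-C []       = 0 , refl , refl
pairs-C (e ∷ es) with mult e es | pairs-C es
... | zero  | k , eq , eq′ = suc k , cong (λ t → + 1 + t) eq , (begin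
  + 1 * classes es + pairs es ≡⟨ cong₂ _+_ (trans (ℤ.*-identityˡ _) eq) eq′ ⟩
  + (k ℕ.+ k C 2)             ≡⟨ cong (λ j → + (j ℕ.+ k C 2)) (nC1≡n k) ⟨
  + (k C 1 ℕ.+ k C 2)         ≡⟨ cong +_ (nCk+nC[k+1]≡[n+1]C[k+1] k 1) ⟩
  + (suc k C 2)               ∎)
... | suc _ | k , eq , eq′ = k , trans (ℤ.+-identityˡ _) eq , trans (ℤ.+-identityˡ _) eq′

-- Triangles as a sum over increasing triples of vertices

lt : Fin n → Fin n → ℤ
lt u v = 𝟙 (u Fin.<? v)

lt-swap : {u v : Fin n} → u ≢ v → lt v u ≡ + 1 - lt u v
lt-swap {u = u} {v} u≢v with Fin.<-cmp u v
... | tri< u<v _ v≮u = trans (𝟙-false (v Fin.<? u) v≮u) (sym (cong (λ t → + 1 - t) (𝟙-true (u Fin.<? v) u<v)))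
... | tri≈ _ u≡v _   = contradiction u≡v u≢v
... | tri> u≮v _ v<u = trans (𝟙-true (v Fin.<? u) v<u) (sym (cong (λ t → + 1 - t) (𝟙-false (u Fin.<? v) u≮v)))

lt-cycle : (u v w : Fin n) → lt u v * lt v w * lt w u ≡ + 0
lt-cycle u v w = trans (cong (_* lt w u) (sym (𝟙-× (u Fin.<? v) (v Fin.<? w))))
  (𝟙-disjoint (u Fin.<? v ×-dec v Fin.<? w) (w Fin.<? u)
    λ ((u<v , v<w) , w<u) → Fin.<-irrefl refl (Fin.<-trans u<v (Fin.<-trans v<w w<u)))

𝟙-product : ∀ {A B : Set} (a? : Dec A) (b? : Dec B) → 𝟙 a? * 𝟙 b? ≡ + 0 ⊎ (𝟙 a? * 𝟙 b? ≡ + 1 × A × B)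
𝟙-product (yes a) (yes b) = inj₂ (refl , a , b)
𝟙-product (yes _) (no _)  = inj₁ refl
𝟙-product (no _)  (yes _) = inj₁ refl
𝟙-product (no _)  (no _)  = inj₁ refl

-- The indicator of u < v with w anywhere relative to u and v.
place : (w u v : Fin n) → ℤ
place w u v = lt u v * lt v w + lt w u * lt u v + lt u w * lt w v

-- Exactly one of the six orders of three distinct vertices occurs. Algebraically the sum is 1 plus
-- twice each of the two cyclic patterns, and transitivity excludes these.
place-sum : {w a b : Fin n} → a ≢ b → w ≢ a → w ≢ b → place w a b + place w b a ≡ + 1
place-sum {w = w} {a} {b} a≢b w≢a w≢b = begin
  place w a b + place w b a
    ≡⟨ lemma (lt a b) (lt b w) (lt a w) (lt-swap a≢b) (lt-swap (w≢b ∘ sym)) (lt-swap (w≢a ∘ sym)) ⟩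
  + 1 + + 2 * (lt a b * lt b w * lt w a) + + 2 * (lt a w * lt w b * lt b a)
    ≡⟨ cong₂ (λ p q → + 1 + + 2 * p + + 2 * q) (lt-cycle a b w) (lt-cycle a w b) ⟩
  + 1 ∎
  where
  lemma : ∀ x y t {x′ y′ t′} → x′ ≡ + 1 - x → y′ ≡ + 1 - y → t′ ≡ + 1 - t →
    x * y + t′ * x + t * y′ + (x′ * t + y′ * x′ + y * t′) ≡ + 1 + + 2 * (x * y * t′) + + 2 * (t * y′ * x′)
  lemma x y t refl refl refl = ring x y t
    where
    ring : ∀ x y t →
      x * y + (+ 1 - t) * x + t * (+ 1 - y) + ((+ 1 - x) * t + (+ 1 - y) * (+ 1 - x) + y * (+ 1 - t))
        ≡ + 1 + + 2 * (x * y * (+ 1 - t)) + + 2 * (t * (+ 1 - y) * (+ 1 - x))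
    ring = solve-∀

∑³ : (Fin n → Fin n → Fin n → ℤ) → ℤ
∑³ F = ∑ λ u → ∑ λ v → ∑ λ w → F u v w

∑³-cong : {F G : Fin n → Fin n → Fin n → ℤ} → (∀ u v w → F u v w ≡ G u v w) → ∑³ F ≡ ∑³ G
∑³-cong eq = sum-cong-≗ λ u → sum-cong-≗ λ v → sum-cong-≗ λ w → eq u v w

∑³-+ : (F G : Fin n → Fin n → Fin n → ℤ) → ∑³ (λ u v w → F u v w + G u v w) ≡ ∑³ F + ∑³ G
∑³-+ F G = trans (sum-cong-≗ λ u → trans (sum-cong-≗ λ v → ∑-distrib-+ (F u v) (G u v)) (∑-distrib-+ (λ v → ∑ (F u v)) (λ v → ∑ (G u v))))
  (∑-distrib-+ (λ u → ∑ λ v → ∑ (F u v)) (λ u → ∑ λ v → ∑ (G u v)))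

∑³-* : (c : ℤ) (F : Fin n → Fin n → Fin n → ℤ) → ∑³ (λ u v w → c * F u v w) ≡ c * ∑³ F
∑³-* c F = sym (trans (*-distribˡ-sum c (λ u → ∑ λ v → ∑ (F u v)))
  (sum-cong-≗ λ u → trans (*-distribˡ-sum c (λ v → ∑ (F u v))) (sum-cong-≗ λ v → *-distribˡ-sum c (F u v))))

∑∑-ε : (f : Edge n) → NonLoop f → (h : Fin n → Fin n → ℤ) →
  ∑ (λ u → ∑ λ v → ε f u v * h u v) ≡ h (proj₁ f) (proj₂ f) + h (proj₂ f) (proj₁ f)
∑∑-ε f@(a , b) nl h = begin
  ∑ (λ u → ∑ λ v → ε f u v * h u v)
    ≡⟨ sum-cong-≗ (λ u → trans (sum-cong-≗ λ v → trans (cong (_* h u v) (ε-δ f nl u v)) (lemma (δ v b) (δ u a) (δ v a) (δ u b) (h u v)))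
         (∑-distrib-+ (λ v → δ v b * (δ u a * h u v)) (λ v → δ v a * (δ u b * h u v)))) ⟩
  ∑ (λ u → ∑ (λ v → δ v b * (δ u a * h u v)) + ∑ (λ v → δ v a * (δ u b * h u v)))
    ≡⟨ sum-cong-≗ (λ u → cong₂ _+_ (∑-δ b (λ v → δ u a * h u v)) (∑-δ a (λ v → δ u b * h u v))) ⟩
  ∑ (λ u → δ u a * h u b + δ u b * h u a)
    ≡⟨ ∑-distrib-+ (λ u → δ u a * h u b) (λ u → δ u b * h u a) ⟩
  ∑ (λ u → δ u a * h u b) + ∑ (λ u → δ u b * h u a)
    ≡⟨ cong₂ _+_ (∑-δ a (λ u → h u b)) (∑-δ b (λ u → h u a)) ⟩
  h a b + h b a ∎
  where
  lemma : ∀ p q r s t → (p * q + r * s) * t ≡ p * (q * t) + r * (s * t)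
  lemma = solve-∀

increasing : Fin n → Fin n → Fin n → ℤ
increasing u v w = lt u v * lt v w

tri : List (Edge n) → ℤ
tri es = ∑³ λ u v w → increasing u v w * (adj es u v * adj es v w * adj es u w)

tri-[] : tri {n} [] ≡ + 0
tri-[] {n} = ∑-zero {n} λ u → ∑-zero {n} λ v → ∑-zero {n} λ w → ℤ.*-zeroʳ (increasing u v w)

-- Expanding the product of the three adjacencies, the terms with two or three increments vanish,
-- because f cannot join two different pairs of a triple. The three linear terms place f at the
-- first two, the last two or the outer two positions; with both orientations of f, every third
-- vertex is met in all six orders, of which one occurs.
tri-∷ : (f : Edge n) → NonLoop f → ∀ {es} → All NonLoop es →
  tri (f ∷ es) ≡ tri es + is0 (mult f es) * common es f
tri-∷ {n} f@(a , b) a≢b {es} nls = begin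
  tri (f ∷ es)
    ≡⟨ ∑³-cong (λ u v w → trans
         (cong (increasing u v w *_) (cong₂ _*_ (cong₂ _*_ (adj-∷ f es u v) (adj-∷ f es v w)) (adj-∷ f es u w)))
         (expand u v w)) ⟩
  ∑³ (λ u v w → increasing u v w * (s u v * s v w * s u w)
      + z * (ε f u v * (increasing u v w * G w) + (ε f v w * (increasing u v w * G u) + ε f u w * (increasing u v w * G v))))
    ≡⟨ trans (∑³-+ {n} _ _) (cong (λ t → tri es + t) (trans (∑³-* {n} z _) (cong (z *_)
         (trans (∑³-+ {n} (λ u v w → ε f u v * (increasing u v w * G w)) _)
           (cong (λ t → ∑³ (λ u v w → ε f u v * (increasing u v w * G w)) + t)
             (∑³-+ (λ u v w → ε f v w * (increasing u v w * G u)) (λ u v w → ε f u w * (increasing u v w * G v)))))))) ⟩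
  tri es + z * (∑³ (λ u v w → ε f u v * (increasing u v w * G w))
    + (∑³ (λ w u v → ε f u v * (increasing w u v * G w)) + ∑³ (λ u w v → ε f u v * (increasing u w v * G w))))
    ≡⟨ cong (λ t → tri es + z * t) (trans (cong₂ _+_ first (cong₂ _+_ second third)) collect) ⟩
  tri es + z * common es f ∎
  where
  z = is0 (mult f es)
  s = adj es
  G : Fin n → ℤ
  G w = s a w * s b w

  first : ∑³ (λ u v w → ε f u v * (increasing u v w * G w)) ≡ ∑ λ w → (increasing a b w + increasing b a w) * G w
  first = begin
    ∑³ (λ u v w → ε f u v * (increasing u v w * G w))
      ≡⟨ sum-cong-≗ (λ u → ∑-comm λ v w → ε f u v * (increasing u v w * G w)) ⟩
    ∑³ (λ u w v → ε f u v * (increasing u v w * G w))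
      ≡⟨ ∑-comm (λ u w → ∑ λ v → ε f u v * (increasing u v w * G w)) ⟩
    ∑³ (λ w u v → ε f u v * (increasing u v w * G w))
      ≡⟨ sum-cong-≗ (λ w → trans (∑∑-ε f a≢b (λ u v → increasing u v w * G w)) (sym (ℤ.*-distribʳ-+ (G w) (increasing a b w) (increasing b a w)))) ⟩
    _ ∎

  second : ∑³ (λ w u v → ε f u v * (increasing w u v * G w)) ≡ ∑ λ w → (increasing w a b + increasing w b a) * G w
  second = sum-cong-≗ λ w → trans (∑∑-ε f a≢b (λ u v → increasing w u v * G w)) (sym (ℤ.*-distribʳ-+ (G w) (increasing w a b) (increasing w b a)))

  third : ∑³ (λ u w v → ε f u v * (increasing u w v * G w)) ≡ ∑ λ w → (increasing a w b + increasing b w a) * G w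
  third = trans (∑-comm (λ u w → ∑ λ v → ε f u v * (increasing u w v * G w)))
    (sum-cong-≗ λ w → trans (∑∑-ε f a≢b (λ u v → increasing u w v * G w)) (sym (ℤ.*-distribʳ-+ (G w) (increasing a w b) (increasing b w a))))

  placed : ∀ w → (place w a b + place w b a) * G w ≡ G w
  -- If w is an end of f the orders need not add up to 1, but then `G w` is 0 because there are no
  -- loops.
  placed w with w Fin.≟ a | w Fin.≟ b
  ... | yes refl | _        = trans (cong (λ t → (place w a b + place w b a) * (t * s b w)) (adj-loop nls a))
                                (trans (ℤ.*-zeroʳ (place w a b + place w b a)) (sym (cong (_* s b w) (adj-loop nls a))))
  ... | no _     | yes refl = trans (cong (λ t → (place w a b + place w b a) * t) G≡0)
                                (trans (ℤ.*-zeroʳ (place w a b + place w b a)) (sym G≡0))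
    where
    G≡0 : s a b * s b b ≡ + 0
    G≡0 = trans (cong (s a b *_) (adj-loop nls b)) (ℤ.*-zeroʳ (s a b))
  ... | no w≢a   | no w≢b   = trans (cong (_* G w) (place-sum a≢b w≢a w≢b)) (ℤ.*-identityˡ (G w))

  collect : ∑ (λ w → (increasing a b w + increasing b a w) * G w)
    + (∑ (λ w → (increasing w a b + increasing w b a) * G w) + ∑ (λ w → (increasing a w b + increasing b w a) * G w))
    ≡ common es f
  collect = begin
    _ ≡⟨ cong (λ t → ∑ (λ w → (increasing a b w + increasing b a w) * G w) + t)
           (∑-distrib-+ (λ w → (increasing w a b + increasing w b a) * G w) (λ w → (increasing a w b + increasing b w a) * G w)) ⟨
    _ ≡⟨ ∑-distrib-+ (λ w → (increasing a b w + increasing b a w) * G w)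
           (λ w → (increasing w a b + increasing w b a) * G w + (increasing a w b + increasing b w a) * G w) ⟨
    _ ≡⟨ sum-cong-≗ (λ w → trans
           (lemma (increasing a b w) (increasing b a w) (increasing w a b) (increasing w b a) (increasing a w b) (increasing b w a) (G w))
           (placed w)) ⟩
    ∑ G ∎
    where
    lemma : ∀ p p′ q q′ r r′ g → (p + p′) * g + ((q + q′) * g + (r + r′) * g) ≡ (p + q + r + (p′ + q′ + r′)) * g
    lemma = solve-∀

  hit : ∀ u v w → ε f u v * (s u w * s v w) ≡ ε f u v * G w
  hit u v w with (u , v) ∥? f
  ... | yes (inj₁ refl) = refl
  ... | yes (inj₂ refl) = cong (λ t → + 1 * t) (ℤ.*-comm (s b w) (s a w))
  ... | no _            = refl

  expand : ∀ u v w →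
    increasing u v w * ((s u v + z * ε f u v) * (s v w + z * ε f v w) * (s u w + z * ε f u w))
      ≡ increasing u v w * (s u v * s v w * s u w)
        + z * (ε f u v * (increasing u v w * G w) + (ε f v w * (increasing u v w * G u) + ε f u w * (increasing u v w * G v)))
  -- The three pairs are known to be distinct only for u < v < w; for every other triple both sides
  -- carry the factor 0. The factor is abstracted as `i` to be matched with its value.
  expand u v w = by-cases (increasing u v w) (𝟙-product (u Fin.<? v) (v Fin.<? w))
    where
    by-cases : ∀ i → i ≡ + 0 ⊎ (i ≡ + 1 × u Fin.< v × v Fin.< w) →
      i * ((s u v + z * ε f u v) * (s v w + z * ε f v w) * (s u w + z * ε f u w))
        ≡ i * (s u v * s v w * s u w)
          + z * (ε f u v * (i * G w) + (ε f v w * (i * G u) + ε f u w * (i * G v)))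
    by-cases i (inj₁ refl) = ring (ε f u v) (ε f v w) (ε f u w) (G w) (G u) (G v) z
        ((s u v + z * ε f u v) * (s v w + z * ε f v w) * (s u w + z * ε f u w)) (s u v * s v w * s u w)
      where
      ring : ∀ p q r g h k z x y → + 0 * x ≡ + 0 * y + z * (p * (+ 0 * g) + (q * (+ 0 * h) + r * (+ 0 * k)))
      ring = solve-∀
    by-cases i (inj₂ (refl , u<v , v<w)) = ring z (s u v) (s v w) (s u w) (ε f u v) (ε f v w) (ε f u w)
        (𝟙-disjoint ((u , v) ∥? f) ((v , w) ∥? f) λ (p , q) → uv≠vw (∥-trans p (∥-sym q)))
        (𝟙-disjoint ((u , v) ∥? f) ((u , w) ∥? f) λ (p , q) → uv≠uw (∥-trans p (∥-sym q)))
        (𝟙-disjoint ((v , w) ∥? f) ((u , w) ∥? f) λ (p , q) → vw≠uw (∥-trans p (∥-sym q)))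
        (trans (cong (ε f u v *_) (ℤ.*-comm (s v w) (s u w))) (hit u v w))
        (trans (cong (ε f v w *_) (cong₂ _*_ (adj-sym es u v) (adj-sym es u w))) (hit v w u))
        (trans (cong (λ t → ε f u w * (s u v * t)) (adj-sym es v w)) (hit u w v))
      where
      u≢w : u ≢ w
      u≢w refl = Fin.<-irrefl refl (Fin.<-trans u<v v<w)
      uv≠vw : ¬ (u , v) ∥ (v , w)
      uv≠vw (inj₁ refl) = u≢w refl
      uv≠vw (inj₂ refl) = u≢w refl
      uv≠uw : ¬ (u , v) ∥ (u , w)
      uv≠uw (inj₁ refl) = Fin.<-irrefl refl v<w
      uv≠uw (inj₂ refl) = u≢w refl
      vw≠uw : ¬ (v , w) ∥ (u , w)
      vw≠uw (inj₁ refl) = Fin.<-irrefl refl u<v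
      vw≠uw (inj₂ refl) = u≢w refl
      ring : ∀ z p q r x y t {g h k} → x * y ≡ + 0 → x * t ≡ + 0 → y * t ≡ + 0 →
        x * (q * r) ≡ x * g → y * (p * r) ≡ y * h → t * (p * q) ≡ t * k →
        + 1 * ((p + z * x) * (q + z * y) * (r + z * t)) ≡ + 1 * (p * q * r) + z * (x * (+ 1 * g) + (y * (+ 1 * h) + t * (+ 1 * k)))
      ring z p q r x y t {g} {h} {k} xy xt yt xg yh tk = begin
        + 1 * ((p + z * x) * (q + z * y) * (r + z * t))
          ≡⟨ expanded z p q r x y t ⟩
        p * q * r + z * (x * (q * r) + (y * (p * r) + t * (p * q))) + z * z * (x * y * (r + z * t) + x * t * q + y * t * p)
          ≡⟨ cong₂ (λ m n → p * q * r + z * m + z * z * n)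
               (cong₂ _+_ xg (cong₂ _+_ yh tk))
               (cong₂ _+_ (cong₂ _+_ (cong (_* (r + z * t)) xy) (cong (_* q) xt)) (cong (_* p) yt)) ⟩
        p * q * r + z * (x * g + (y * h + t * k)) + z * z * (+ 0 * (r + z * t) + + 0 * q + + 0 * p)
          ≡⟨ tidy z p q r x y t g h k ⟩
        _ ∎
        where
        expanded : ∀ z p q r x y t → + 1 * ((p + z * x) * (q + z * y) * (r + z * t))
          ≡ p * q * r + z * (x * (q * r) + (y * (p * r) + t * (p * q))) + z * z * (x * y * (r + z * t) + x * t * q + y * t * p)
        expanded = solve-∀
        tidy : ∀ z p q r x y t g h k →
          p * q * r + z * (x * g + (y * h + t * k)) + z * z * (+ 0 * (r + z * t) + + 0 * q + + 0 * p)
            ≡ + 1 * (p * q * r) + z * (x * (+ 1 * g) + (y * (+ 1 * h) + t * (+ 1 * k)))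
        tidy = solve-∀

-- Rank sums

mapᴱ : (Fin n → Fin n) → Edge n → Edge n
mapᴱ φ = Prod.map φ φ

contractBy : (Fin n → Fin n) → Edge n → Fin n → Fin n
contractBy φ e = merge (φ (proj₁ e)) (φ (proj₂ e)) ∘ φ

-- Rank and nullity of the multigraph with edges es in which the vertices are
-- identified along φ: each edge that is not a loop is contracted in turn.
rank nullity : (Fin n → Fin n) → List (Edge n) → ℕ
rank φ []       = 0
rank φ (e ∷ es) = if does (nonLoop? (mapᴱ φ e)) then suc (rank (contractBy φ e) es) else rank φ es
nullity φ []       = 0
nullity φ (e ∷ es) = if does (nonLoop? (mapᴱ φ e)) then nullity (contractBy φ e) es else suc (nullity φ es)

rank+nullity : (φ : Fin n → Fin n) → ∀ es → rank φ es ℕ.+ nullity φ es ≡ length es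
rank+nullity φ []       = refl
rank+nullity φ (e ∷ es) with does (nonLoop? (mapᴱ φ e))
... | true  = cong suc (rank+nullity (contractBy φ e) es)
... | false = trans (ℕ.+-suc _ _) (cong suc (rank+nullity φ es))

∑⊆ : (List (Edge n) → ℤ) → List (Edge n) → ℤ
∑⊆ F []       = F []
∑⊆ F (e ∷ es) = ∑⊆ F es + ∑⊆ (λ A → F (e ∷ A)) es

∑⊆-cong : {F G : List (Edge n) → ℤ} → (∀ A → F A ≡ G A) → ∀ es → ∑⊆ F es ≡ ∑⊆ G es
∑⊆-cong eq []       = eq []
∑⊆-cong eq (e ∷ es) = cong₂ _+_ (∑⊆-cong eq es) (∑⊆-cong (λ A → eq (e ∷ A)) es)

∑⊆-+ : (F G : List (Edge n) → ℤ) → ∀ es → ∑⊆ (λ A → F A + G A) es ≡ ∑⊆ F es + ∑⊆ G es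
∑⊆-+ F G []       = refl
∑⊆-+ F G (e ∷ es) = trans (cong₂ _+_ (∑⊆-+ F G es) (∑⊆-+ (λ A → F (e ∷ A)) (λ A → G (e ∷ A)) es))
  (lemma (∑⊆ F es) (∑⊆ G es) (∑⊆ (λ A → F (e ∷ A)) es) (∑⊆ (λ A → G (e ∷ A)) es))
  where
  lemma : ∀ a b c d → a + b + (c + d) ≡ a + c + (b + d)
  lemma = solve-∀

∑⊆-* : (c : ℤ) (F : List (Edge n) → ℤ) → ∀ es → ∑⊆ (λ A → c * F A) es ≡ c * ∑⊆ F es
∑⊆-* c F []       = refl
∑⊆-* c F (e ∷ es) = trans (cong₂ _+_ (∑⊆-* c F es) (∑⊆-* c (λ A → F (e ∷ A)) es))
  (sym (ℤ.*-distribˡ-+ c (∑⊆ F es) (∑⊆ (λ A → F (e ∷ A)) es)))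

-- The coefficient of x^i in (x - 1)^a.
power : (a i : ℕ) → ℤ
power zero    zero    = + 1
power zero    (suc i) = + 0
power (suc a) zero    = - power a zero
power (suc a) (suc i) = power a i - power a (suc i)

-- A Kronecker delta by structural recursion: removing one from both rank and target, as in
-- `rankSum-suc-nonLoop`, is then a computation, and target 0 is literally `is0`.
_≡ᶻ_ : ℕ → ℕ → ℤ
zero  ≡ᶻ r     = is0 r
suc k ≡ᶻ zero  = + 0
suc k ≡ᶻ suc r = k ≡ᶻ r

-- The coefficient of y^j in ∑ (y - 1)^γ(A) over the sets A of rank k.
rankSum : (k j : ℕ) → (Fin n → Fin n) → List (Edge n) → ℤ
rankSum k j φ = ∑⊆ λ A → (k ≡ᶻ rank φ A) * power (nullity φ A) j

module _ (φ : Fin n → Fin n) {e : Edge n} (nl : NonLoop (mapᴱ φ e)) where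
  rank-nonLoop : ∀ A → rank φ (e ∷ A) ≡ suc (rank (contractBy φ e) A)
  rank-nonLoop A with nonLoop? (mapᴱ φ e)
  ... | yes _ = refl
  ... | no l  = contradiction nl l

  nullity-nonLoop : ∀ A → nullity φ (e ∷ A) ≡ nullity (contractBy φ e) A
  nullity-nonLoop A with nonLoop? (mapᴱ φ e)
  ... | yes _ = refl
  ... | no l  = contradiction nl l

  rankSum-zero-nonLoop : ∀ j es → rankSum 0 j φ (e ∷ es) ≡ rankSum 0 j φ es
  rankSum-zero-nonLoop j es = trans
    (cong (λ t → rankSum 0 j φ es + t) (trans
      (∑⊆-cong (λ A → cong (λ r → is0 r * power (nullity φ (e ∷ A)) j) (rank-nonLoop A)) es)
      (trans (∑⊆-* (+ 0) (λ A → power (nullity φ (e ∷ A)) j) es) (ℤ.*-zeroˡ (∑⊆ (λ A → power (nullity φ (e ∷ A)) j) es)))))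
    (ℤ.+-identityʳ (rankSum 0 j φ es))

  rankSum-suc-nonLoop : ∀ k j es →
    rankSum (suc k) j φ (e ∷ es) ≡ rankSum (suc k) j φ es + rankSum k j (contractBy φ e) es
  rankSum-suc-nonLoop k j es = cong (λ t → rankSum (suc k) j φ es + t)
    (∑⊆-cong (λ A → cong₂ (λ r g → (suc k ≡ᶻ r) * power g j) (rank-nonLoop A) (nullity-nonLoop A)) es)

module _ (φ : Fin n → Fin n) {e : Edge n} (l : ¬ NonLoop (mapᴱ φ e)) where
  rank-loop : ∀ A → rank φ (e ∷ A) ≡ rank φ A
  rank-loop A with nonLoop? (mapᴱ φ e)
  ... | yes nl = contradiction nl l
  ... | no _   = refl

  nullity-loop : ∀ A → nullity φ (e ∷ A) ≡ suc (nullity φ A)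
  nullity-loop A with nonLoop? (mapᴱ φ e)
  ... | yes nl = contradiction nl l
  ... | no _   = refl

  -- A loop can be added to any set without changing its rank, so it multiplies the sum by 1 + (y -
  -- 1) = y: degree 0 becomes zero, and degree 1 becomes the former degree 0 (`rankSum-loop-1`).
  rankSum-loop-0 : ∀ k es → rankSum k 0 φ (e ∷ es) ≡ + 0
  rankSum-loop-0 k es = begin
    rankSum k 0 φ (e ∷ es)
      ≡⟨ cong (λ t → rankSum k 0 φ es + t) (∑⊆-cong (λ A → trans
           (cong₂ (λ r g → (k ≡ᶻ r) * power g 0) (rank-loop A) (nullity-loop A))
           (lemma (k ≡ᶻ rank φ A) (power (nullity φ A) 0))) es) ⟩
    rankSum k 0 φ es + ∑⊆ (λ A → - (+ 1) * ((k ≡ᶻ rank φ A) * power (nullity φ A) 0)) es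
      ≡⟨ cong (λ t → rankSum k 0 φ es + t) (∑⊆-* (- (+ 1)) (λ A → (k ≡ᶻ rank φ A) * power (nullity φ A) 0) es) ⟩
    rankSum k 0 φ es + - (+ 1) * rankSum k 0 φ es
      ≡⟨ cancel (rankSum k 0 φ es) ⟩
    + 0 ∎
    where
    lemma : ∀ x y → x * - y ≡ - (+ 1) * (x * y)
    lemma = solve-∀
    cancel : ∀ x → x + - (+ 1) * x ≡ + 0
    cancel = solve-∀

  rankSum-loop-1 : ∀ k es → rankSum k 1 φ (e ∷ es) ≡ rankSum k 0 φ es
  rankSum-loop-1 k es = begin
    rankSum k 1 φ (e ∷ es)
      ≡⟨ cong (λ t → rankSum k 1 φ es + t) (∑⊆-cong (λ A → trans
           (cong₂ (λ r g → (k ≡ᶻ r) * power g 1) (rank-loop A) (nullity-loop A))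
           (lemma (k ≡ᶻ rank φ A) (power (nullity φ A) 0) (power (nullity φ A) 1))) es) ⟩
    rankSum k 1 φ es + ∑⊆ (λ A → (k ≡ᶻ rank φ A) * power (nullity φ A) 0 + - (+ 1) * ((k ≡ᶻ rank φ A) * power (nullity φ A) 1)) es
      ≡⟨ cong (λ t → rankSum k 1 φ es + t) (trans
           (∑⊆-+ (λ A → (k ≡ᶻ rank φ A) * power (nullity φ A) 0) (λ A → - (+ 1) * ((k ≡ᶻ rank φ A) * power (nullity φ A) 1)) es)
           (cong (λ t → rankSum k 0 φ es + t) (∑⊆-* (- (+ 1)) (λ A → (k ≡ᶻ rank φ A) * power (nullity φ A) 1) es))) ⟩
    rankSum k 1 φ es + (rankSum k 0 φ es + - (+ 1) * rankSum k 1 φ es)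
      ≡⟨ cancel (rankSum k 1 φ es) (rankSum k 0 φ es) ⟩
    rankSum k 0 φ es ∎
    where
    lemma : ∀ x y z → x * (y - z) ≡ x * y + - (+ 1) * (x * z)
    lemma = solve-∀
    cancel : ∀ x y → x + (y + - (+ 1) * x) ≡ y
    cancel = solve-∀

-- Evaluation of the rank sums in ranks 0, 1 and 2

loops : List (Edge n) → ℕ
loops es = length (filter (λ e → ¬? (nonLoop? e)) es)

loops-nonLoop : {e : Edge n} → NonLoop e → ∀ es → loops (e ∷ es) ≡ loops es
loops-nonLoop {e = e} nl es with nonLoop? e
... | yes _ = refl
... | no l  = contradiction nl l

loops-loop : {e : Edge n} → ¬ NonLoop e → ∀ es → loops (e ∷ es) ≡ suc (loops es)
loops-loop {e = e} l es with nonLoop? e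
... | yes nl = contradiction nl l
... | no _   = refl

loops-none : {es : List (Edge n)} → All NonLoop es → loops es ≡ 0
loops-none []         = refl
loops-none (nl ∷ nls) = trans (loops-nonLoop nl _) (loops-none nls)

nonloops-nonLoop : {e : Edge n} → NonLoop e → ∀ es → nonloops (e ∷ es) ≡ e ∷ nonloops es
nonloops-nonLoop {e = e} nl es with nonLoop? e
... | yes _ = refl
... | no l  = contradiction nl l

nonloops-loop : {e : Edge n} → ¬ NonLoop e → ∀ es → nonloops (e ∷ es) ≡ nonloops es
nonloops-loop {e = e} l es with nonLoop? e
... | yes nl = contradiction nl l
... | no _   = refl

loops-merge : {a b : Fin n} → a ≢ b → ∀ es → loops (map (mergeᴱ a b) es) ≡ loops es ℕ.+ mult (a , b) es
loops-merge {a = a} {b} a≢b es = trans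
  (length-filter-map (λ e → ¬? (nonLoop? e)) (mergeᴱ a b) es)
  (length-filter-⊎ (λ e → ¬? (nonLoop? (mergeᴱ a b e))) (λ e → ¬? (nonLoop? e)) ((a , b) ∥?_)
    to (λ _ l nl → l (nl ∘ cong (merge a b))) (λ _ → mergeᴱ-loop a b ∘ ∥-sym)
    (λ _ l ∥e → l (NonLoop-resp ∥e a≢b)) es)
  where
  to : ∀ e → ¬ NonLoop (mergeᴱ a b e) → ¬ NonLoop e ⊎ (a , b) ∥ e
  to e l with nonLoop? e
  ... | no l′  = inj₁ l′
  ... | yes nl with (a , b) ∥? e
  ...   | yes ∥e = inj₂ ∥e
  ...   | no ∦e  = contradiction (mergeᴱ-nonLoop a b nl (∦e ∘ ∥-sym)) l

image : (Fin n → Fin n) → List (Edge n) → List (Edge n)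
image φ = map (mapᴱ φ)

image-contractBy : (φ : Fin n → Fin n) (e : Edge n) → ∀ es →
  image (contractBy φ e) es ≡ map (mergeᴱ (φ (proj₁ e)) (φ (proj₂ e))) (image φ es)
image-contractBy φ e es = map-∘ es

rankSum-00 : (φ : Fin n → Fin n) → ∀ es → rankSum 0 0 φ es ≡ is0 (loops (image φ es))
rankSum-00 φ [] = refl
rankSum-00 φ (e ∷ es) = by (nonLoop? (mapᴱ φ e))
  where
  by : Dec (NonLoop (mapᴱ φ e)) → rankSum 0 0 φ (e ∷ es) ≡ is0 (loops (image φ (e ∷ es)))
  by (yes nl) = trans (rankSum-zero-nonLoop φ nl 0 es)
    (trans (rankSum-00 φ es) (cong is0 (sym (loops-nonLoop nl (image φ es)))))
  by (no l)   = trans (rankSum-loop-0 φ l 0 es) (cong is0 (sym (loops-loop l (image φ es))))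

rankSum-01 : (φ : Fin n → Fin n) → ∀ es → rankSum 0 1 φ es ≡ is1 (loops (image φ es))
rankSum-01 φ [] = refl
rankSum-01 φ (e ∷ es) = by (nonLoop? (mapᴱ φ e))
  where
  by : Dec (NonLoop (mapᴱ φ e)) → rankSum 0 1 φ (e ∷ es) ≡ is1 (loops (image φ (e ∷ es)))
  by (yes nl) = trans (rankSum-zero-nonLoop φ nl 1 es)
    (trans (rankSum-01 φ es) (cong is1 (sym (loops-nonLoop nl (image φ es)))))
  by (no l)   = trans (rankSum-loop-1 φ l 0 es)
    (trans (rankSum-00 φ es) (cong is1 (sym (loops-loop l (image φ es)))))

loops-contractBy : (φ : Fin n → Fin n) {e : Edge n} → NonLoop (mapᴱ φ e) → ∀ es →
  loops (image (contractBy φ e) es) ≡ loops (image φ es) ℕ.+ mult (mapᴱ φ e) (nonloops (image φ es))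
loops-contractBy φ {e} nl es = trans (cong loops (image-contractBy φ e es))
  (trans (loops-merge nl (image φ es)) (cong (loops (image φ es) ℕ.+_) (sym (mult-nonloops (mapᴱ φ e) nl (image φ es)))))

-- This and `rankSum-11` are the two lowest coefficients of y^l (classes + classes* y), with l the
-- number of loops: contracting an edge that has k later parallel edges leaves l + k loops and the
-- rank 0 sum y^(l+k).
rankSum-10 : (φ : Fin n → Fin n) → ∀ es →
  rankSum 1 0 φ es ≡ is0 (loops (image φ es)) * classes (nonloops (image φ es))
rankSum-10 φ [] = refl
rankSum-10 φ (e ∷ es) = by (nonLoop? (mapᴱ φ e))
  where
  l = loops (image φ es)
  N = nonloops (image φ es)
  k = mult (mapᴱ φ e) N
  lemma : ∀ z c x → z * c + z * x ≡ z * (x + c)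
  lemma = solve-∀
  by : Dec (NonLoop (mapᴱ φ e)) →
    rankSum 1 0 φ (e ∷ es) ≡ is0 (loops (image φ (e ∷ es))) * classes (nonloops (image φ (e ∷ es)))
  by (no lp) = trans (rankSum-loop-0 φ lp 1 es)
    (sym (cong₂ (λ i M → is0 i * classes M) (loops-loop lp (image φ es)) (nonloops-loop lp (image φ es))))
  by (yes nl) = begin
    rankSum 1 0 φ (e ∷ es)
      ≡⟨ rankSum-suc-nonLoop φ nl 0 0 es ⟩
    rankSum 1 0 φ es + rankSum 0 0 (contractBy φ e) es
      ≡⟨ cong₂ _+_ (rankSum-10 φ es) (trans (rankSum-00 (contractBy φ e) es) (cong is0 (loops-contractBy φ nl es))) ⟩
    is0 l * classes N + is0 (l ℕ.+ k)
      ≡⟨ cong (λ t → is0 l * classes N + t) (is0-+ l k) ⟩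
    is0 l * classes N + is0 l * is0 k
      ≡⟨ lemma (is0 l) (classes N) (is0 k) ⟩
    is0 l * (is0 k + classes N)
      ≡⟨ cong₂ (λ i M → is0 i * classes M) (loops-nonLoop nl (image φ es)) (nonloops-nonLoop nl (image φ es)) ⟨
    _ ∎

rankSum-11 : (φ : Fin n → Fin n) → ∀ es →
  rankSum 1 1 φ es ≡ is0 (loops (image φ es)) * classes* (nonloops (image φ es))
                   + is1 (loops (image φ es)) * classes (nonloops (image φ es))
rankSum-11 φ [] = refl
rankSum-11 φ (e ∷ es) = by (nonLoop? (mapᴱ φ e))
  where
  l = loops (image φ es)
  N = nonloops (image φ es)
  k = mult (mapᴱ φ e) N
  value : ℕ → List (Edge _) → ℤ
  value i M = is0 i * classes* M + is1 i * classes M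
  by : Dec (NonLoop (mapᴱ φ e)) →
    rankSum 1 1 φ (e ∷ es) ≡ value (loops (image φ (e ∷ es))) (nonloops (image φ (e ∷ es)))
  by (no lp) = begin
    rankSum 1 1 φ (e ∷ es) ≡⟨ rankSum-loop-1 φ lp 1 es ⟩
    rankSum 1 0 φ es       ≡⟨ rankSum-10 φ es ⟩
    is0 l * classes N      ≡⟨ lemma (is0 l * classes N) (classes* N) ⟩
    value (suc l) N        ≡⟨ cong₂ value (loops-loop lp (image φ es)) (nonloops-loop lp (image φ es)) ⟨
    _ ∎
    where
    lemma : ∀ x y → x ≡ + 0 * y + x
    lemma = solve-∀
  by (yes nl) = begin
    rankSum 1 1 φ (e ∷ es)
      ≡⟨ rankSum-suc-nonLoop φ nl 0 1 es ⟩
    rankSum 1 1 φ es + rankSum 0 1 (contractBy φ e) es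
      ≡⟨ cong₂ _+_ (rankSum-11 φ es) (trans (rankSum-01 (contractBy φ e) es) (cong is1 (loops-contractBy φ nl es))) ⟩
    value l N + is1 (l ℕ.+ k)
      ≡⟨ cong (λ t → value l N + t) (is1-+ l k) ⟩
    value l N + (is1 l * is0 k + is0 l * is1 k)
      ≡⟨ lemma (is0 l) (is1 l) (classes* N) (classes N) (is0 k) (is1 k) ⟩
    value l (mapᴱ φ e ∷ N)
      ≡⟨ cong₂ value (loops-nonLoop nl (image φ es)) (nonloops-nonLoop nl (image φ es)) ⟨
    _ ∎
    where
    lemma : ∀ z o c′ c x y → z * c′ + o * c + (o * x + z * y) ≡ z * (y + c′) + o * (x + c)
    lemma = solve-∀

loops-merged : (e : Edge n) → NonLoop e → ∀ {es} → All NonLoop es →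
  loops (image (contractBy id e) es) ≡ mult e es
loops-merged e nl {es} nls = trans (loops-merge nl es) (cong (ℕ._+ mult e es) (loops-none nls))

-- Only the first edge of a class leaves no loops after contraction. It then adds the classes of G /
-- e, that is all old classes (the growth of `pairs`) less the common neighbours of its ends (the
-- growth of `tri`). The summand `1 - z` of `classes-merge` is killed by the factor z, as
-- `z * z ≡ z`.
rankSum-20 : {es : List (Edge n)} → All NonLoop es → rankSum 2 0 id es ≡ pairs es - tri es
rankSum-20 {n} [] = cong (λ t → + 0 - t) (sym (tri-[] {n}))
rankSum-20 {es = e@(a , b) ∷ es} (nl ∷ nls) = begin
  rankSum 2 0 id (e ∷ es)
    ≡⟨ rankSum-suc-nonLoop id nl 1 0 es ⟩
  rankSum 2 0 id es + rankSum 1 0 (merge a b) es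
    ≡⟨ cong₂ _+_ (rankSum-20 nls) (trans (rankSum-10 (merge a b) es) (cong (λ k → is0 k * Q) (loops-merged e nl nls))) ⟩
  pairs es - tri es + z * Q
    ≡⟨ lemma (pairs es) (tri es) z Q (common es e) (is0-idem (mult e es)) (classes-merge a b nl nls) ⟩
  z * classes es + pairs es - (tri es + z * common es e)
    ≡⟨ cong (λ t → z * classes es + pairs es - t) (tri-∷ e nl nls) ⟨
  z * classes es + pairs es - tri (e ∷ es) ∎
  where
  z = is0 (mult e es)
  Q = classes (nonloops (map (mergeᴱ a b) es))
  lemma : ∀ x t z q c {p} → z * z ≡ z → q + c + (+ 1 - z) ≡ p → x - t + z * q ≡ z * p + x - (t + z * c)
  lemma x t z q c zz refl = begin
    x - t + z * q
      ≡⟨ left x t z q ⟩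
    x - t + z * q + z - z
      ≡⟨ cong (λ s → x - t + z * q + z - s) zz ⟨
    x - t + z * q + z - z * z
      ≡⟨ right x t z q c ⟩
    z * (q + c + (+ 1 - z)) + x - (t + z * c) ∎
    where
    left : ∀ x t z q → x - t + z * q ≡ x - t + z * q + z - z
    left = solve-∀
    right : ∀ x t z q c → x - t + z * q + z - z * z ≡ z * (q + c + (+ 1 - z)) + x - (t + z * c)
    right = solve-∀

-- Contracting e leaves as many loops as e has parallel edges: with none the non-trivial classes of
-- G / e count, with one the factor y leaves all its classes, with more nothing remains in degree 1.
-- The form with `commons` is the one that fits an induction on the edges.
rankSum-21′ : {es : List (Edge n)} → All NonLoop es →
  rankSum 2 1 id es ≡ classes* es * (classes es - + 1) - commons es + tri es
rankSum-21′ {n} [] = cong (λ t → + 0 + t) (sym (tri-[] {n}))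
rankSum-21′ {es = e@(a , b) ∷ es} (nl ∷ nls) = begin
  rankSum 2 1 id (e ∷ es)
    ≡⟨ rankSum-suc-nonLoop id nl 1 1 es ⟩
  rankSum 2 1 id es + rankSum 1 1 (merge a b) es
    ≡⟨ cong₂ _+_ (rankSum-21′ nls) (trans (rankSum-11 (merge a b) es) (cong (λ k → is0 k * Q* + is1 k * Q) (loops-merged e nl nls))) ⟩
  classes* es * (classes es - + 1) - commons es + tri es + (z * Q* + o * Q)
    ≡⟨ cong (λ t → classes* es * (classes es - + 1) - commons es + tri es + t) (cong₂ _+_ (contracted* (mult e es) refl) (contracted Q (common es e) z o (is0*is1 (mult e es)) (classes-merge a b nl nls))) ⟩
  classes* es * (classes es - + 1) - commons es + tri es
    + (z * (classes* es + common es e - mixed es e) + o * (classes es - + 1 - common es e))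
    ≡⟨ lemma (classes* es) (classes es) (commons es) (tri es) z o (common es e) (mixed es e) (is0*is1 (mult e es)) ⟩
  (o + classes* es) * (z + classes es - + 1) - (commons es + o * common es e + z * mixed es e) + (tri es + z * common es e)
    ≡⟨ cong₂ (λ s t → (o + classes* es) * (z + classes es - + 1) - s + t) (commons-∷ e nl nls) (tri-∷ e nl nls) ⟨
  (o + classes* es) * (z + classes es - + 1) - commons (e ∷ es) + tri (e ∷ es) ∎
  where
  z = is0 (mult e es)
  o = is1 (mult e es)
  Q = classes (nonloops (map (mergeᴱ a b) es))
  Q* = classes* (nonloops (map (mergeᴱ a b) es))
  -- `classes*-merge` needs e to have no parallel edge, which is precisely when the factor `is0 k`
  -- does not vanish.
  contracted* : ∀ k → mult e es ≡ k → is0 k * Q* ≡ is0 k * (classes* es + common es e - mixed es e)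
  contracted* zero    eq = cong (+ 1 *_) (trans (ring Q* (mixed es e)) (cong (_- mixed es e) (classes*-merge a b nl nls eq)))
    where
    ring : ∀ q x → q ≡ q + x - x
    ring = solve-∀
  contracted* (suc _) _  = refl
  contracted : ∀ q c z o {p} → z * o ≡ + 0 → q + c + (+ 1 - z) ≡ p → o * q ≡ o * (p - + 1 - c)
  contracted q c z o zo refl = begin
    o * q                                  ≡⟨ left o q ⟩
    o * q - + 0                            ≡⟨ cong (λ t → o * q - t) zo ⟨
    o * q - z * o                          ≡⟨ right o q c z ⟩
    o * (q + c + (+ 1 - z) - + 1 - c)      ∎
    where
    left : ∀ o q → o * q ≡ o * q - + 0
    left = solve-∀
    right : ∀ o q c z → o * q - z * o ≡ o * (q + c + (+ 1 - z) - + 1 - c)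
    right = solve-∀
  lemma : ∀ p* p d t z o c x → z * o ≡ + 0 →
    p* * (p - + 1) - d + t + (z * (p* + c - x) + o * (p - + 1 - c))
      ≡ (o + p*) * (z + p - + 1) - (d + o * c + z * x) + (t + z * c)
  lemma p* p d t z o c x zo = begin
    p* * (p - + 1) - d + t + (z * (p* + c - x) + o * (p - + 1 - c))
      ≡⟨ left p* p d t z o c x ⟩
    (o + p*) * (z + p - + 1) - (d + o * c + z * x) + (t + z * c) - z * o
      ≡⟨ cong (λ s → (o + p*) * (z + p - + 1) - (d + o * c + z * x) + (t + z * c) - s) zo ⟩
    (o + p*) * (z + p - + 1) - (d + o * c + z * x) + (t + z * c) - + 0
      ≡⟨ ℤ.+-identityʳ _ ⟩
    _ ∎
    where
    left : ∀ p* p d t z o c x →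
      p* * (p - + 1) - d + t + (z * (p* + c - x) + o * (p - + 1 - c))
        ≡ (o + p*) * (z + p - + 1) - (d + o * c + z * x) + (t + z * c) - z * o
    left = solve-∀

rankSum-21 : {es : List (Edge n)} → All NonLoop es → rankSum 2 1 id es ≡ ∑contractions es + tri es
rankSum-21 {es = es} nls = trans (rankSum-21′ nls) (cong (_+ tri es) (sym (∑contractions-commons nls)))

-- Rank and components

-- A system of representatives. By `transversal-length` its size does not depend on the choice, so
-- components can be counted with any convenient system instead of the deduplicated vertex list
-- behind `c`.
record Transversal (R : Rel (Fin n) 0ℓ) (T : List (Fin n)) : Set where
  field
    unrelated : AllPairs (λ u v → ¬ R u v) T
    covers    : ∀ v → Any (R v) T

open Transversal

unrelated-lookup : {R : Rel (Fin n) 0ℓ} → (∀ {u v} → R u v → R v u) → ∀ {T} → AllPairs (λ u v → ¬ R u v) T →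
  ∀ i j → R (List.lookup T i) (List.lookup T j) → i ≡ j
unrelated-lookup R-sym (_ ∷ _)   zero    zero    _ = refl
unrelated-lookup R-sym (¬r ∷ _)  zero    (suc j) r = contradiction r (All.lookup ¬r (∈-lookup j))
unrelated-lookup R-sym (¬r ∷ _)  (suc i) zero    r = contradiction (R-sym r) (All.lookup ¬r (∈-lookup i))
unrelated-lookup R-sym (_ ∷ ¬rs) (suc i) (suc j) r = cong suc (unrelated-lookup R-sym ¬rs i j r)

module _ {R : Rel (Fin n) 0ℓ} (R-equiv : IsEquivalence R) where
  open IsEquivalence R-equiv using () renaming (sym to R-sym; trans to R-trans)

  transversal-≤ : ∀ {S T} → Transversal R S → Transversal R T → length S ℕ.≤ length T
  transversal-≤ {S} {T} s t = Fin.injective⇒≤ {f = f} λ {i} {j} eq → unrelated-lookup R-sym (unrelated s) i j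
      (R-trans (hits i) (R-sym (subst (λ k → R (List.lookup S j) (List.lookup T k)) (sym eq) (hits j))))
    where
    f : Fin (length S) → Fin (length T)
    f i = index (covers t (List.lookup S i))
    hits : ∀ i → R (List.lookup S i) (List.lookup T (f i))
    hits i = Any.lookup-index (covers t (List.lookup S i))

  transversal-length : ∀ {S T} → Transversal R S → Transversal R T → length S ≡ length T
  transversal-length s t = ℕ.≤-antisym (transversal-≤ s t) (transversal-≤ t s)

transversal-resp : {R S : Rel (Fin n) 0ℓ} → (∀ {u v} → R u v → S u v) → (∀ {u v} → S u v → R u v) →
  ∀ {T} → Transversal R T → Transversal S T
transversal-resp R⇒S S⇒R t = record
  { unrelated = AllPairs.map (λ ¬r s → ¬r (S⇒R s)) (unrelated t)
  ; covers    = λ v → Any.map R⇒S (covers t v)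
  }

Joined : List (Edge n) → Rel (Fin n) 0ℓ
Joined es = EqClosure λ u v → (u , v) ∈ es

joined-equivalence : (es : List (Edge n)) → IsEquivalence (Joined es)
joined-equivalence es = EqClosure.isEquivalence _

module _ {es : List (Edge n)} where
  open IsEquivalence (joined-equivalence es) public
    using () renaming (refl to joined-refl; reflexive to joined-reflexive; sym to joined-sym; trans to joined-trans)

joined-loop : {e : Edge n} → ¬ NonLoop e → ∀ {es u v} → Joined (e ∷ es) u v → Joined es u v
joined-loop {e = a , b} l {es} = EqClosure.fold (joined-equivalence es) step
  where
  step : ∀ {u v} → (u , v) ∈ ((a , b) ∷ es) → Joined es u v
  step (there p)   = EqClosure.return p
  step (here refl) with a Fin.≟ b
  ... | yes refl = joined-refl
  ... | no a≢b   = contradiction a≢b l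

module _ (a b : Fin n) (a≢b : a ≢ b) (es : List (Edge n)) where

  private
    m₁ : Fin n → Fin n
    m₁ = merge a b
    es/e : List (Edge n)
    es/e = map (mergeᴱ a b) es

  joined-merge : ∀ {u v} → Joined ((a , b) ∷ es) u v → Joined es/e (m₁ u) (m₁ v)
  joined-merge = EqClosure.gfold (joined-equivalence es/e) m₁ step
    where
    step : ∀ {u v} → (u , v) ∈ ((a , b) ∷ es) → Joined es/e (m₁ u) (m₁ v)
    step (here refl) = joined-reflexive (merge-ends a b)
    step (there p)   = EqClosure.return (∈-map⁺ (mergeᴱ a b) p)

  joined-merged : ∀ u → Joined ((a , b) ∷ es) u (m₁ u)
  joined-merged u with u Fin.≟ b
  ... | yes refl = joined-sym (EqClosure.return (here refl))
  ... | no _     = joined-refl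

  joined-unmerge : ∀ {u v} → Joined es/e (m₁ u) (m₁ v) → Joined ((a , b) ∷ es) u v
  joined-unmerge {u} {v} p = joined-trans (joined-merged u)
    (joined-trans (EqClosure.fold (joined-equivalence ((a , b) ∷ es)) step p) (joined-sym (joined-merged v)))
    where
    step : ∀ {x y} → (x , y) ∈ es/e → Joined ((a , b) ∷ es) x y
    step p with (u , v) , uv∈es , refl ← ∈-map⁻ (mergeᴱ a b) p =
      joined-trans (joined-sym (joined-merged u)) (joined-trans (EqClosure.return (there uv∈es)) (joined-merged v))

  merge-≢ : ∀ v → m₁ v ≢ b
  merge-≢ v eq with v Fin.≟ b
  ... | yes _  = a≢b eq
  ... | no v≢b = v≢b eq

  -- No edge of the merged list ends in b, so being equal to b is invariant along its paths.
  b-isolated : ∀ {v} → Joined es/e b v → v ≡ b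
  b-isolated p = proj₁ (EqClosure.fold iff-equivalence step p) refl
    where
    Iff : Rel (Fin n) 0ℓ
    Iff u v = (u ≡ b → v ≡ b) × (v ≡ b → u ≡ b)
    iff-equivalence : IsEquivalence Iff
    iff-equivalence = record
      { refl  = id , id
      ; sym   = swap
      ; trans = λ (f , g) (h , k) → h ∘ f , g ∘ k
      }
    step : ∀ {u v} → (u , v) ∈ es/e → Iff u v
    step p with (u , v) , _ , refl ← ∈-map⁻ (mergeᴱ a b) p =
      (λ eq → contradiction eq (merge-≢ u)) , (λ eq → contradiction eq (merge-≢ v))

  -- The vertex b, left behind by the contraction, is a component of its own and needs one extra
  -- representative. It makes up for the rank lost by contracting the edge.
  transversal-merge : ∀ {T} → Transversal (Joined ((a , b) ∷ es)) T → Transversal (Joined es/e) (b ∷ map m₁ T)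
  transversal-merge {T} t = record
    { unrelated = All.map⁺ (All.universal (λ v b~v → merge-≢ v (b-isolated b~v)) T)
                  ∷ AllPairs.map⁺ (AllPairs.map (λ ¬r r → ¬r (joined-unmerge r)) (unrelated t))
    ; covers = λ v → covered v (v Fin.≟ b)
    }
    where
    covered : ∀ v → Dec (v ≡ b) → Any (Joined es/e v) (b ∷ map m₁ T)
    covered v (yes refl) = here joined-refl
    covered v (no v≢b)   = there (Any.map⁺ (Any.map
      (λ r → joined-trans (joined-reflexive (sym (merge-miss a v≢b))) (joined-merge r)) (covers t v)))

-- Vertices outside the image of φ are kept as isolated vertices, so the total is n for every φ.
transversal-rank : (φ : Fin n → Fin n) → ∀ es {T} → Transversal (Joined (image φ es)) T → length T ℕ.+ rank φ es ≡ n
transversal-rank {n} φ [] {T} t = begin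
  length T ℕ.+ 0     ≡⟨ ℕ.+-identityʳ (length T) ⟩
  length T           ≡⟨ transversal-length (joined-equivalence []) t everything ⟩
  length (allFin n)  ≡⟨ length-tabulate id ⟩
  n                  ∎
  where
  discrete : ∀ {u v : Fin n} → Joined [] u v → u ≡ v
  discrete = EqClosure.fold isEquivalence λ ()
  everything : Transversal (Joined []) (allFin n)
  everything = record
    { unrelated = AllPairs.tabulate⁺ λ i≢j i~j → i≢j (discrete i~j)
    ; covers    = λ v → Any.map (λ { refl → joined-refl }) (∈-allFin v)
    }
transversal-rank {n} φ (e ∷ es) {T} t = by (nonLoop? (mapᴱ φ e))
  where
  by : Dec (NonLoop (mapᴱ φ e)) → length T ℕ.+ rank φ (e ∷ es) ≡ n
  by (no l) = trans (cong (length T ℕ.+_) (rank-loop φ l es))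
    (transversal-rank φ es (transversal-resp (joined-loop l) (EqClosure.map there) t))
  by (yes nl) = begin
    length T ℕ.+ rank φ (e ∷ es)
      ≡⟨ cong (length T ℕ.+_) (rank-nonLoop φ nl es) ⟩
    length T ℕ.+ suc (rank (contractBy φ e) es)
      ≡⟨ ℕ.+-suc (length T) _ ⟩
    suc (length T ℕ.+ rank (contractBy φ e) es)
      ≡⟨ cong (λ k → suc (k ℕ.+ rank (contractBy φ e) es)) (length-map _ T) ⟨
    length (φ (proj₂ e) ∷ map (merge (φ (proj₁ e)) (φ (proj₂ e))) T) ℕ.+ rank (contractBy φ e) es
      ≡⟨ transversal-rank (contractBy φ e) es
           (subst (λ M → Transversal (Joined M) (φ (proj₂ e) ∷ map (merge (φ (proj₁ e)) (φ (proj₂ e))) T)) (sym (image-contractBy φ e es))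
             (transversal-merge (φ (proj₁ e)) (φ (proj₂ e)) nl (image φ es) t)) ⟩
    n ∎

restrict : (Fin m → Edge n) → Subset m → List (Edge n)
restrict f Vec.[]             = []
restrict f (outside Vec.∷ A) = restrict (f ∘ suc) A
restrict f (inside Vec.∷ A)  = f zero ∷ restrict (f ∘ suc) A

length-restrict : (f : Fin m → Edge n) (A : Subset m) → length (restrict f A) ≡ ∣ A ∣
length-restrict f Vec.[]             = refl
length-restrict f (outside Vec.∷ A) = length-restrict (f ∘ suc) A
length-restrict f (inside Vec.∷ A)  = cong suc (length-restrict (f ∘ suc) A)

∈-restrict⁺ : (f : Fin m → Edge n) {A : Subset m} → ∀ {i} → i Subset.∈ A → f i ∈ restrict f A
∈-restrict⁺ f {inside Vec.∷ A}  Vec.here      = here refl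
∈-restrict⁺ f {outside Vec.∷ A} (Vec.there p) = ∈-restrict⁺ (f ∘ suc) p
∈-restrict⁺ f {inside Vec.∷ A}  (Vec.there p) = there (∈-restrict⁺ (f ∘ suc) p)

∈-restrict⁻ : (f : Fin m → Edge n) (A : Subset m) → ∀ {e} → e ∈ restrict f A → Prod.∃ λ i → i Subset.∈ A × f i ≡ e
∈-restrict⁻ f (outside Vec.∷ A) p with i , i∈A , eq ← ∈-restrict⁻ (f ∘ suc) A p = suc i , Vec.there i∈A , eq
∈-restrict⁻ f (inside Vec.∷ A)  (here refl) = zero , Vec.here , refl
∈-restrict⁻ f (inside Vec.∷ A)  (there p) with i , i∈A , eq ← ∈-restrict⁻ (f ∘ suc) A p = suc i , Vec.there i∈A , eq

linked-equivalence : (G : Graph n m) (A : Subset m) → IsEquivalence (Linked G A)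
linked-equivalence G A = EqClosure.isEquivalence _

linked⇒joined : (G : Graph n m) (A : Subset m) → ∀ {u v} → Linked G A u v → Joined (restrict (ends G) A) u v
linked⇒joined G A = EqClosure.map λ { (e , e∈A , refl) → ∈-restrict⁺ (ends G) e∈A }

joined⇒linked : (G : Graph n m) (A : Subset m) → ∀ {u v} → Joined (restrict (ends G) A) u v → Linked G A u v
joined⇒linked G A = EqClosure.map (∈-restrict⁻ (ends G) A)

deduplicate-unrelated : {R : Rel (Fin n) 0ℓ} (R? : Binary.Decidable R) → ∀ xs →
  AllPairs (λ u v → ¬ R u v) (deduplicate R? xs)
deduplicate-unrelated R? []       = []
deduplicate-unrelated R? (x ∷ xs) =
  All.all-filter (¬? ∘ R? x) (deduplicate R? xs) ∷ AllPairs.filter⁺ (¬? ∘ R? x) (deduplicate-unrelated R? xs)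

representatives-transversal : (G : Graph n m) (A : Subset m) → Transversal (Linked G A) (representatives G A)
representatives-transversal {n} G A = record
  { unrelated = deduplicate-unrelated (linked? G A) (allFin n)
  ; covers    = λ v → SetoidMembership.∈-deduplicate⁺ (EqClosure.setoid _) (linked? G A)
      (λ y~x z~x → EqClosure.transitive _ z~x (EqClosure.symmetric _ y~x))
      (Any.map (λ { refl → EqClosure.reflexive _ }) (∈-allFin v))
  }

c-rank : (G : Graph n m) (A : Subset m) → c G A ℕ.+ rank id (restrict (ends G) A) ≡ n
c-rank G A = transversal-rank id (restrict (ends G) A)
  (subst (λ es → Transversal (Joined es) (representatives G A)) (sym (map-id (restrict (ends G) A)))
    (transversal-resp (linked⇒joined G A) (joined⇒linked G A) (representatives-transversal G A)))

linked-component : (G : Graph n m) (A : Subset m) → ∀ v → Linked G A v (List.lookup (representatives G A) (component G A v))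
-- This has to be the same membership proof as the one whose index defines `component`, hence the
-- repetition.
linked-component G A v = Any.lookup-index
  (SetoidMembership.∈-deduplicate⁺ (EqClosure.setoid _) (linked? G A)
    (λ y~x z~x → EqClosure.transitive _ z~x (EqClosure.symmetric _ y~x))
    (Any.map _ (∈-allFin v)))

component⇒linked : (G : Graph n m) (A : Subset m) → ∀ {u v} → component G A u ≡ component G A v → Linked G A u v
component⇒linked G A {u} {v} eq = L.trans (linked-component G A u)
    (subst (λ i → Linked G A (List.lookup (representatives G A) i) v) (sym eq) (L.sym (linked-component G A v)))
  where module L = IsEquivalence (linked-equivalence G A)

linked⇒component : (G : Graph n m) (A : Subset m) → ∀ {u v} → Linked G A u v → component G A u ≡ component G A v
linked⇒component G A {u} {v} u~v = unrelated-lookup L.sym (unrelated (representatives-transversal G A)) _ _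
    (L.trans (L.sym (linked-component G A u)) (L.trans u~v (linked-component G A v)))
  where module L = IsEquivalence (linked-equivalence G A)

c-⊤ : (G : Graph n m) → Connected G → c G ⊤ ≡ 1
c-⊤ {suc n} G (_ , linked) = transversal-length (linked-equivalence G ⊤) (representatives-transversal G ⊤)
  (record { unrelated = [] ∷ [] ; covers = λ v → here (linked v zero) })

∑ˡ : {A : Set} → (A → ℤ) → List A → ℤ
∑ˡ F xs = foldr _+_ (+ 0) (map F xs)

∑ˡ-++ : {A : Set} (F : A → ℤ) → ∀ xs ys → ∑ˡ F (xs ++ ys) ≡ ∑ˡ F xs + ∑ˡ F ys
∑ˡ-++ F []       ys = sym (ℤ.+-identityˡ (∑ˡ F ys))
∑ˡ-++ F (x ∷ xs) ys = trans (cong (λ t → F x + t) (∑ˡ-++ F xs ys)) (sym (ℤ.+-assoc (F x) (∑ˡ F xs) (∑ˡ F ys)))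

∑ˡ-map : {A B : Set} (F : B → ℤ) (f : A → B) → ∀ xs → ∑ˡ F (map f xs) ≡ ∑ˡ (F ∘ f) xs
∑ˡ-map F f xs = cong (foldr _+_ (+ 0)) (sym (map-∘ xs))

∑ˡ-cong : {A : Set} {F G : A → ℤ} → (∀ x → F x ≡ G x) → ∀ xs → ∑ˡ F xs ≡ ∑ˡ G xs
∑ˡ-cong eq []       = refl
∑ˡ-cong eq (x ∷ xs) = cong₂ _+_ (eq x) (∑ˡ-cong eq xs)

∑-subsets : (f : Fin m → Edge n) (F : List (Edge n) → ℤ) →
  ∑ˡ (λ A → F (restrict f A)) (subsets m) ≡ ∑⊆ F (tabulate f)
∑-subsets {zero}  f F = ℤ.+-identityʳ (F [])
∑-subsets {suc m} f F = begin
  ∑ˡ (λ A → F (restrict f A)) (map (outside Vec.∷_) (subsets m) ++ map (inside Vec.∷_) (subsets m))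
    ≡⟨ ∑ˡ-++ (λ A → F (restrict f A)) (map (outside Vec.∷_) (subsets m)) (map (inside Vec.∷_) (subsets m)) ⟩
  _ ≡⟨ cong₂ _+_ (∑ˡ-map (λ A → F (restrict f A)) (outside Vec.∷_) (subsets m)) (∑ˡ-map (λ A → F (restrict f A)) (inside Vec.∷_) (subsets m)) ⟩
  _ ≡⟨ cong₂ _+_ (∑-subsets (f ∘ suc) F) (∑-subsets (f ∘ suc) (λ A → F (f zero ∷ A))) ⟩
  ∑⊆ F (tabulate f) ∎

-- Coefficients of the Tutte polynomial

open ℤ[x] using (_⊕_; _⊗_; coeff) renaming (Poly to ℤ[x]-Poly)
open ℤ[x,y] using () renaming (Poly to ℤ[x,y]-Poly; _⊕_ to _⊕₂_; _⊗_ to _⊗₂_; coeff to coeff₂)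

coeff-⊕ : ∀ p q i → coeff (p ⊕ q) i ≡ coeff p i + coeff q i
coeff-⊕ []      q       i       = sym (ℤ.+-identityˡ (coeff q i))
coeff-⊕ (a ∷ p) []      i       = sym (ℤ.+-identityʳ (coeff (a ∷ p) i))
coeff-⊕ (a ∷ p) (b ∷ q) zero    = refl
coeff-⊕ (a ∷ p) (b ∷ q) (suc i) = coeff-⊕ p q i

coeff-scale : ∀ a q i → coeff (map (a *_) q) i ≡ a * coeff q i
coeff-scale a []      i       = sym (ℤ.*-zeroʳ a)
coeff-scale a (b ∷ q) zero    = refl
coeff-scale a (b ∷ q) (suc i) = coeff-scale a q i

coeff-⊗ : ∀ a p q i → coeff ((a ∷ p) ⊗ q) i ≡ a * coeff q i + coeff (+ 0 ∷ (p ⊗ q)) i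
coeff-⊗ a p q i = trans (coeff-⊕ (map (a *_) q) (+ 0 ∷ (p ⊗ q)) i) (cong (_+ coeff (+ 0 ∷ (p ⊗ q)) i) (coeff-scale a q i))

coeff-zero : ∀ i → coeff (+ 0 ∷ []) i ≡ + 0
coeff-zero zero    = refl
coeff-zero (suc i) = refl

coeff-constant-⊗ : ∀ a q i → coeff ((a ∷ []) ⊗ q) i ≡ a * coeff q i
coeff-constant-⊗ a q i = trans (coeff-⊗ a [] q i) (trans (cong (λ t → a * coeff q i + t) (coeff-zero i)) (ℤ.+-identityʳ _))

coeff-⊗-constant : ∀ p q → (∀ i → coeff q (suc i) ≡ + 0) → ∀ i → coeff (p ⊗ q) i ≡ coeff p i * coeff q 0
coeff-⊗-constant []      q q-const i       = refl
coeff-⊗-constant (a ∷ p) q q-const zero    = trans (coeff-⊗ a p q zero) (ℤ.+-identityʳ (a * coeff q 0))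
coeff-⊗-constant (a ∷ p) q q-const (suc i) = begin
  coeff ((a ∷ p) ⊗ q) (suc i)            ≡⟨ coeff-⊗ a p q (suc i) ⟩
  a * coeff q (suc i) + coeff (p ⊗ q) i  ≡⟨ cong₂ (λ s t → a * s + t) (q-const i) (coeff-⊗-constant p q q-const i) ⟩
  a * + 0 + coeff p i * coeff q 0        ≡⟨ cong (_+ coeff p i * coeff q 0) (ℤ.*-zeroʳ a) ⟩
  + 0 + coeff p i * coeff q 0            ≡⟨ ℤ.+-identityˡ _ ⟩
  coeff p i * coeff q 0                  ∎

⊕-[] : ∀ p → p ⊕ [] ≡ p
⊕-[] []      = refl
⊕-[] (a ∷ p) = refl

-- The exponent of y comes first, because ℤ[x,y] is (ℤ[x])[y].
coefficient : ℤ[x,y]-Poly → (j i : ℕ) → ℤ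
coefficient p j i = coeff (coeff₂ p j) i

coefficient-⊕ : ∀ p q j i → coefficient (p ⊕₂ q) j i ≡ coefficient p j i + coefficient q j i
coefficient-⊕ []      q       j       i = sym (ℤ.+-identityˡ (coefficient q j i))
coefficient-⊕ (a ∷ p) []      j       i = sym (ℤ.+-identityʳ (coefficient (a ∷ p) j i))
coefficient-⊕ (a ∷ p) (b ∷ q) zero    i = coeff-⊕ a b i
coefficient-⊕ (a ∷ p) (b ∷ q) (suc j) i = coefficient-⊕ p q j i

coefficient-scale : ∀ a q j i → coefficient (map (a ⊗_) q) j i ≡ coeff (a ⊗ coeff₂ q j) i
coefficient-scale a []      j       i = sym (trans (coeff-⊗-constant a [] (λ _ → refl) i) (ℤ.*-zeroʳ (coeff a i)))
coefficient-scale a (b ∷ q) zero    i = refl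
coefficient-scale a (b ∷ q) (suc j) i = coefficient-scale a q j i

coefficient-zero : ∀ j i → coefficient ([] ∷ []) j i ≡ + 0
coefficient-zero zero    i = refl
coefficient-zero (suc j) i = refl

coefficient-constant-⊗ : ∀ a q j i → coefficient ((a ∷ []) ⊗₂ q) j i ≡ coeff (a ⊗ coeff₂ q j) i
coefficient-constant-⊗ a q j i = begin
  coefficient (map (a ⊗_) q ⊕₂ ([] ∷ [])) j i
    ≡⟨ coefficient-⊕ (map (a ⊗_) q) ([] ∷ []) j i ⟩
  coefficient (map (a ⊗_) q) j i + coefficient ([] ∷ []) j i
    ≡⟨ cong₂ _+_ (coefficient-scale a q j i) (coefficient-zero j i) ⟩
  coeff (a ⊗ coeff₂ q j) i + + 0
    ≡⟨ ℤ.+-identityʳ _ ⟩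
  coeff (a ⊗ coeff₂ q j) i ∎

x-1 : ℤ[x]-Poly
x-1 = - (+ 1) ∷ + 1 ∷ []

-- The trailing `⊕ []` is what multiplying polynomials of degree 0 in y leaves behind; with it each
-- step of `[x-1]^` is a computation.
x-1^ : ℕ → ℤ[x]-Poly
x-1^ zero  = + 1 ∷ []
x-1^ (suc a) = (x-1 ⊗ (x-1^ a)) ⊕ []

coeff-x-1^ : ∀ a i → coeff (x-1^ a) i ≡ power a i
coeff-x-1^ zero    zero    = refl
coeff-x-1^ zero    (suc i) = refl
coeff-x-1^ (suc a) i       = trans (cong (λ p → coeff p i) (⊕-[] (x-1 ⊗ (x-1^ a))))
  (trans (coeff-⊗ (- (+ 1)) (+ 1 ∷ []) (x-1^ a) i) (step i))
  where
  step : ∀ i → - (+ 1) * coeff (x-1^ a) i + coeff (+ 0 ∷ ((+ 1 ∷ []) ⊗ (x-1^ a))) i ≡ power (suc a) i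
  step zero    = trans (ℤ.+-identityʳ _) (trans (ℤ.-1*i≡-i (coeff (x-1^ a) 0)) (cong -_ (coeff-x-1^ a 0)))
  step (suc i) = begin
    - (+ 1) * coeff (x-1^ a) (suc i) + coeff ((+ 1 ∷ []) ⊗ (x-1^ a)) i
      ≡⟨ cong₂ _+_ (trans (ℤ.-1*i≡-i (coeff (x-1^ a) (suc i))) (cong -_ (coeff-x-1^ a (suc i))))
           (trans (coeff-constant-⊗ (+ 1) (x-1^ a) i) (trans (ℤ.*-identityˡ _) (coeff-x-1^ a i))) ⟩
    - power a (suc i) + power a i
      ≡⟨ ℤ.+-comm (- power a (suc i)) (power a i) ⟩
    power a i - power a (suc i) ∎

-- The forms to which x - 1 and y - 1 in the definition of `T` compute, so that `t-power` applies to
-- `T` without conversion.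
[x-1] [y-1] : ℤ[x,y]-Poly
[x-1] = x-1 ∷ []
[y-1] = (- (+ 1) ∷ []) ∷ (+ 1 ∷ []) ∷ []

[x-1]^ : ∀ a → [x-1] ^ a ≡ x-1^ a ∷ []
[x-1]^ zero    = refl
[x-1]^ (suc a) = cong ([x-1] ⊗₂_) ([x-1]^ a)

coefficient-[y-1]^ : ∀ b j i → coefficient ([y-1] ^ b) j i ≡ power b j * is0 i
coefficient-[y-1]^ zero    zero    zero    = refl
coefficient-[y-1]^ zero    zero    (suc i) = refl
coefficient-[y-1]^ zero    (suc j) i       = refl
coefficient-[y-1]^ (suc b) j       i       = trans
    (coefficient-⊕ (map ((- (+ 1) ∷ []) ⊗_) q) ([] ∷ ((+ 1 ∷ []) ∷ []) ⊗₂ q) j i)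
    (trans (cong (_+ coefficient ([] ∷ ((+ 1 ∷ []) ∷ []) ⊗₂ q) j i)
      (trans (coefficient-scale (- (+ 1) ∷ []) q j i)
        (trans (coeff-constant-⊗ (- (+ 1)) (coeff₂ q j) i) (cong (- (+ 1) *_) (coefficient-[y-1]^ b j i)))))
      (step j))
  where
  q = [y-1] ^ b
  step : ∀ j → - (+ 1) * (power b j * is0 i) + coefficient ([] ∷ ((+ 1 ∷ []) ∷ []) ⊗₂ q) j i ≡ power (suc b) j * is0 i
  step zero    = ring (power b 0) (is0 i)
    where
    ring : ∀ x y → - (+ 1) * (x * y) + + 0 ≡ - x * y
    ring = solve-∀
  step (suc j) = trans
      (cong (λ t → - (+ 1) * (power b (suc j) * is0 i) + t)
        (trans (coefficient-constant-⊗ (+ 1 ∷ []) q j i)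
          (trans (coeff-constant-⊗ (+ 1) (coeff₂ q j) i) (cong (+ 1 *_) (coefficient-[y-1]^ b j i)))))
      (ring (power b (suc j)) (power b j) (is0 i))
    where
    ring : ∀ x z y → - (+ 1) * (x * y) + + 1 * (z * y) ≡ (z - x) * y
    ring = solve-∀

-- No convolution arises: (x - 1)^a is constant in y, and the coefficients of (y - 1)^b are constant
-- in x.
coefficient-term : ∀ a b j i → coefficient (([x-1] ^ a) ⊗₂ ([y-1] ^ b)) j i ≡ power a i * power b j
coefficient-term a b j i = begin
  coefficient (([x-1] ^ a) ⊗₂ q) j i
    ≡⟨ cong (λ p → coefficient (p ⊗₂ q) j i) ([x-1]^ a) ⟩
  coefficient ((x-1^ a ∷ []) ⊗₂ q) j i
    ≡⟨ coefficient-constant-⊗ (x-1^ a) q j i ⟩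
  coeff (x-1^ a ⊗ coeff₂ q j) i
    ≡⟨ coeff-⊗-constant (x-1^ a) (coeff₂ q j) (λ i → trans (coefficient-[y-1]^ b j (suc i)) (ℤ.*-zeroʳ (power b j))) i ⟩
  coeff (x-1^ a) i * coefficient q j 0
    ≡⟨ cong₂ _*_ (coeff-x-1^ a i) (trans (coefficient-[y-1]^ b j 0) (ℤ.*-identityʳ (power b j))) ⟩
  power a i * power b j ∎
  where
  q = [y-1] ^ b

coefficient-sum : {A : Set} (g : A → ℤ[x,y]-Poly) → ∀ xs j i →
  coefficient (foldr _⊕₂_ [] (map g xs)) j i ≡ ∑ˡ (λ x → coefficient (g x) j i) xs
coefficient-sum g []       j i = refl
coefficient-sum g (x ∷ xs) j i = trans (coefficient-⊕ (g x) (foldr _⊕₂_ [] (map g xs)) j i)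
  (cong (λ t → coefficient (g x) j i + t) (coefficient-sum g xs j i))

t-power : (G : Graph n m) → ∀ i j →
  t G (+ i) (+ j) ≡ ∑ˡ (λ A → power (ρ G ⊤ ∸ ρ G A) i * power (γ G A) j) (subsets m)
t-power {m = m} G i j = trans
  (coefficient-sum (λ A → ([x-1] ^ (ρ G ⊤ ∸ ρ G A)) ⊗₂ ([y-1] ^ γ G A)) (subsets m) j i)
  (∑ˡ-cong (λ A → coefficient-term (ρ G ⊤ ∸ ρ G A) (γ G A) j i) (subsets m))

edges : Graph n m → List (Edge n)
edges G = tabulate (ends G)

module _ {r} (G : Graph (suc r) m) (connected : Connected G) where

  private
    rk nul : Subset m → ℕ
    rk A  = rank id (restrict (ends G) A)
    nul A = nullity id (restrict (ends G) A)

  ρ-rank : ∀ A → ρ G A ≡ rk A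
  ρ-rank A = trans (cong (_∸ c G A) (sym (c-rank G A))) (ℕ.m+n∸m≡n (c G A) (rk A))

  -- Writing |A| as rank plus nullity and n as components plus rank makes the truncated subtraction
  -- cancel exactly.
  γ-nullity : ∀ A → γ G A ≡ nul A
  γ-nullity A = begin
    (∣ A ∣ ℕ.+ c G A) ∸ suc r
      ≡⟨ cong (λ k → (k ℕ.+ c G A) ∸ suc r) (trans (rank+nullity id (restrict (ends G) A)) (length-restrict (ends G) A)) ⟨
    (rk A ℕ.+ nul A ℕ.+ c G A) ∸ suc r
      ≡⟨ cong₂ _∸_ rearrange (sym (c-rank G A)) ⟩
    (c G A ℕ.+ rk A ℕ.+ nul A) ∸ (c G A ℕ.+ rk A)
      ≡⟨ ℕ.m+n∸m≡n (c G A ℕ.+ rk A) (nul A) ⟩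
    nul A ∎
    where
    rearrange : rk A ℕ.+ nul A ℕ.+ c G A ≡ c G A ℕ.+ rk A ℕ.+ nul A
    rearrange = trans (ℕ.+-comm (rk A ℕ.+ nul A) (c G A)) (sym (ℕ.+-assoc (c G A) (rk A) (nul A)))

  ρ-⊤ : ρ G ⊤ ≡ r
  ρ-⊤ = cong (suc r ∸_) (c-⊤ G connected)

  rank-≤ : ∀ A → rk A ℕ.≤ r
  rank-≤ A = ℕ.s≤s⁻¹ (subst (suc (rk A) ℕ.≤_) (c-rank G A) (ℕ.+-monoˡ-≤ (rk A) (nonempty (Transversal.covers (representatives-transversal G A) zero))))
    where
    nonempty : ∀ {A : Set} {P : A → Set} {xs} → Any P xs → 1 ℕ.≤ length xs
    nonempty (here _)  = ℕ.s≤s ℕ.z≤n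
    nonempty (there _) = ℕ.s≤s ℕ.z≤n

  -- The bound on the rank holds for edge sets of G but not for arbitrary lists, over which
  -- `∑⊆-cong` quantifies. The detour through `subsets` brings the bound in.
  ∑-sublists-cong : {F F′ : List (Edge (suc r)) → ℤ} → (∀ S → rank id S ℕ.≤ r → F S ≡ F′ S) →
    ∑⊆ F (edges G) ≡ ∑⊆ F′ (edges G)
  ∑-sublists-cong {F} {F′} eq = trans (sym (∑-subsets (ends G) F))
    (trans (∑ˡ-cong (λ A → eq (restrict (ends G) A) (rank-≤ A)) (subsets m)) (∑-subsets (ends G) F′))

  t-∑⊆ : ∀ i j → t G (+ i) (+ j) ≡ ∑⊆ (λ S → power (r ∸ rank id S) i * power (nullity id S) j) (edges G)
  t-∑⊆ i j = begin
    t G (+ i) (+ j)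
      ≡⟨ t-power G i j ⟩
    ∑ˡ (λ A → power (ρ G ⊤ ∸ ρ G A) i * power (γ G A) j) (subsets m)
      ≡⟨ ∑ˡ-cong (λ A → cong₂ (λ a b → power a i * power b j) (cong₂ _∸_ ρ-⊤ (ρ-rank A)) (γ-nullity A)) (subsets m) ⟩
    ∑ˡ (λ A → power (r ∸ rk A) i * power (nul A) j) (subsets m)
      ≡⟨ ∑-subsets (ends G) (λ S → power (r ∸ rank id S) i * power (nullity id S) j) ⟩
    _ ∎

  -- The constants are meant to be the coefficients of x^i in (x - 1)^r, (x - 1)^(r-1) and (x -
  -- 1)^(r-2), as far as these powers exist. The hypothesis on `power` includes that higher ranks
  -- contribute nothing.
  t-rankSums : ∀ i j (c₀ c₁ c₂ : ℤ) →
    (∀ k → k ℕ.≤ r → power (r ∸ k) i ≡ c₀ * (0 ≡ᶻ k) + c₁ * (1 ≡ᶻ k) + c₂ * (2 ≡ᶻ k)) →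
    t G (+ i) (+ j) ≡ c₀ * rankSum 0 j id (edges G) + c₁ * rankSum 1 j id (edges G) + c₂ * rankSum 2 j id (edges G)
  t-rankSums i j c₀ c₁ c₂ eq = begin
    t G (+ i) (+ j)
      ≡⟨ t-∑⊆ i j ⟩
    ∑⊆ (λ S → power (r ∸ rank id S) i * power (nullity id S) j) (edges G)
      ≡⟨ ∑-sublists-cong (λ S ≤r → trans (cong (_* power (nullity id S) j) (eq (rank id S) ≤r))
           (lemma c₀ c₁ c₂ (0 ≡ᶻ rank id S) (1 ≡ᶻ rank id S) (2 ≡ᶻ rank id S) (power (nullity id S) j))) ⟩
    ∑⊆ (λ S → c₀ * W 0 S + c₁ * W 1 S + c₂ * W 2 S) (edges G)
      ≡⟨ trans (∑⊆-+ (λ S → c₀ * W 0 S + c₁ * W 1 S) (λ S → c₂ * W 2 S) (edges G))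
           (cong₂ _+_ (trans (∑⊆-+ (λ S → c₀ * W 0 S) (λ S → c₁ * W 1 S) (edges G))
             (cong₂ _+_ (∑⊆-* c₀ (W 0) (edges G)) (∑⊆-* c₁ (W 1) (edges G)))) (∑⊆-* c₂ (W 2) (edges G))) ⟩
    _ ∎
    where
    W : ℕ → List (Edge (suc r)) → ℤ
    W k S = (k ≡ᶻ rank id S) * power (nullity id S) j
    lemma : ∀ a b c x y z w → (a * x + b * y + c * z) * w ≡ a * (x * w) + b * (y * w) + c * (z * w)
    lemma = solve-∀

  -- For n at most 2 some of the coefficients are 0 by convention. The formulas then follow by
  -- comparing a vanishing rank sum with its general evaluation.
  rankSum-vanishes : ∀ k j → r ℕ.< k → rankSum k j id (edges G) ≡ + 0
  rankSum-vanishes k j r<k = trans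
    (∑-sublists-cong (λ S ≤r → cong (_* power (nullity id S) j) (≡ᶻ-< k (rank id S) (ℕ.≤-<-trans ≤r r<k))))
    (trans (∑⊆-* (+ 0) (λ S → power (nullity id S) j) (edges G)) (ℤ.*-zeroˡ (∑⊆ (λ S → power (nullity id S) j) (edges G))))
    where
    ≡ᶻ-< : ∀ k s → s ℕ.< k → (k ≡ᶻ s) ≡ + 0
    ≡ᶻ-< (suc k) zero    _ = refl
    ≡ᶻ-< (suc k) (suc s) (ℕ.s≤s s<k) = ≡ᶻ-< k s s<k

-- The three highest coefficients of powers of x - 1

power-> : ∀ {a i} → a ℕ.< i → power a i ≡ + 0
power-> {zero}  {suc i} _           = refl
power-> {suc a} {suc i} (ℕ.s≤s a<i) = cong₂ _-_ (power-> a<i) (power-> (ℕ.m≤n⇒m≤1+n a<i))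

power-≡ : ∀ a → power a a ≡ + 1
power-≡ zero    = refl
power-≡ (suc a) = cong₂ _-_ (power-≡ a) (power-> (ℕ.n<1+n a))

power-1 : ∀ a → power (suc a) a ≡ - + suc a
power-1 zero    = refl
power-1 (suc a) = trans (cong₂ _-_ (power-1 a) (power-≡ (suc a))) (cong (λ k → -[1+ suc k ]) (ℕ.+-identityʳ a))

power-2 : ∀ a → power (2 ℕ.+ a) a ≡ + ((2 ℕ.+ a) C 2)
power-2 zero    = refl
power-2 (suc a) = begin
  power (2 ℕ.+ a) a - power (2 ℕ.+ a) (suc a)
    ≡⟨ cong₂ _-_ (power-2 a) (power-1 (suc a)) ⟩
  + ((2 ℕ.+ a) C 2 ℕ.+ (2 ℕ.+ a))
    ≡⟨ cong +_ (trans (ℕ.+-comm ((2 ℕ.+ a) C 2) (2 ℕ.+ a)) (cong (ℕ._+ (2 ℕ.+ a) C 2) (sym (nC1≡n (2 ℕ.+ a))))) ⟩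
  + ((2 ℕ.+ a) C 1 ℕ.+ (2 ℕ.+ a) C 2)
    ≡⟨ cong +_ (nCk+nC[k+1]≡[n+1]C[k+1] (2 ℕ.+ a) 1) ⟩
  + ((3 ℕ.+ a) C 2) ∎

-- Parallel classes and triangles of a graph

subsets-complete : (A : Subset m) → A ∈ subsets m
subsets-complete Vec.[]                     = here refl
subsets-complete {suc m} (outside Vec.∷ A) = ∈-++⁺ˡ (∈-map⁺ (outside Vec.∷_) (subsets-complete A))
subsets-complete {suc m} (inside Vec.∷ A)  = ∈-++⁺ʳ (map (outside Vec.∷_) (subsets m)) (∈-map⁺ (inside Vec.∷_) (subsets-complete A))

subsets-unique : ∀ m → Unique (subsets m)
subsets-unique zero    = [] ∷ []
subsets-unique (suc m) = Unique.++⁺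
  (Unique.map⁺ Vec.∷-injectiveʳ (subsets-unique m)) (Unique.map⁺ Vec.∷-injectiveʳ (subsets-unique m)) disjoint
  where
  disjoint : ∀ {A} → ¬ (A ∈ map (outside Vec.∷_) (subsets m) × A ∈ map (inside Vec.∷_) (subsets m))
  disjoint (p , q) with ∈-map⁻ (outside Vec.∷_) p | ∈-map⁻ (inside Vec.∷_) q
  ... | _ , _ , refl | _ , _ , ()

-- The position in A counted from the end. On the members of A it is a bijection onto the numbers
-- below |A|, so A has a member in position k just when it has more than k members.
above : Subset m → Fin m → ℕ
above (_ Vec.∷ A) zero    = ∣ A ∣
above (_ Vec.∷ A) (suc i) = above A i

above-< : {A : Subset m} → ∀ {i} → i Subset.∈ A → above A i ℕ.< ∣ A ∣
above-< Vec.here                           = ℕ.≤-refl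
above-< {A = outside Vec.∷ _} (Vec.there p) = above-< p
above-< {A = inside Vec.∷ _}  (Vec.there p) = ℕ.m≤n⇒m≤1+n (above-< p)

above-injective : {A : Subset m} → ∀ {i j} → i Subset.∈ A → j Subset.∈ A → above A i ≡ above A j → i ≡ j
above-injective Vec.here      Vec.here      _  = refl
above-injective Vec.here      (Vec.there q) eq = contradiction (sym eq) (ℕ.<⇒≢ (above-< q))
above-injective (Vec.there p) Vec.here      eq = contradiction eq (ℕ.<⇒≢ (above-< p))
above-injective (Vec.there p) (Vec.there q) eq = cong suc (above-injective p q eq)

above-surjective : (A : Subset m) → ∀ {k} → k ℕ.< ∣ A ∣ → ∃ λ i → i Subset.∈ A × above A i ≡ k
above-surjective (outside Vec.∷ A) k<A with i , i∈A , eq ← above-surjective A k<A = suc i , Vec.there i∈A , eq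
above-surjective (inside Vec.∷ A) {k} (ℕ.s≤s k≤A) with k ℕ.≟ ∣ A ∣
... | yes eq = zero , Vec.here , sym eq
... | no k≢A with i , i∈A , eq ← above-surjective A (ℕ.≤∧≢⇒< k≤A k≢A) = suc i , Vec.there i∈A , eq

classOf : (Fin m → Edge n) → Fin m → Subset m
classOf f i = Vec.tabulate λ j → does (f i ∥? f j)

∈-classOf⁺ : (f : Fin m → Edge n) → ∀ {i j} → f i ∥ f j → j Subset.∈ classOf f i
∈-classOf⁺ f {i} {j} i∥j = Vec.lookup⇒[]= j (classOf f i)
  (trans (Vec.lookup∘tabulate (λ j → does (f i ∥? f j)) j) (dec-true (f i ∥? f j) i∥j))

∈-classOf⁻ : (f : Fin m → Edge n) → ∀ {i j} → j Subset.∈ classOf f i → f i ∥ f j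
∈-classOf⁻ f {i} {j} j∈ with f i ∥? f j | trans (sym (Vec.lookup∘tabulate (λ j → does (f i ∥? f j)) j)) (Vec.[]=⇒lookup j∈)
... | yes i∥j | _  = i∥j
... | no _    | ()

later : (Fin m → Edge n) → Fin m → ℕ
later f zero    = mult (f zero) (tabulate (f ∘ suc))
later f (suc i) = later (f ∘ suc) i

mult-tabulate : (e : Edge n) (f : Fin m → Edge n) → mult e (tabulate f) ≡ ∣ Vec.tabulate (λ j → does (e ∥? f j)) ∣
mult-tabulate {m = zero}  e f = refl
mult-tabulate {m = suc m} e f with does (e ∥? f zero)
... | true  = cong suc (mult-tabulate e (f ∘ suc))
... | false = mult-tabulate e (f ∘ suc)

later-above : (f : Fin m → Edge n) → ∀ i → later f i ≡ above (classOf f i) i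
later-above f zero    = mult-tabulate (f zero) (f ∘ suc)
later-above f (suc i) = later-above (f ∘ suc) i

-- The edges followed by exactly k parallel ones: one in every parallel class
-- with more than k members.
markers : ℕ → (Fin m → Edge n) → List (Fin m)
markers k f = filter (λ i → later f i ℕ.≟ k) (allFin _)

module _ (G : Graph n m) where

  private
    f : Fin m → Edge n
    f = ends G

  ∈-classOf : ∀ i → i Subset.∈ classOf f i
  ∈-classOf i = ∈-classOf⁺ f ∥-refl

  parallelClass-classOf : ∀ i → ParallelClass G (classOf f i)
  parallelClass-classOf i =
    (i , ∈-classOf i) ,
    (λ j k j∈ k∈ → ∥-trans (∥-sym (∈-classOf⁻ f j∈)) (∈-classOf⁻ f k∈)) ,
    (λ B parallel i⊆B j∈B → ∈-classOf⁺ f (parallel i _ (i⊆B (∈-classOf i)) j∈B))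

  parallelClass⇒classOf : ∀ {A i} → ParallelClass G A → i Subset.∈ A → A ≡ classOf f i
  parallelClass⇒classOf {A} {i} (_ , parallel , maximal) i∈A = Subset.⊆-antisym A⊆ (maximal (classOf f i) all-parallel A⊆)
    where
    A⊆ : A ⊆ classOf f i
    A⊆ j∈A = ∈-classOf⁺ f (parallel i _ i∈A j∈A)
    all-parallel : AllParallel G (classOf f i)
    all-parallel = proj₁ (proj₂ (parallelClass-classOf i))

  markers-unique : ∀ k → Unique (map (classOf f) (markers k f))
  markers-unique k = AllPairs.map⁺ (distinct (All.all-filter (λ i → later f i ℕ.≟ k) (allFin m))
      (Unique.filter⁺ (λ i → later f i ℕ.≟ k) (Unique.allFin⁺ m)))
    where
    separate : ∀ {i j} → later f i ≡ k → later f j ≡ k → i ≢ j → classOf f i ≢ classOf f j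
    separate {i} {j} i≡k j≡k i≢j eq = i≢j (above-injective (∈-classOf i) (subst (j Subset.∈_) (sym eq) (∈-classOf j))
      (begin
        above (classOf f i) i ≡⟨ later-above f i ⟨
        later f i             ≡⟨ trans i≡k (sym j≡k) ⟩
        later f j             ≡⟨ later-above f j ⟩
        above (classOf f j) j ≡⟨ cong (λ A → above A j) eq ⟨
        above (classOf f i) j ∎))
    distinct : ∀ {xs} → All (λ i → later f i ≡ k) xs → Unique xs → AllPairs (λ i j → classOf f i ≢ classOf f j) xs
    distinct []         []           = []
    distinct (px ∷ pxs) (≢xs ∷ uniq) =
      All.zipWith (λ (py , x≢y) → separate px py x≢y) (pxs , ≢xs) ∷ distinct pxs uniq

  -- Both lists are free of repetitions and have the same members, though not in the same order.
  -- Comparing lengths would do for p and p*, but the sum over contractions needs the permutation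
  -- itself.
  markers-↭ : ∀ k {L} → Unique L → (∀ {A} → A ∈ L → ParallelClass G A × k ℕ.< ∣ A ∣) →
    (∀ {A} → ParallelClass G A → k ℕ.< ∣ A ∣ → A ∈ L) → L ↭ map (classOf f) (markers k f)
  markers-↭ k {L} uniq sound complete = ∼bag⇒↭ (unique∧set⇒bag uniq (markers-unique k) (mk⇔ to from))
    where
    to : ∀ {A} → A ∈ L → A ∈ map (classOf f) (markers k f)
    to {A} A∈L with pc , k<A ← sound A∈L with i , i∈A , eq ← above-surjective A k<A
      with refl ← parallelClass⇒classOf pc i∈A =
      ∈-map⁺ (classOf f) (∈-filter⁺ (λ i → later f i ℕ.≟ k) (∈-allFin i) (trans (later-above f i) eq))
    from : ∀ {A} → A ∈ map (classOf f) (markers k f) → A ∈ L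
    from A∈ with i , i∈ , refl ← ∈-map⁻ (classOf f) A∈ = complete (parallelClass-classOf i)
      (subst (ℕ._< ∣ classOf f i ∣)
        (trans (sym (later-above f i)) (proj₂ (∈-filter⁻ (λ i → later f i ℕ.≟ k) {xs = allFin m} i∈)))
        (above-< (∈-classOf i)))

  parallelClasses-unique : Unique (parallelClasses G)
  parallelClasses-unique = Unique.filter⁺ (parallelClass? G) (subsets-unique m)

  parallelClasses-sound : ∀ {A} → A ∈ parallelClasses G → ParallelClass G A
  parallelClasses-sound A∈ = proj₂ (∈-filter⁻ (parallelClass? G) {xs = subsets m} A∈)

  parallelClasses-complete : ∀ {A} → ParallelClass G A → A ∈ parallelClasses G
  parallelClasses-complete {A} pc = ∈-filter⁺ (parallelClass? G) (subsets-complete A) pc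

  parallelClass-nonempty : ∀ {A} → ParallelClass G A → 0 ℕ.< ∣ A ∣
  parallelClass-nonempty ((i , i∈A) , _) = ℕ.≤-<-trans ℕ.z≤n (above-< i∈A)

  parallelClasses-↭ : parallelClasses G ↭ map (classOf f) (markers 0 f)
  parallelClasses-↭ = markers-↭ 0 parallelClasses-unique
    (λ A∈ → parallelClasses-sound A∈ , parallelClass-nonempty (parallelClasses-sound A∈))
    (λ pc _ → parallelClasses-complete pc)

  nontrivialClasses-↭ : nontrivialClasses G ↭ map (classOf f) (markers 1 f)
  nontrivialClasses-↭ = markers-↭ 1 (Unique.filter⁺ nontrivial? parallelClasses-unique)
    -- `Nontrivial` only rules out size 1; size 0 is ruled out by the nonemptiness of a class.
    (λ A∈ → let A∈′ , nt = ∈-filter⁻ nontrivial? {xs = parallelClasses G} A∈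
                pc = parallelClasses-sound A∈′
            in pc , ℕ.≤∧≢⇒< (parallelClass-nonempty pc) (nt ∘ sym))
    (λ pc 1<A → ∈-filter⁺ nontrivial? (parallelClasses-complete pc) (ℕ.<⇒≢ 1<A ∘ sym))

sum-filter : {A : Set} {P : A → Set} (P? : Unary.Decidable P) (W : A → ℕ) (h : Fin m → A) →
  + sum (map W (filter P? (tabulate h))) ≡ ∑ λ i → 𝟙 (P? (h i)) * + W (h i)
sum-filter {m = zero}  P? W h = refl
sum-filter {m = suc m} P? W h with does (P? (h zero))
... | true  = cong₂ _+_ (sym (ℤ.*-identityˡ (+ W (h zero)))) (sum-filter P? W (h ∘ suc))
... | false = trans (sum-filter P? W (h ∘ suc)) (sym (trans (cong (_+ rest) (ℤ.*-zeroˡ (+ W (h zero)))) (ℤ.+-identityˡ rest)))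
  where
  rest = ∑ λ i → 𝟙 (P? (h (suc i))) * + W (h (suc i))

length-sum : {A : Set} → (xs : List A) → length xs ≡ sum (map (λ _ → 1) xs)
length-sum []       = refl
length-sum (x ∷ xs) = cong suc (length-sum xs)

length-filter-∑ : {A : Set} {P : A → Set} (P? : Unary.Decidable P) (h : Fin m → A) →
  + length (filter P? (tabulate h)) ≡ ∑ λ i → 𝟙 (P? (h i))
length-filter-∑ P? h = trans (cong +_ (length-sum (filter P? (tabulate h))))
  (trans (sum-filter P? (λ _ → 1) h) (sum-cong-≗ λ i → ℤ.*-identityʳ (𝟙 (P? (h i)))))

𝟙-≟0 : ∀ j → 𝟙 (j ℕ.≟ 0) ≡ is0 j
𝟙-≟0 zero    = refl
𝟙-≟0 (suc j) = refl

𝟙-≟1 : ∀ j → 𝟙 (j ℕ.≟ 1) ≡ is1 j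
𝟙-≟1 zero          = refl
𝟙-≟1 (suc zero)    = refl
𝟙-≟1 (suc (suc j)) = refl

classes-tabulate : (f : Fin m → Edge n) → (∑ λ i → is0 (later f i)) ≡ classes (tabulate f)
classes-tabulate {m = zero}  f = refl
classes-tabulate {m = suc m} f = cong (λ t → is0 (later f zero) + t) (classes-tabulate (f ∘ suc))

classes*-tabulate : (f : Fin m → Edge n) → (∑ λ i → is1 (later f i)) ≡ classes* (tabulate f)
classes*-tabulate {m = zero}  f = refl
classes*-tabulate {m = suc m} f = cong (λ t → is1 (later f zero) + t) (classes*-tabulate (f ∘ suc))

∑classes*-tabulate : (f : Fin m → Edge n) (g : Edge n → ℤ) → (∑ λ i → is1 (later f i) * g (f i)) ≡ ∑classes* g (tabulate f)
∑classes*-tabulate {m = zero}  f g = refl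
∑classes*-tabulate {m = suc m} f g = cong (λ t → is1 (later f zero) * g (f zero) + t) (∑classes*-tabulate (f ∘ suc) g)

length-markers : ∀ k (f : Fin m → Edge n) → + length (map (classOf f) (markers k f)) ≡ ∑ λ i → 𝟙 (later f i ℕ.≟ k)
length-markers k f = trans (cong +_ (length-map (classOf f) (markers k f))) (length-filter-∑ (λ i → later f i ℕ.≟ k) id)

p-classes : (G : Graph n m) → + p G ≡ classes (edges G)
p-classes G = trans (cong +_ (↭-length (parallelClasses-↭ G)))
  (trans (length-markers 0 (ends G)) (trans (sum-cong-≗ λ i → 𝟙-≟0 (later (ends G) i)) (classes-tabulate (ends G))))

p*-classes* : (G : Graph n m) → + p* G ≡ classes* (edges G)
p*-classes* G = trans (cong +_ (↭-length (nontrivialClasses-↭ G)))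
  (trans (length-markers 1 (ends G)) (trans (sum-cong-≗ λ i → 𝟙-≟1 (later (ends G) i)) (classes*-tabulate (ends G))))

sum-nontrivialClasses : (G : Graph n m) (W : Subset m → ℕ) (g : Edge n → ℤ) →
  (∀ i → + W (classOf (ends G) i) ≡ g (ends G i)) → + sum (map W (nontrivialClasses G)) ≡ ∑classes* g (edges G)
sum-nontrivialClasses G W g eq = begin
  + sum (map W (nontrivialClasses G))
    ≡⟨ cong +_ (sum-↭ (↭-map⁺ W (nontrivialClasses-↭ G))) ⟩
  + sum (map W (map (classOf f) (markers 1 f)))
    ≡⟨ cong (λ xs → + sum xs) (map-∘ (markers 1 f)) ⟨
  + sum (map (W ∘ classOf f) (markers 1 f))
    ≡⟨ sum-filter (λ i → later f i ℕ.≟ 1) (W ∘ classOf f) id ⟩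
  ∑ (λ i → 𝟙 (later f i ℕ.≟ 1) * + W (classOf f i))
    ≡⟨ sum-cong-≗ (λ i → cong₂ _*_ (𝟙-≟1 (later f i)) (eq i)) ⟩
  ∑ (λ i → is1 (later f i) * g (f i))
    ≡⟨ ∑classes*-tabulate f g ⟩
  ∑classes* g (edges G) ∎
  where
  f = ends G

-- Contraction of a parallel class

-- `classes` sees only which edges are parallel, so it can be compared across different vertex sets:
-- here the components of (V , A) and the merged copy of `Fin n`.
classes-cong : {I : Set} {n′ : ℕ} (g : I → Edge n) (h : I → Edge n′) →
  (∀ x y → g x ∥ g y → h x ∥ h y) → (∀ x y → h x ∥ h y → g x ∥ g y) →
  ∀ xs → classes (map g xs) ≡ classes (map h xs)
classes-cong g h to from []       = refl
classes-cong g h to from (x ∷ xs) = cong₂ (λ k t → is0 k + t) mult-eq (classes-cong g h to from xs)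
  where
  mult-eq : mult (g x) (map g xs) ≡ mult (h x) (map h xs)
  mult-eq = trans (length-filter-map (g x ∥?_) g xs)
    (trans (length-filter-cong (λ y → g x ∥? g y) (λ y → h x ∥? h y) (to x) (from x) xs)
      (sym (length-filter-map (h x ∥?_) h xs)))

mapᴱ-∥ : {n₁ n₂ : ℕ} (φ : Fin n → Fin n₁) (ψ : Fin n → Fin n₂) → (∀ {u v} → φ u ≡ φ v → ψ u ≡ ψ v) →
  ∀ {e f : Edge n} → Prod.map φ φ e ∥ Prod.map φ φ f → Prod.map ψ ψ e ∥ Prod.map ψ ψ f
mapᴱ-∥ φ ψ φ⇒ψ (inj₁ eq) = inj₁ (cong₂ _,_ (φ⇒ψ (cong proj₁ eq)) (φ⇒ψ (cong proj₂ eq)))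
mapᴱ-∥ φ ψ φ⇒ψ (inj₂ eq) = inj₂ (cong₂ _,_ (φ⇒ψ (cong proj₁ eq)) (φ⇒ψ (cong proj₂ eq)))

-- The class A is kept a variable: were it classOf (ends G) i, comparing types
-- that mention contract G A would unfold the decision procedures behind c G A.
module _ (G : Graph n m) (loopless : ∀ i → NonLoop (ends G i)) (i : Fin m) (A : Subset m)
  (∈A⁺ : ∀ {j} → ends G i ∥ ends G j → j Subset.∈ A) (∈A⁻ : ∀ {j} → j Subset.∈ A → ends G i ∥ ends G j) where

  private
    a = proj₁ (ends G i)
    b = proj₂ (ends G i)

  -- All edges of A join a and b, so the components of (V , A) are {a , b} and single vertices.
  -- These are the fibres of `merge a b`; the converse is `merge⇒linked`.
  linked⇒merge : ∀ {u v} → Linked G A u v → merge a b u ≡ merge a b v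
  linked⇒merge = EqClosure.gfold isEquivalence (merge a b) λ { (j , j∈A , eq) → merged (subst (ends G i ∥_) eq (∈A⁻ j∈A)) }
    where
    merged : ∀ {u v} → (a , b) ∥ (u , v) → merge a b u ≡ merge a b v
    merged (inj₁ refl) = merge-ends a b
    merged (inj₂ refl) = sym (merge-ends a b)

  merge⇒linked : ∀ {u v} → merge a b u ≡ merge a b v → Linked G A u v
  merge⇒linked {u} {v} eq with u Fin.≟ v
  ... | yes refl = EqClosure.reflexive _
  ... | no u≢v with merge-≡ a b eq u≢v
  ...   | inj₁ refl = EqClosure.return (i , ∈A⁺ ∥-refl , refl)
  ...   | inj₂ refl = EqClosure.symmetric _ (EqClosure.return (i , ∈A⁺ ∥-refl , refl))

  edges-contract : edges (contract G A) ≡ map (Prod.map (component G A) (component G A) ∘ ends G) (remaining A)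
  edges-contract = trans (sym (map-tabulate (List.lookup (remaining A)) (Prod.map (component G A) (component G A) ∘ ends G)))
    (cong (map _) (tabulate-lookup (remaining A)))

  p-contract : + p (contract G A) ≡
    classes (nonloops (map (mergeᴱ (proj₁ (ends G i)) (proj₂ (ends G i))) (edges G)))
  p-contract = begin
    + p (contract G A)
      ≡⟨ p-classes (contract G A) ⟩
    classes (edges (contract G A))
      ≡⟨ cong classes edges-contract ⟩
    classes (map (Prod.map κ κ ∘ ends G) (remaining A))
      ≡⟨ classes-cong (Prod.map κ κ ∘ ends G) (mergeᴱ a b ∘ ends G)
           (λ _ _ → mapᴱ-∥ κ (merge a b) (linked⇒merge ∘ component⇒linked G A))
           (λ _ _ → mapᴱ-∥ (merge a b) κ (linked⇒component G A ∘ merge⇒linked)) (remaining A) ⟩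
    classes (map (mergeᴱ a b ∘ ends G) (remaining A))
      -- As G has no loops, the edges that merging turns into loops are exactly those of the class
      -- A, so deleting A is the same as discarding loops.
      ≡⟨ cong (λ xs → classes (map (mergeᴱ a b ∘ ends G) xs))
           (filter-≐ (λ j → ¬? (j Subset.∈? A)) (λ j → nonLoop? (mergeᴱ a b (ends G j))) (remains , remaining⁻) (allFin m)) ⟩
    classes (map (mergeᴱ a b ∘ ends G) (filter (λ j → nonLoop? (mergeᴱ a b (ends G j))) (allFin m)))
      ≡⟨ cong classes (filter-map nonLoop? (mergeᴱ a b ∘ ends G) (allFin m)) ⟨
    classes (nonloops (map (mergeᴱ a b ∘ ends G) (allFin m)))
      ≡⟨ cong (classes ∘ nonloops) (trans (map-tabulate id (mergeᴱ a b ∘ ends G)) (sym (map-tabulate (ends G) (mergeᴱ a b)))) ⟩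
    classes (nonloops (map (mergeᴱ a b) (edges G))) ∎
    where
    κ = component G A
    remains : ∀ {j} → ¬ j Subset.∈ A → NonLoop (mergeᴱ a b (ends G j))
    remains {j} j∉A = mergeᴱ-nonLoop a b (loopless j) λ j∥i → j∉A (∈A⁺ (∥-sym j∥i))
    remaining⁻ : ∀ {j} → NonLoop (mergeᴱ a b (ends G j)) → ¬ j Subset.∈ A
    remaining⁻ nl j∈A = mergeᴱ-loop a b (∥-sym (∈A⁻ j∈A)) nl

p-contract-classOf : (G : Graph n m) → (∀ i → NonLoop (ends G i)) → ∀ i →
  + p (contract G (classOf (ends G) i)) ≡ classes (nonloops (map (mergeᴱ (proj₁ (ends G i)) (proj₂ (ends G i))) (edges G)))
p-contract-classOf G loopless i =
  p-contract G loopless i (classOf (ends G) i) (∈-classOf⁺ (ends G)) (∈-classOf⁻ (ends G))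

mult-none : (e : Edge n) → ∀ {es} → (∀ {f} → f ∈ es → ¬ e ∥ f) → mult e es ≡ 0
mult-none e {[]}     none = refl
mult-none e {f ∷ es} none = trans (mult-∦ (none (here refl)) es) (mult-none e (none ∘ there))

𝟙-adjacent : (G : Graph n m) → ∀ u v (d : Dec (Adjacent G u v)) → 𝟙 d ≡ adj (edges G) u v
𝟙-adjacent G u v (yes (e , joins)) = sym (cong (λ t → + 1 - t)
  (trans (cong is0 (mult-cong (∥-sym joins) (edges G))) (mult-∈ (∈-tabulate⁺ {f = ends G} e))))
𝟙-adjacent G u v (no ¬adj) = sym (cong (λ k → + 1 - is0 k) (mult-none (u , v) λ f∈ uv∥f →
  let e , eq = ∈-tabulate⁻ {f = ends G} f∈ in ¬adj (e , ∥-sym (subst ((u , v) ∥_) eq uv∥f))))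

simplification-adjacent⁻ : (G : Graph n m) → ∀ {u v} → Adjacent (simplification G) u v → Adjacent G u v
simplification-adjacent⁻ G (i , joins) = _ , joins

-- The class of e occurs in `parallelClasses G`, and whichever member was chosen there is parallel
-- to e.
simplification-adjacent⁺ : (G : Graph n m) → ∀ {u v} → Adjacent G u v → Adjacent (simplification G) u v
simplification-adjacent⁺ {m = m} G {u} {v} (e , joins) = i , ∥-trans (∥-sym (∈-classOf⁻ (ends G) member∈)) joins
  where
  class∈ : classOf (ends G) e ∈ parallelClasses G
  class∈ = parallelClasses-complete G (parallelClass-classOf G e)
  i : Fin (p G)
  i = index class∈
  nonempty : Subset.Nonempty (List.lookup (parallelClasses G) i)
  nonempty = proj₁ (proj₂ (∈-filter⁻ (parallelClass? G) {xs = subsets m} (∈-lookup i)))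
  member∈ : proj₁ nonempty Subset.∈ classOf (ends G) e
  member∈ = subst (proj₁ nonempty Subset.∈_) (sym (Any.lookup-index class∈)) (proj₂ nonempty)

length-filter-cartesianProduct : {A B : Set} {P : A × B → Set} (P? : Unary.Decidable P) (g : Fin m → A) (ys : List B) →
  + length (filter P? (cartesianProduct (tabulate g) ys)) ≡ ∑ λ i → + length (filter (λ y → P? (g i , y)) ys)
length-filter-cartesianProduct {m = zero}  P? g ys = refl
length-filter-cartesianProduct {m = suc m} P? g ys = begin
  + length (filter P? (map (g zero ,_) ys ++ zs))
    ≡⟨ cong (λ xs → + length xs) (filter-++ P? (map (g zero ,_) ys) zs) ⟩
  + length (filter P? (map (g zero ,_) ys) ++ filter P? zs)
    ≡⟨ cong +_ (length-++ (filter P? (map (g zero ,_) ys))) ⟩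
  + (length (filter P? (map (g zero ,_) ys)) ℕ.+ length (filter P? zs))
    ≡⟨ cong₂ (λ k t → + k + t) (length-filter-map P? (g zero ,_) ys) (length-filter-cartesianProduct P? (g ∘ suc) ys) ⟩
  _ ∎
  where
  zs = cartesianProduct (tabulate (g ∘ suc)) ys

triangles-tri : (G : Graph n m) → + triangles (simplification G) ≡ tri (edges G)
triangles-tri {n} G = begin
  + length (filter (triangle? H) (cartesianProduct (allFin n) (cartesianProduct (allFin n) (allFin n))))
    ≡⟨ length-filter-cartesianProduct (triangle? H) id (cartesianProduct (allFin n) (allFin n)) ⟩
  _ ≡⟨ sum-cong-≗ {n} (λ u → length-filter-cartesianProduct (λ y → triangle? H (u , y)) id (allFin n)) ⟩
  _ ≡⟨ sum-cong-≗ {n} (λ u → sum-cong-≗ {n} λ v → length-filter-∑ (λ w → triangle? H (u , v , w)) id) ⟩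
  ∑³ {n} (λ u v w → 𝟙 (triangle? H (u , v , w)))
    ≡⟨ ∑³-cong {n} indicator ⟩
  tri (edges G) ∎
  where
  H = simplification G
  adjacency : ∀ u v → 𝟙 (adjacent? H u v) ≡ adj (edges G) u v
  adjacency u v = trans
    (𝟙-cong (adjacent? H u v) (adjacent? G u v) (simplification-adjacent⁻ G) (simplification-adjacent⁺ G))
    (𝟙-adjacent G u v (adjacent? G u v))
  indicator : ∀ u v w → 𝟙 (triangle? H (u , v , w)) ≡ increasing u v w * (adj (edges G) u v * adj (edges G) v w * adj (edges G) u w)
  indicator u v w = trans
    (𝟙-× (u Fin.<? v ×-dec v Fin.<? w) (adjacent? H u v ×-dec adjacent? H v w ×-dec adjacent? H u w))
    (cong₂ _*_ (𝟙-× (u Fin.<? v) (v Fin.<? w))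
      (trans (𝟙-× (adjacent? H u v) (adjacent? H v w ×-dec adjacent? H u w))
        (trans (cong₂ _*_ (adjacency u v) (trans (𝟙-× (adjacent? H v w) (adjacent? H u w)) (cong₂ _*_ (adjacency v w) (adjacency u w))))
          (sym (ℤ.*-assoc (adj (edges G) u v) (adj (edges G) v w) (adj (edges G) u w))))))

-- The coefficients

edges-nonLoop : (G : Graph n m) → Loopless G → ∀ i → NonLoop (ends G i)
edges-nonLoop G loopless i eq = loopless i (proj₁ (ends G i)) (inj₁ (cong (proj₁ (ends G i) ,_) (sym eq)))

module _ (G : Graph n m) (loopless : Loopless G) where

  private
    es : List (Edge n)
    es = edges G

    nls : All NonLoop es
    nls = All.tabulate⁺ (edges-nonLoop G loopless)

    image-id : image id es ≡ es
    image-id = map-id es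

    loops-0 : loops (image id es) ≡ 0
    loops-0 = trans (cong loops image-id) (loops-none nls)

    nonloops-es : nonloops (image id es) ≡ es
    nonloops-es = trans (cong nonloops image-id) (filter-all nonLoop? nls)

  edges-rankSum-00 : rankSum 0 0 id es ≡ + 1
  edges-rankSum-00 = trans (rankSum-00 id es) (cong is0 loops-0)

  edges-rankSum-01 : rankSum 0 1 id es ≡ + 0
  edges-rankSum-01 = trans (rankSum-01 id es) (cong is1 loops-0)

  edges-rankSum-10 : rankSum 1 0 id es ≡ + p G
  edges-rankSum-10 = begin
    rankSum 1 0 id es        ≡⟨ rankSum-10 id es ⟩
    _                        ≡⟨ cong₂ (λ j N → is0 j * classes N) loops-0 nonloops-es ⟩
    + 1 * classes es         ≡⟨ ℤ.*-identityˡ (classes es) ⟩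
    classes es               ≡⟨ p-classes G ⟨
    + p G                    ∎

  edges-rankSum-11 : rankSum 1 1 id es ≡ + p* G
  edges-rankSum-11 = begin
    rankSum 1 1 id es                    ≡⟨ rankSum-11 id es ⟩
    _                                    ≡⟨ cong₂ (λ j N → is0 j * classes* N + is1 j * classes N) loops-0 nonloops-es ⟩
    + 1 * classes* es + + 0 * classes es ≡⟨ lemma (classes* es) (classes es) ⟩
    classes* es                          ≡⟨ p*-classes* G ⟨
    + p* G                               ∎
    where
    lemma : ∀ x y → + 1 * x + + 0 * y ≡ x
    lemma = solve-∀

  pairs-p : pairs es ≡ + (p G C 2)
  pairs-p with k , classes≡k , pairs≡ ← pairs-C es =
    trans pairs≡ (cong (λ j → + (j C 2)) (sym (ℤ.+-injective (trans (p-classes G) classes≡k))))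

  private
    Δ S : ℤ
    Δ = + triangles (simplification G)
    S = + sum (map (λ A → p (contract G A)) (nontrivialClasses G))

  edges-rankSum-20 : rankSum 2 0 id es ≡ + (p G C 2) - Δ
  edges-rankSum-20 = trans (rankSum-20 nls) (cong₂ _-_ pairs-p (sym (triangles-tri G)))

  S-contractions : S ≡ ∑contractions es
  S-contractions = sum-nontrivialClasses G (λ A → p (contract G A))
    (λ f → classes (nonloops (map (mergeᴱ (proj₁ f) (proj₂ f)) es)))
    (p-contract-classOf G (edges-nonLoop G loopless))

  edges-rankSum-21 : rankSum 2 1 id es ≡ S + Δ
  edges-rankSum-21 = begin
    rankSum 2 1 id es           ≡⟨ rankSum-21 nls ⟩
    ∑contractions es + tri es   ≡⟨ cong₂ _+_ S-contractions (triangles-tri G) ⟨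
    S + Δ                       ∎

module _ {r} (G : Graph (suc r) m) (connected : Connected G) (loopless : Loopless G) where

  t-top : t G (+ suc r - + 1) (+ 0) ≡ + 1
  t-top = trans (t-rankSums G connected r 0 (+ 1) (+ 0) (+ 0) top)
    (trans (cong (λ s → + 1 * s + + 0 * rankSum 1 0 id (edges G) + + 0 * rankSum 2 0 id (edges G)) (edges-rankSum-00 G loopless))
      (lemma (rankSum 1 0 id (edges G)) (rankSum 2 0 id (edges G))))
    where
    lemma : ∀ x y → + 1 * + 1 + + 0 * x + + 0 * y ≡ + 1
    lemma = solve-∀
    top : ∀ k → k ℕ.≤ r → power (r ∸ k) r ≡ + 1 * (0 ≡ᶻ k) + + 0 * (1 ≡ᶻ k) + + 0 * (2 ≡ᶻ k)
    top zero    _   = power-≡ r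
    top (suc k) k<r = trans (power-> (ℕ.∸-monoʳ-< (ℕ.s≤s ℕ.z≤n) k<r)) (zeros (is0 k) (1 ≡ᶻ k))
      where
      zeros : ∀ x y → + 0 ≡ + 1 * + 0 + + 0 * x + + 0 * y
      zeros = solve-∀

-- Rank 1 meets the leading coefficient of a monic power, and from rank 2 on the degree is below r.
-- In `third-row` the same happens one rank later.
second-row : ∀ r (c₀ : ℤ) → power (suc r) r ≡ c₀ → ∀ k → k ℕ.≤ suc r →
  power (suc r ∸ k) r ≡ c₀ * (0 ≡ᶻ k) + + 1 * (1 ≡ᶻ k) + + 0 * (2 ≡ᶻ k)
second-row r c₀ eq zero          _             = trans eq (lemma c₀)
  where
  lemma : ∀ x → x ≡ x * + 1 + + 1 * + 0 + + 0 * + 0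
  lemma = solve-∀
second-row r c₀ eq (suc zero)    _             = trans (power-≡ r) (lemma c₀)
  where
  lemma : ∀ x → + 1 ≡ x * + 0 + + 1 * + 1 + + 0 * + 0
  lemma = solve-∀
second-row r c₀ eq (suc (suc k)) (ℕ.s≤s k<r) = trans (power-> (ℕ.∸-monoʳ-< (ℕ.s≤s ℕ.z≤n) k<r)) (lemma c₀ (is0 k))
  where
  lemma : ∀ x y → + 0 ≡ x * + 0 + + 1 * + 0 + + 0 * y
  lemma = solve-∀

third-row : ∀ r (c₀ c₁ : ℤ) → power (2 ℕ.+ r) r ≡ c₀ → power (suc r) r ≡ c₁ → ∀ k → k ℕ.≤ 2 ℕ.+ r →
  power ((2 ℕ.+ r) ∸ k) r ≡ c₀ * (0 ≡ᶻ k) + c₁ * (1 ≡ᶻ k) + + 1 * (2 ≡ᶻ k)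
third-row r c₀ c₁ eq₀ eq₁ zero                _ = trans eq₀ (lemma c₀ c₁)
  where
  lemma : ∀ x y → x ≡ x * + 1 + y * + 0 + + 1 * + 0
  lemma = solve-∀
third-row r c₀ c₁ eq₀ eq₁ (suc zero)          _ = trans eq₁ (lemma c₀ c₁)
  where
  lemma : ∀ x y → y ≡ x * + 0 + y * + 1 + + 1 * + 0
  lemma = solve-∀
third-row r c₀ c₁ eq₀ eq₁ (suc (suc zero))    _ = trans (power-≡ r) (lemma c₀ c₁)
  where
  lemma : ∀ x y → + 1 ≡ x * + 0 + y * + 0 + + 1 * + 1
  lemma = solve-∀
third-row r c₀ c₁ eq₀ eq₁ (suc (suc (suc k))) (ℕ.s≤s (ℕ.s≤s k<r)) =
  trans (power-> (ℕ.∸-monoʳ-< (ℕ.s≤s ℕ.z≤n) k<r)) (lemma c₀ c₁)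
  where
  lemma : ∀ x y → + 0 ≡ x * + 0 + y * + 0 + + 1 * + 0
  lemma = solve-∀

t-second : ∀ {r} (G : Graph (suc (suc r)) m) → Connected G → ∀ j → t G (+ suc (suc r) - + 2) (+ j) ≡
  - + suc r * rankSum 0 j id (edges G) + + 1 * rankSum 1 j id (edges G) + + 0 * rankSum 2 j id (edges G)
-- With two successors visible, the integer `+ suc (suc r) - + 2` computes to `+ r`. This is why the
-- theorem is split according to n.
t-second {r = r} G connected j = trans (cong (λ i → t G i (+ j)) {x = + suc (suc r) - + 2} {y = + r} refl)
  (t-rankSums G connected r j (- + suc r) (+ 1) (+ 0) (second-row r (- + suc r) (power-1 r)))

t-third : ∀ {r} (G : Graph (suc (suc (suc r))) m) → Connected G → ∀ j → t G (+ suc (suc (suc r)) - + 3) (+ j) ≡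
  + ((2 ℕ.+ r) C 2) * rankSum 0 j id (edges G) + - + suc r * rankSum 1 j id (edges G) + + 1 * rankSum 2 j id (edges G)
t-third {r = r} G connected j = trans (cong (λ i → t G i (+ j)) {x = + suc (suc (suc r)) - + 3} {y = + r} refl)
  (t-rankSums G connected r j (+ ((2 ℕ.+ r) C 2)) (- + suc r) (+ 1)
    (third-row r (+ ((2 ℕ.+ r) C 2)) (- + suc r) (power-2 r) (power-1 r)))

-- Here and in the lemmas that follow, coefficients, rank sums and graph invariants are arbitrary
-- integers tied together by equations, so that the ring solver meets only variables.
arith-20 : ∀ {τ a b c N} s P → τ ≡ - s * a + + 1 * b + + 0 * c → a ≡ + 1 → b ≡ P → N ≡ + 1 + s → τ ≡ P - N + + 1
arith-20 {c = c} s P refl refl refl refl = lemma s P c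
  where
  lemma : ∀ s p c → - s * + 1 + + 1 * p + + 0 * c ≡ p - (+ 1 + s) + + 1
  lemma = solve-∀

arith-21 : ∀ {τ a b c} s P → τ ≡ - s * a + + 1 * b + + 0 * c → a ≡ + 0 → b ≡ P → τ ≡ P
arith-21 {c = c} s P refl refl refl = lemma s P c
  where
  lemma : ∀ s p c → - s * + 0 + + 1 * p + + 0 * c ≡ p
  lemma = solve-∀

arith-30 : ∀ {τ x y z k′ s′} k s P B D → τ ≡ k * x + - s * y + + 1 * z → x ≡ + 1 → y ≡ P → z ≡ B - D →
  k′ ≡ k → s′ ≡ s → τ ≡ k′ - s′ * P + B - D
arith-30 k s P B D refl refl refl refl refl refl = lemma k s P B D
  where
  lemma : ∀ k s p b d → k * + 1 + - s * p + + 1 * (b - d) ≡ k - s * p + b - d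
  lemma = solve-∀

arith-31 : ∀ {τ x y z s′} k s P Q D → τ ≡ k * x + - s * y + + 1 * z → x ≡ + 0 → y ≡ P → z ≡ Q + D →
  s′ ≡ s → τ ≡ - P * s′ + Q + D
arith-31 k s P Q D refl refl refl refl refl = lemma k s P Q D
  where
  lemma : ∀ k s p c d → k * + 0 + - s * p + + 1 * (c + d) ≡ - p * s + c + d
  lemma = solve-∀

arith-low-20 : ∀ {a P} → a ≡ + 0 → a ≡ P → + 0 ≡ P - + 1 + + 1
arith-low-20 refl refl = refl

arith-low-30 : ∀ {z k} s P B D → s * P ≡ + 0 → z ≡ + 0 → z ≡ B - D → k ≡ + 0 → + 0 ≡ k - s * P + B - D
arith-low-30 s P B D sP z≡0 z≡ refl = begin
  + 0                   ≡⟨ trans (sym z≡0) z≡ ⟩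
  B - D                 ≡⟨ lemma B D ⟩
  + 0 - + 0 + B - D     ≡⟨ cong (λ t → + 0 - t + B - D) sP ⟨
  + 0 - s * P + B - D   ∎
  where
  lemma : ∀ b d → b - d ≡ + 0 - + 0 + b - d
  lemma = solve-∀

arith-low-31 : ∀ {z} s P Q D → - P * s ≡ + 0 → z ≡ + 0 → z ≡ Q + D → + 0 ≡ - P * s + Q + D
arith-low-31 s P Q D Ps z≡0 z≡ = begin
  + 0               ≡⟨ trans (sym z≡0) z≡ ⟩
  Q + D             ≡⟨ cong (_+ D) (ℤ.+-identityˡ Q) ⟨
  + 0 + Q + D       ≡⟨ cong (λ t → t + Q + D) Ps ⟨
  - P * s + Q + D   ∎

module _ {r} (G : Graph (suc (suc r)) m) (connected : Connected G) (loopless : Loopless G) where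

  t-second-0 : t G (+ suc (suc r) - + 2) (+ 0) ≡ + p G - + suc (suc r) + + 1
  t-second-0 = arith-20 {c = rankSum 2 0 id (edges G)} (+ suc r) (+ p G) (t-second G connected 0) (edges-rankSum-00 G loopless) (edges-rankSum-10 G loopless) refl

  t-second-1 : t G (+ suc (suc r) - + 2) (+ 1) ≡ + p* G
  t-second-1 = arith-21 {c = rankSum 2 1 id (edges G)} (+ suc r) (+ p* G) (t-second G connected 1) (edges-rankSum-01 G loopless) (edges-rankSum-11 G loopless)

module _ {r} (G : Graph (suc (suc (suc r))) m) (connected : Connected G) (loopless : Loopless G) where

  t-third-0 : t G (+ suc (suc (suc r)) - + 3) (+ 0) ≡
    + ((suc (suc (suc r)) ∸ 1) C 2) - (+ suc (suc (suc r)) - + 2) * + p G + + (p G C 2) - + triangles (simplification G)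
  t-third-0 = arith-30 (+ ((2 ℕ.+ r) C 2)) (+ suc r) (+ p G) (+ (p G C 2)) (+ triangles (simplification G))
    (t-third G connected 0) (edges-rankSum-00 G loopless) (edges-rankSum-10 G loopless) (edges-rankSum-20 G loopless)
    (cong (λ a → + (a C 2)) {x = suc (suc (suc r)) ∸ 1} {y = 2 ℕ.+ r} refl) refl

  t-third-1 : t G (+ suc (suc (suc r)) - + 3) (+ 1) ≡
    - (+ p* G) * (+ suc (suc (suc r)) - + 2)
      + + sum (map (λ A → p (contract G A)) (nontrivialClasses G))
      + + triangles (simplification G)
  t-third-1 = arith-31 (+ ((2 ℕ.+ r) C 2)) (+ suc r) (+ p* G)
    (+ sum (map (λ A → p (contract G A)) (nontrivialClasses G))) (+ triangles (simplification G))
    (t-third G connected 1) (edges-rankSum-01 G loopless) (edges-rankSum-11 G loopless) (edges-rankSum-21 G loopless) refl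

module _ {r} (G : Graph (suc r) m) (connected : Connected G) (loopless : Loopless G) (r<2 : r ℕ.< 2) where

  -- With at most two vertices no edge set has rank 2. The evaluations of the rank 2 sums then say
  -- that C(p,2) - Δ, and in `t-low-1` the sum over contractions plus Δ, are 0, which is the formula
  -- up to terms vanishing by hypothesis.
  t-low-0 : ∀ k s → k ≡ + 0 → s * + p G ≡ + 0 →
    + 0 ≡ k - s * + p G + + (p G C 2) - + triangles (simplification G)
  t-low-0 k s k≡0 sp = arith-low-30 s (+ p G) (+ (p G C 2)) (+ triangles (simplification G)) sp
    (rankSum-vanishes G connected 2 0 r<2) (edges-rankSum-20 G loopless) k≡0

  t-low-1 : ∀ s → - (+ p* G) * s ≡ + 0 →
    + 0 ≡ - (+ p* G) * s + + sum (map (λ A → p (contract G A)) (nontrivialClasses G)) + + triangles (simplification G)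
  t-low-1 s ps = arith-low-31 s (+ p* G) (+ sum (map (λ A → p (contract G A)) (nontrivialClasses G)))
    (+ triangles (simplification G)) ps (rankSum-vanishes G connected 2 1 r<2) (edges-rankSum-21 G loopless)

theorem2 : ∀ {n m : ℕ} (G : Graph n m) → Connected G → Loopless G → Bridgeless G →
    (t G (+ n - + 1) (+ 0) ≡ + 1)
    × (t G (+ n - + 2) (+ 0) ≡ + p G - + n + + 1)
    × (t G (+ n - + 3) (+ 0) ≡
    + ((n ∸ 1) C 2) - (+ n - + 2) * + p G + + (p G C 2) - + triangles (simplification G))
    × (t G (+ n - + 2) (+ 1) ≡ + p* G)
    × (t G (+ n - + 3) (+ 1) ≡
    - (+ p* G) * (+ n - + 2)
    + + sum (map (λ A → p (contract G A)) (nontrivialClasses G))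
    + + triangles (simplification G))
theorem2 {zero} G (() , _) _ _
-- For one vertex n - 2 and n - 3 are negative, so four of the coefficients are 0 by convention. No
-- edge set has rank 1 (`vanish`), which makes p and p* zero.
theorem2 {suc zero} G connected loopless _ =
    t-top G connected loopless
  , arith-low-20 (vanish 0) (edges-rankSum-10 G loopless)
  , t-low-0 G connected loopless (ℕ.s≤s ℕ.z≤n) (+ ((1 ∸ 1) C 2)) (+ 1 - + 2) refl
      (trans (cong ((+ 1 - + 2) *_) (trans (sym (edges-rankSum-10 G loopless)) (vanish 0))) refl)
  , trans (sym (vanish 1)) (edges-rankSum-11 G loopless)
  , t-low-1 G connected loopless (ℕ.s≤s ℕ.z≤n) (+ 1 - + 2)
      (trans (cong (λ q → - q * (+ 1 - + 2)) (trans (sym (edges-rankSum-11 G loopless)) (vanish 1))) refl)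
  where
  vanish : ∀ j → rankSum 1 j id (edges G) ≡ + 0
  vanish j = rankSum-vanishes G connected 1 j (ℕ.s≤s ℕ.z≤n)
-- For two vertices only n - 3 is negative, and the factor n - 2 is 0.
theorem2 {suc (suc zero)} G connected loopless _ =
    t-top G connected loopless
  , t-second-0 G connected loopless
  , t-low-0 G connected loopless (ℕ.s≤s (ℕ.s≤s ℕ.z≤n)) (+ ((2 ∸ 1) C 2)) (+ 2 - + 2) refl (ℤ.*-zeroˡ (+ p G))
  , t-second-1 G connected loopless
  , t-low-1 G connected loopless (ℕ.s≤s (ℕ.s≤s ℕ.z≤n)) (+ 2 - + 2) (ℤ.*-zeroʳ (- (+ p* G)))
theorem2 {suc (suc (suc r))} G connected loopless _ =
    t-top G connected loopless
  , t-second-0 G connected loopless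
  , t-third-0 G connected loopless
  , t-second-1 G connected loopless
  , t-third-1 G connected loopless
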